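{- Let $p\ge5$ be a prime with $p\equiv 1\pmod 3$. Let $J\in\mathbb{F}_p$ with $J\neq\pm2,-1$ and $J^2\neq 4/3$, and assume $\dfrac{J+1}{J-2}=T^3$ for some $T\in\mathbb{F}_p^*$. Put $C=3J^2-4$, $D=9J^3-36J-28$. Then the Vieta graph of the cubic $x^2+y^2+z^2=xyz-C(x+y+z)+D$ over $\mathbb{F}_p$ has $p^2+1+4\sigma(1-4T^3)p$ vertices in total, of which $3\big(p-6+2\sigma(T^4-T)A_3(p)\big)$ are deficient; there are $3\big(p-9+2\sigma(T^4-T)A_3(p)\big)$ vertices of degree $2$, $9$ vertices of degree $1$, and $0$ vertices of degree $0$.
   Context: $\sigma:\mathbb{F}_p\to\{ -1,0,1\}\subset\mathbb{Z}$ denotes the quadratic character: $\sigma(a)=1$ if $a$ is a nonzero square, $\sigma(a)=-1$ if $a$ is a non-square, $\sigma(0)=0$. For a prime $p\equiv1\pmod 3$, $A_3(p)$ is the integer $A$ determined by writing $p=A^2+3B^2$ with $A,B\in\mathbb{Z}$ and $A\equiv-1\pmod 3$. The Vieta graph of the equation $x^2+y^2+z^2=xyz-C(x+y+z)+D$ over $\mathbb{F}_p$ is the finite simple graph whose vertices are the solutions $(x,y,z)\in\mathbb{F}_p^3$, where two distinct vertices are joined by an edge whenever one is a Vieta flip of the other. The Vieta flips of $(x,y,z)$ are $(yz-C-x,y,z)$, $(x,xz-C-y,z)$, $(x,y,xy-C-z)$. Every vertex has degree at most $3$; a vertex is deficient if its degree is less than $3$. -}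

module Defs where

open import Data.Nat.Base as ℕ using (ℕ; zero; suc; NonZero; _∸_)
open import Data.Nat.DivMod using (_mod_)
open import Data.Nat.Properties using (_<?_) renaming (_≟_ to _≟ℕ_)
open import Data.Integer.Base as ℤ using (ℤ; +_; -[1+_])
open import Data.Integer.Divisibility using (_∣_)
open import Data.Fin.Base using (Fin; toℕ)
open import Data.Fin.Properties using (_≟_; any?)
open import Data.List.Base using (List; []; _∷_; length; filter; allFin; cartesianProduct)
open import Data.List.Membership.Propositional using (_∈_)
open import Data.Product.Base using (_×_; _,_; ∃-syntax)
open import Data.Product.Properties using (≡-dec)
open import Data.Sum.Base using (_⊎_)
open import Relation.Binary.Definitions using (Decidable; DecidableEquality)
open import Relation.Binary.PropositionalEquality using (_≡_; _≢_)
open import Relation.Nullary using (yes; no; ¬?; _×-dec_; _⊎-dec_)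
import Relation.Unary as U
import Data.List.Membership.DecPropositional as DecMembership

-- IsA₃ p A says that A = A₃(p); such an A exists and is unique for every
-- prime p ≡ 1 (mod 3).
IsA₃ : ℕ → ℤ → Set
IsA₃ p A =
  (∃[ B ] + p ≡ A ℤ.* A ℤ.+ + 3 ℤ.* (B ℤ.* B)) × (+ 3 ∣ A ℤ.+ + 1)

-- Arithmetic of ℤ/p, with each residue class represented by its element of
-- {0,…,p-1}; it is the field 𝔽_p when p is prime.
module PrimeField (p : ℕ) .{{_ : NonZero p}} where

  𝔽 : Set
  𝔽 = Fin p

  infixr 8 _^_
  infix  8 -_
  infixl 7 _*_ _/_
  infixl 6 _+_ _-_

  ι : ℕ → 𝔽
  ι n = n mod p

  _+_ : 𝔽 → 𝔽 → 𝔽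
  a + b = (toℕ a ℕ.+ toℕ b) mod p

  _*_ : 𝔽 → 𝔽 → 𝔽
  a * b = (toℕ a ℕ.* toℕ b) mod p

  -_ : 𝔽 → 𝔽
  - a = (p ∸ toℕ a) mod p

  _-_ : 𝔽 → 𝔽 → 𝔽
  a - b = a + (- b)

  _^_ : 𝔽 → ℕ → 𝔽
  a ^ zero  = ι 1
  a ^ suc n = a * (a ^ n)

  -- Total by the convention that non-units (for p prime, only 0) have inverse 0.
  inv : 𝔽 → 𝔽
  inv a with any? (λ x → a * x ≟ ι 1)
  ... | yes (x , _) = x
  ... | no _        = ι 0

  _/_ : 𝔽 → 𝔽 → 𝔽
  a / b = a * inv b

  σ : 𝔽 → ℤ
  σ a with a ≟ ι 0 | any? (λ x → x * x ≟ a)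
  ... | yes _ | _     = + 0
  ... | no _  | yes _ = + 1
  ... | no _  | no _  = -[1+ 0 ]

  -- The Vieta graph of x² + y² + z² = xyz - C(x + y + z) + D.
  module VietaGraph (C D : 𝔽) where

    Point : Set
    Point = 𝔽 × 𝔽 × 𝔽

    _≟ₚ_ : DecidableEquality Point
    _≟ₚ_ = ≡-dec _≟_ (≡-dec _≟_ _≟_)

    open DecMembership _≟ₚ_ using (_∈?_)

    IsSolution : Point → Set
    IsSolution (x , y , z) =
      x ^ 2 + y ^ 2 + z ^ 2 ≡ x * y * z - C * (x + y + z) + D

    isSolution? : U.Decidable IsSolution
    isSolution? (x , y , z) =
      x ^ 2 + y ^ 2 + z ^ 2 ≟ x * y * z - C * (x + y + z) + D

    -- A duplicate-free enumeration of the vertex set.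
    vertices : List Point
    vertices = filter isSolution?
      (cartesianProduct (allFin p) (cartesianProduct (allFin p) (allFin p)))

    flips : Point → List Point
    flips (x , y , z) =
        (y * z - C - x , y , z)
      ∷ (x , x * z - C - y , z)
      ∷ (x , y , x * y - C - z)
      ∷ []

    Adjacent : Point → Point → Set
    Adjacent v w = v ≢ w × (w ∈ flips v ⊎ v ∈ flips w)

    adjacent? : Decidable Adjacent
    adjacent? v w = ¬? (v ≟ₚ w) ×-dec ((w ∈? flips v) ⊎-dec (v ∈? flips w))

    degree : Point → ℕ
    degree v = length (filter (adjacent? v) vertices)

    Deficient : Point → Set
    Deficient v = degree v ℕ.< 3

    deficient? : U.Decidable Deficient
    deficient? v = degree v <? 3

    #vertices : ℕ
    #vertices = length vertices

    #deficient : ℕ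
    #deficient = length (filter deficient? vertices)

    #degree : ℕ → ℕ
    #degree d = length (filter (λ v → degree v ≟ℕ d) vertices)

{-# OPTIONS --safe #-}
module Submission where

-- Write m = J - 2 and n = J + 2, so that m (T³ - 1) = 3.  On the surface, y is determined by x and z up
-- to a quadratic equation whose discriminant disc x z is itself quadratic in z, with discriminant
-- 16 (x + 2) f x for a monic cubic f.  After the substitution x + 2 = n t, v = 3/t - 1 one has
-- f x = 0 iff v³ = -T³, and (x + 2) f x agrees with 3m (v³ + T³) up to nonzero squares.
-- Summing the quadratic character over z and x counts the vertices.  The points fixed by one flip lie over
-- disc = 0, and counting them leads to the sum S of σ (x³ + 1).  Points fixed by two flips correspond to the
-- three roots of f, and no point is fixed by all three.  Distinct non-trivial flips give distinct neighbours,
-- so these numbers determine the degrees.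
--
-- Finally S = 2 A₃: for a non-cube h and g = h², the sums S a of σ (x³ + a) satisfy
-- S 1 + S g + S g² = 0 and S 1² + S g² + S (g²)² = 6p, whence S 1² + S 1 S g + S g² = 3p; since S 1 is even
-- and ≡ 1 mod 3 this is a representation p = A² + 3B², and such a representation is unique.

open import Defs
open import Data.Nat.Base as ℕ using (ℕ; zero; suc; NonZero; _≥_; _%_; _∸_)
open import Data.Nat.Coprimality using (prime⇒coprime; coprime-Bézout)
import Data.Nat.Divisibility as ℕ
open import Data.Nat.DivMod using (m%n<n; n%n≡0; m<n⇒m%n≡m; %-distribˡ-+; %-distribˡ-*)
open import Data.Nat.GCD using (module Bézout)
open import Data.Nat.Primality using (Prime; prime?; euclidsLemma; prime⇒nonZero; prime⇒nonTrivial)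
import Data.Nat.Properties as ℕₚ
open import Data.Integer.Base as ℤ using (ℤ; +_; -[1+_]; _⊖_)
open import Data.Integer.Divisibility.Signed using (_∣_; divides; ∣m∣n⇒∣m+n; ∣m∣n⇒∣m-n; ∣m⇒∣m*n; ∣⇒∣ᵤ; ∣ᵤ⇒∣)
import Data.Integer.Properties as ℤₚ
import Data.Integer.Solver as ℤSolver
open import Data.Bool.Base using (if_then_else_)
open import Data.Fin.Base using (Fin; zero; suc; toℕ)
open import Data.Fin.Permutation using (permutation)
open import Data.Fin.Properties using (_≟_; any?; ¬∀⟶∃¬; toℕ-injective; toℕ-fromℕ<; toℕ<n)
open import Data.List.Base using (List; []; _∷_; _++_; length; filter; map; tabulate; allFin; cartesianProduct)
open import Data.List.Membership.Propositional using (_∈_)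
open import Data.List.Membership.Propositional.Properties using (∈-filter⁺; ∈-filter⁻; ∈-cartesianProduct⁺; ∈-allFin; ∈-++⁺ˡ; ∈-++⁺ʳ; ∈-++⁻; ∈-∃++)
open import Data.List.Properties using (length-++)
open import Data.List.Relation.Binary.Subset.Propositional using (_⊆_)
open import Data.List.Relation.Unary.All as All using (All; []; _∷_)
open import Data.List.Relation.Unary.AllPairs using ([]; _∷_)
open import Data.List.Relation.Unary.Any using (here; there)
open import Data.List.Relation.Unary.Unique.Propositional using (Unique)
import Data.List.Relation.Unary.Unique.Propositional.Properties as Unique
open import Data.Maybe.Base using (Maybe; just; nothing)
open import Data.Product.Base using (_×_; _,_; proj₁; proj₂; ∃-syntax)
open import Data.Sum.Base using (_⊎_; inj₁; inj₂; [_,_]′)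
open import Algebra.Bundles using (CommutativeRing; Ring)
open import Algebra.Consequences.Propositional using (comm∧idˡ⇒id; comm∧invʳ⇒inv)
open import Algebra.Core using (Op₁; Op₂)
import Algebra.Properties.AbelianGroup ℤₚ.+-0-abelianGroup as ℤ+
import Algebra.Properties.Ring as RingProperties
import Algebra.Properties.Semiring.Exp as Exp
open import Algebra.Properties.Semiring.Sum ℤₚ.+-*-semiring using (sum; sum-cong-≗; ∑-distrib-+; ∑-comm; *-distribˡ-sum; *-distribʳ-sum; sum-permute)
import Algebra.Solver.Ring as RingSolver
open import Algebra.Solver.Ring.AlmostCommutativeRing using (_-Raw-AlmostCommutative⟶_; fromCommutativeRing)
open import Algebra.Structures using (IsCommutativeRing)
open import Function.Base using (_∘_; id)
open import Level using (0ℓ)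
open import Relation.Binary.PropositionalEquality
open import Relation.Nullary using (Dec; yes; no; does; contradiction; ¬_; _×-dec_)
open import Relation.Nullary.Decidable using (from-yes; from-no)
import Relation.Unary as U

-- Indicators and finite sums of integers

-- The multiplicative group is never shown to be cyclic, and no cubic character or Jacobi sum is
-- formed. What a generator would give (two nonsquares multiply to a square, the cubes have index 3)
-- comes from tallies: a pointwise inequality between two functions with equal sums is an equality.
-- The cosets of the cubes get the representatives 1, g, g² with g = h² because a square can be
-- scaled out of σ: S (s²) becomes a sum of σ (a + 1) weighted by the number of cube roots of s² a,
-- and over the three cosets these weights add up to 3. A₃ enters because y² = (x + 2) f x is a
-- curve of genus 1, the quadratic twist by 3mT of y² = x³ + 1. The parameters C and D are such that
-- f, expanded at x = -2 and reversed, is a cube plus a constant. The fractional linear substitution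
-- that shows this sends x = -2 to infinity; under the convention 1/0 = 0 it is a permutation of the
-- field, so sums can be reindexed by it at the cost of one correction term at x = -2.

𝟙 : ∀ {ℓ} {P : Set ℓ} → Dec P → ℤ
𝟙 d = if does d then + 1 else + 0

module _ {ℓ} {P : Set ℓ} where

  𝟙-yes : (d : Dec P) → P → 𝟙 d ≡ + 1
  𝟙-yes (yes _) _ = refl
  𝟙-yes (no ¬p) p = contradiction p ¬p

  𝟙-no : (d : Dec P) → ¬ P → 𝟙 d ≡ + 0
  𝟙-no (yes p) ¬p = contradiction p ¬p
  𝟙-no (no _)  _  = refl

  𝟙-cong : ∀ {ℓ′} {Q : Set ℓ′} (d : Dec P) (e : Dec Q) → (P → Q) → (Q → P) → 𝟙 d ≡ 𝟙 e
  𝟙-cong d (yes q) _ Q→P = 𝟙-yes d (Q→P q)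
  𝟙-cong d (no ¬q) P→Q _ = 𝟙-no d (¬q ∘ P→Q)

  𝟙-× : ∀ {ℓ′} {Q : Set ℓ′} (d : Dec P) (e : Dec Q) → 𝟙 (d ×-dec e) ≡ 𝟙 d ℤ.* 𝟙 e
  𝟙-× (yes _) e = sym (ℤₚ.*-identityˡ (𝟙 e))
  𝟙-× (no _)  e = refl

  𝟙-*-cong : (d : Dec P) {a b : ℤ} → (P → a ≡ b) → 𝟙 d ℤ.* a ≡ 𝟙 d ℤ.* b
  𝟙-*-cong (yes p) eq = cong (+ 1 ℤ.*_) (eq p)
  𝟙-*-cong (no _)  eq = refl

module _ {n : ℕ} where

  sum-+ : (f g : Fin n → ℤ) → sum (λ i → f i ℤ.+ g i) ≡ sum f ℤ.+ sum g
  sum-+ = ∑-distrib-+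

  sum-* : (c : ℤ) (f : Fin n → ℤ) → sum (λ i → c ℤ.* f i) ≡ c ℤ.* sum f
  sum-* c f = sym (*-distribˡ-sum c f)

  sum-neg : (f : Fin n → ℤ) → sum (λ i → ℤ.- f i) ≡ ℤ.- sum f
  sum-neg f = trans (sum-cong-≗ (λ i → sym (ℤₚ.-1*i≡-i (f i))))
    (trans (sum-* (ℤ.- + 1) f) (ℤₚ.-1*i≡-i (sum f)))

  sum-− : (f g : Fin n → ℤ) → sum (λ i → f i ℤ.- g i) ≡ sum f ℤ.- sum g
  sum-− f g = trans (sum-+ f (ℤ.-_ ∘ g)) (cong₂ ℤ._+_ (refl {x = sum f}) (sum-neg g))

  sum-reindex : (φ ψ : Fin n → Fin n) → (∀ i → φ (ψ i) ≡ i) → (∀ i → ψ (φ i) ≡ i) →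
    (f : Fin n → ℤ) → sum (f ∘ φ) ≡ sum f
  sum-reindex φ ψ φψ ψφ f = sym (sum-permute f (permutation φ ψ φψ ψφ))

  sum-∣ : {d : ℤ} (f : Fin n → ℤ) → (∀ i → d ∣ f i) → d ∣ sum f
  sum-∣ = go n
    where
    go : ∀ n {d} (f : Fin n → ℤ) → (∀ i → d ∣ f i) → d ∣ sum f
    go zero    f _ = divides (+ 0) refl
    go (suc n) f h = ∣m∣n⇒∣m+n (h zero) (go n (f ∘ suc) (h ∘ suc))

  sum-𝟙-≡ : (a : Fin n) (f : Fin n → ℤ) → sum (λ i → 𝟙 (i ≟ a) ℤ.* f i) ≡ f a
  sum-𝟙-≡ = go
    where
    sum-0 : ∀ {n} → sum {n} (λ _ → + 0) ≡ + 0
    sum-0 {zero}  = refl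
    sum-0 {suc n} = cong₂ ℤ._+_ (refl {x = + 0}) (sum-0 {n})
    go : ∀ {n} (a : Fin n) (f : Fin n → ℤ) → sum (λ i → 𝟙 (i ≟ a) ℤ.* f i) ≡ f a
    go {suc n} zero    f = trans (cong₂ ℤ._+_ (ℤₚ.*-identityˡ (f zero)) (sum-0 {n})) (ℤₚ.+-identityʳ (f zero))
    go {suc n} (suc a) f = trans (ℤₚ.+-identityˡ _) (trans
      (sum-cong-≗ (λ i → cong (ℤ._* f (suc i)) (𝟙-cong (suc i ≟ suc a) (i ≟ a) (λ { refl → refl }) (cong suc))))
      (go a (f ∘ suc)))

  sum-𝟙 : (a : Fin n) → sum (λ i → 𝟙 (i ≟ a)) ≡ + 1
  sum-𝟙 a = trans (sum-cong-≗ {n} (λ i → sym (ℤₚ.*-identityʳ (𝟙 (i ≟ a))))) (sum-𝟙-≡ a (λ _ → + 1))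

sum-comm : ∀ {m n} (f : Fin m → Fin n → ℤ) →
  sum (λ i → sum (λ j → f i j)) ≡ sum (λ j → sum (λ i → f i j))
sum-comm = ∑-comm

sum-fibres : ∀ {m n} (h : Fin m → Fin n) (f : Fin n → ℤ) →
  sum (f ∘ h) ≡ sum (λ a → sum (λ x → 𝟙 (h x ≟ a)) ℤ.* f a)
sum-fibres {m} {n} h f = sym (begin
  sum (λ a → sum (λ x → 𝟙 (h x ≟ a)) ℤ.* f a)     ≡⟨ sum-cong-≗ {n} (λ a → *-distribʳ-sum (f a) (λ x → 𝟙 (h x ≟ a))) ⟩
  sum (λ a → sum (λ x → 𝟙 (h x ≟ a) ℤ.* f a))     ≡⟨ sum-comm (λ a x → 𝟙 (h x ≟ a) ℤ.* f a) ⟩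
  sum (λ x → sum (λ a → 𝟙 (h x ≟ a) ℤ.* f a))     ≡⟨ sum-cong-≗ {m} (λ x → sum-cong-≗ {n} (λ a →
                                                       cong (ℤ._* f a) (𝟙-cong (h x ≟ a) (a ≟ h x) sym sym))) ⟩
  sum (λ x → sum (λ a → 𝟙 (a ≟ h x) ℤ.* f a))     ≡⟨ sum-cong-≗ {m} (λ x → sum-𝟙-≡ (h x) f) ⟩
  sum (f ∘ h)                                     ∎)
  where open ≡-Reasoning

sum-const : ∀ n (c : ℤ) → sum {n} (λ _ → c) ≡ + n ℤ.* c
sum-const zero    c = refl
sum-const (suc n) c = trans (cong₂ ℤ._+_ (refl {x = c}) (sum-const n c)) (sym (ℤₚ.suc-* (+ n) c))

sum-mono : ∀ {n} (f g : Fin n → ℤ) → (∀ i → f i ℤ.≤ g i) → sum f ℤ.≤ sum g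
sum-mono {zero}  f g _ = ℤₚ.≤-refl
sum-mono {suc n} f g h = ℤₚ.+-mono-≤ (h zero) (sum-mono (f ∘ suc) (g ∘ suc) (h ∘ suc))

sum-1 : ∀ n → sum {n} (λ _ → + 1) ≡ + n
sum-1 n = trans (sum-const n (+ 1)) (ℤₚ.*-identityʳ (+ n))

sum-0 : ∀ n → sum {n} (λ _ → + 0) ≡ + 0
sum-0 n = trans (sum-const n (+ 0)) (ℤₚ.*-zeroʳ (+ n))

-- One strict inequality would already make the sums differ. This gives the multiplicativity of σ,
-- the existence of a noncube and the fact that three cosets of the cubes exhaust the nonzero
-- elements.
pointwise-≤∧sum-≡⇒≡ : ∀ {n} {f g : Fin n → ℤ} →
  (∀ i → f i ℤ.≤ g i) → sum f ≡ sum g → ∀ i → f i ≡ g i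
pointwise-≤∧sum-≡⇒≡ {suc n} {f} {g} f≤g eq = λ
  { zero    → head≡
  ; (suc i) → pointwise-≤∧sum-≡⇒≡ (f≤g ∘ suc) tail≡ i }
  where
  Σf Σg : ℤ
  Σf = sum (f ∘ suc)
  Σg = sum (g ∘ suc)
  Σf≤Σg : Σf ℤ.≤ Σg
  Σf≤Σg = sum-mono (f ∘ suc) (g ∘ suc) (f≤g ∘ suc)
  head≡ : f zero ≡ g zero
  head≡ = ℤₚ.≤-antisym (f≤g zero) (ℤₚ.≮⇒≥ λ lt →
    ℤₚ.<-irrefl eq (ℤₚ.+-mono-<-≤ lt Σf≤Σg))
  tail≡ : Σf ≡ Σg
  tail≡ = ℤₚ.≤-antisym Σf≤Σg (ℤₚ.≮⇒≥ λ lt →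
    ℤₚ.<-irrefl eq (ℤₚ.+-mono-≤-< (f≤g zero) lt))

sum³ : ∀ {n} → (Fin n → Fin n → Fin n → ℤ) → ℤ
sum³ g = sum (λ x → sum (λ y → sum (λ z → g x y z)))

module _ {n : ℕ} where

  sum³-cong : {g h : Fin n → Fin n → Fin n → ℤ} → (∀ x y z → g x y z ≡ h x y z) → sum³ g ≡ sum³ h
  sum³-cong eq = sum-cong-≗ {n} (λ x → sum-cong-≗ {n} (λ y → sum-cong-≗ {n} (λ z → eq x y z)))

  sum³-swap₁₂ : (g : Fin n → Fin n → Fin n → ℤ) → sum³ (λ x y z → g y x z) ≡ sum³ g
  sum³-swap₁₂ g = sum-comm (λ x y → sum (λ z → g y x z))

  sum³-swap₂₃ : (g : Fin n → Fin n → Fin n → ℤ) → sum³ (λ x y z → g x z y) ≡ sum³ g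
  sum³-swap₂₃ g = sum-cong-≗ {n} (λ x → sum-comm (λ y z → g x z y))

  sum³-rotate : (g : Fin n → Fin n → Fin n → ℤ) → sum³ (λ x y z → g z x y) ≡ sum³ g
  sum³-rotate g = trans (sum³-swap₂₃ (λ x z y → g z x y)) (sum³-swap₁₂ g)

  sum³-+ : (g h : Fin n → Fin n → Fin n → ℤ) → sum³ (λ x y z → g x y z ℤ.+ h x y z) ≡ sum³ g ℤ.+ sum³ h
  sum³-+ g h = trans
    (sum-cong-≗ {n} (λ x → trans (sum-cong-≗ {n} (λ y → sum-+ (g x y) (h x y)))
      (sum-+ (λ y → sum (g x y)) (λ y → sum (h x y)))))
    (sum-+ (λ x → sum (λ y → sum (g x y))) (λ x → sum (λ y → sum (h x y))))

  sum³-* : ∀ k (g : Fin n → Fin n → Fin n → ℤ) → sum³ (λ x y z → k ℤ.* g x y z) ≡ k ℤ.* sum³ g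
  sum³-* k g = trans
    (sum-cong-≗ {n} (λ x → trans (sum-cong-≗ {n} (λ y → sum-* k (g x y))) (sum-* k (λ y → sum (g x y)))))
    (sum-* k (λ x → sum (λ y → sum (g x y))))

private
  weightℤ : ℤ → ℤ → ℤ → ℤ → ℤ
  weightℤ k a b c = a ℤ.+ b ℤ.+ c ℤ.+ k ℤ.* (a ℤ.* b ℤ.+ a ℤ.* c ℤ.+ b ℤ.* c)

-- If j of the three hold and j ≤ 2, this is j + k (j choose 2).
weight : ∀ {P₁ P₂ P₃ : Set} → ℤ → Dec P₁ → Dec P₂ → Dec P₃ → ℤ
weight k d₁ d₂ d₃ = weightℤ k (𝟙 d₁) (𝟙 d₂) (𝟙 d₃)

weight-cong : ∀ {P₁ P₂ P₃ Q₁ Q₂ Q₃ : Set} k {d₁ : Dec P₁} {d₂ : Dec P₂} {d₃ : Dec P₃} {e₁ : Dec Q₁} {e₂ : Dec Q₂} {e₃ : Dec Q₃} →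
  𝟙 d₁ ≡ 𝟙 e₁ → 𝟙 d₂ ≡ 𝟙 e₂ → 𝟙 d₃ ≡ 𝟙 e₃ → weight k d₁ d₂ d₃ ≡ weight k e₁ e₂ e₃
weight-cong k {d₁} {d₂} {d₃} {e₁} {e₂} {e₃} eq₁ eq₂ eq₃ = trans (cong (λ a → weightℤ k a (𝟙 d₂) (𝟙 d₃)) eq₁)
  (cong₂ (weightℤ k (𝟙 e₁)) eq₂ eq₃)

-- Finite fields

-- The counting argument uses residues modulo p only through these axioms. With `inv-0`, `inv` is an
-- involution of the whole field, so that sums may be reindexed by it.
record FiniteField (p : ℕ) : Set where
  infix  8 -_
  infixl 7 _*_
  infixl 6 _+_
  field
    _+_ _*_ : Op₂ (Fin p)
    -_ inv  : Op₁ (Fin p)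
    ι       : ℕ → Fin p
    isCommutativeRing : IsCommutativeRing _≡_ _+_ _*_ -_ (ι 0) (ι 1)
    ι-+ : ∀ m n → ι (m ℕ.+ n) ≡ ι m + ι n
    ι-* : ∀ m n → ι (m ℕ.* n) ≡ ι m * ι n
    1≢0 : ι 1 ≢ ι 0
    *-invʳ : ∀ {a} → a ≢ ι 0 → a * inv a ≡ ι 1
    inv-0  : inv (ι 0) ≡ ι 0

module FieldProperties {p : ℕ} (K : FiniteField p) where
  open FiniteField K

  𝔽 : Set
  𝔽 = Fin p

  commutativeRing : CommutativeRing 0ℓ 0ℓ
  commutativeRing = record { isCommutativeRing = isCommutativeRing }

  open CommutativeRing commutativeRing public
    using (ring; semiring; _-_; +-congˡ; +-congʳ; *-congˡ; *-congʳ; +-identityˡ; +-identityʳ; +-assoc; +-comm; *-assoc; *-comm;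
           *-identityˡ; *-identityʳ; zeroˡ; zeroʳ; distribˡ; -‿inverseˡ; -‿inverseʳ)
  open RingProperties ring public using (-‿distribˡ-*; -‿distribʳ-*; -‿involutive; -0#≈0#; -‿+-comm)
  open Exp semiring public using (_^_)

  -- The canonical ring homomorphism. Through it the polynomial identities below are identities over
  -- ℤ and hold in every characteristic.
  φ : ℤ → 𝔽
  φ (+ n)    = ι n
  φ -[1+ n ] = - ι (suc n)

  [a+b]-[a+c]≡b-c : ∀ a b c → (a + b) - (a + c) ≡ b - c
  [a+b]-[a+c]≡b-c a b c = begin
    (a + b) + - (a + c)       ≡⟨ cong (_+ - (a + c)) (+-comm a b) ⟩
    (b + a) + - (a + c)       ≡⟨ +-congˡ (sym (-‿+-comm a c)) ⟩
    (b + a) + (- a + - c)     ≡⟨ +-assoc b a _ ⟩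
    b + (a + (- a + - c))     ≡⟨ +-congˡ (sym (+-assoc a (- a) (- c))) ⟩
    b + ((a + - a) + - c)     ≡⟨ cong (λ x → b + (x + - c)) (-‿inverseʳ a) ⟩
    b + (ι 0 + - c)           ≡⟨ +-congˡ (+-identityˡ (- c)) ⟩
    b - c                     ∎
    where open ≡-Reasoning

  φ-⊖ : ∀ m n → φ (m ⊖ n) ≡ ι m - ι n
  φ-⊖ m zero = sym (trans (+-congˡ -0#≈0#) (+-identityʳ (ι m)))
  φ-⊖ zero (suc n) = sym (+-identityˡ _)
  φ-⊖ (suc m) (suc n) = begin
    φ (suc m ⊖ suc n)              ≡⟨ cong φ (ℤₚ.[1+m]⊖[1+n]≡m⊖n m n) ⟩
    φ (m ⊖ n)                      ≡⟨ φ-⊖ m n ⟩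
    ι m - ι n                      ≡⟨ [a+b]-[a+c]≡b-c (ι 1) (ι m) (ι n) ⟨
    (ι 1 + ι m) - (ι 1 + ι n)      ≡⟨ cong₂ _-_ (ι-+ 1 m) (ι-+ 1 n) ⟨
    ι (suc m) - ι (suc n)          ∎
    where open ≡-Reasoning

  φ-+ : ∀ i j → φ (i ℤ.+ j) ≡ φ i + φ j
  φ-+ (+ m)    (+ n)    = ι-+ m n
  φ-+ (+ m)    -[1+ n ] = φ-⊖ m (suc n)
  φ-+ -[1+ m ] (+ n)    = trans (φ-⊖ n (suc m)) (+-comm (ι n) _)
  φ-+ -[1+ m ] -[1+ n ] = begin
    - ι (suc (suc (m ℕ.+ n)))      ≡⟨ cong (-_ ∘ ι ∘ suc) (sym (Data.Nat.Properties.+-suc m n)) ⟩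
    - ι (suc m ℕ.+ suc n)          ≡⟨ cong -_ (ι-+ (suc m) (suc n)) ⟩
    - (ι (suc m) + ι (suc n))      ≡⟨ -‿+-comm _ _ ⟨
    - ι (suc m) + - ι (suc n)      ∎
    where open ≡-Reasoning
          import Data.Nat.Properties

  φ-neg : ∀ i → φ (ℤ.- i) ≡ - φ i
  φ-neg (+ zero)  = sym -0#≈0#
  φ-neg (+ suc n) = refl
  φ-neg -[1+ n ]  = sym (-‿involutive _)

  φ-*⁺ : ∀ m j → φ (+ m ℤ.* j) ≡ ι m * φ j
  φ-*⁺ m (+ n)    = trans (cong φ (sym (ℤₚ.pos-* m n))) (ι-* m n)
  φ-*⁺ m -[1+ n ] = begin
    φ (+ m ℤ.* ℤ.- (+ suc n))     ≡⟨ cong φ (sym (ℤₚ.neg-distribʳ-* (+ m) (+ suc n))) ⟩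
    φ (ℤ.- (+ m ℤ.* + suc n))     ≡⟨ φ-neg (+ m ℤ.* + suc n) ⟩
    - φ (+ m ℤ.* + suc n)         ≡⟨ cong -_ (φ-*⁺ m (+ suc n)) ⟩
    - (ι m * ι (suc n))           ≡⟨ -‿distribʳ-* _ _ ⟩
    ι m * - ι (suc n)             ∎
    where open ≡-Reasoning

  φ-* : ∀ i j → φ (i ℤ.* j) ≡ φ i * φ j
  φ-* (+ m)    j = φ-*⁺ m j
  φ-* -[1+ m ] j = begin
    φ (ℤ.- (+ suc m) ℤ.* j)       ≡⟨ cong φ (sym (ℤₚ.neg-distribˡ-* (+ suc m) j)) ⟩
    φ (ℤ.- (+ suc m ℤ.* j))       ≡⟨ φ-neg (+ suc m ℤ.* j) ⟩
    - φ (+ suc m ℤ.* j)           ≡⟨ cong -_ (φ-*⁺ (suc m) j) ⟩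
    - (ι (suc m) * φ j)           ≡⟨ -‿distribˡ-* _ _ ⟩
    - ι (suc m) * φ j             ∎
    where open ≡-Reasoning

  morphism : ℤ.+-*-rawRing -Raw-AlmostCommutative⟶ fromCommutativeRing commutativeRing
  morphism = record
    { ⟦_⟧    = φ
    ; +-homo = φ-+
    ; *-homo = φ-*
    ; -‿homo = φ-neg
    ; 0-homo = refl
    ; 1-homo = refl
    }

  -- Coefficients are compared in ℤ, so two that agree only modulo p are kept apart.
  coefficient≟ : (i j : ℤ) → Maybe (φ i ≡ φ j)
  coefficient≟ i j with i ℤₚ.≟ j
  ... | yes refl = just refl
  ... | no _     = nothing

  open RingSolver ℤ.+-*-rawRing (fromCommutativeRing commutativeRing) morphism coefficient≟ public
    using (Polynomial; con; _:+_; _:*_; _:-_; :-_; _:^_; _:=_; solve)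

  # : ∀ {n} → ℕ → Polynomial n
  # k = con (+ k)

  a-b≡0⇒a≡b : ∀ {a b} → a - b ≡ ι 0 → a ≡ b
  a-b≡0⇒a≡b {a} {b} eq = begin
    a              ≡⟨ solve 2 (λ a b → a := (a :- b) :+ b) refl a b ⟩
    (a - b) + b    ≡⟨ cong (_+ b) eq ⟩
    ι 0 + b        ≡⟨ +-identityˡ b ⟩
    b              ∎
    where open ≡-Reasoning

  a≡b⇒a-b≡0 : ∀ {a b} → a ≡ b → a - b ≡ ι 0
  a≡b⇒a-b≡0 {a} refl = -‿inverseʳ a

  a≢b⇒a-b≢0 : ∀ {a b} → a ≢ b → a - b ≢ ι 0
  a≢b⇒a-b≢0 a≢b = a≢b ∘ a-b≡0⇒a≡b

  *-invˡ : ∀ {a} → a ≢ ι 0 → inv a * a ≡ ι 1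
  *-invˡ a≢0 = trans (*-comm _ _) (*-invʳ a≢0)

  inv-cancelˡ : ∀ {a} b → a ≢ ι 0 → inv a * (a * b) ≡ b
  inv-cancelˡ {a} b a≢0 = trans (sym (*-assoc (inv a) a b)) (trans (cong (_* b) (*-invˡ a≢0)) (*-identityˡ b))

  inv-cancelʳ : ∀ {a} b → a ≢ ι 0 → a * (inv a * b) ≡ b
  inv-cancelʳ {a} b a≢0 = trans (sym (*-assoc a (inv a) b)) (trans (cong (_* b) (*-invʳ a≢0)) (*-identityˡ b))

  *-cancelˡ : ∀ {a b c} → a ≢ ι 0 → a * b ≡ a * c → b ≡ c
  *-cancelˡ {a} {b} {c} a≢0 eq =
    trans (sym (inv-cancelˡ b a≢0)) (trans (*-congˡ eq) (inv-cancelˡ c a≢0))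

  *-≡0 : ∀ {a b} → a * b ≡ ι 0 → a ≡ ι 0 ⊎ b ≡ ι 0
  *-≡0 {a} {b} eq with a ≟ ι 0
  ... | yes a≡0 = inj₁ a≡0
  ... | no  a≢0 = inj₂ (*-cancelˡ a≢0 (trans eq (sym (zeroʳ a))))

  *-≢0 : ∀ {a b} → a ≢ ι 0 → b ≢ ι 0 → a * b ≢ ι 0
  *-≢0 a≢0 b≢0 eq with *-≡0 eq
  ... | inj₁ a≡0 = a≢0 a≡0
  ... | inj₂ b≡0 = b≢0 b≡0

  *-≢0ˡ : ∀ {a b} → a * b ≢ ι 0 → a ≢ ι 0
  *-≢0ˡ {a} {b} ab≢0 refl = ab≢0 (zeroˡ b)

  inv-≢0 : ∀ {a} → a ≢ ι 0 → inv a ≢ ι 0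
  inv-≢0 {a} a≢0 eq = 1≢0 (trans (sym (*-invʳ a≢0)) (trans (*-congˡ eq) (zeroʳ a)))

  inv-involutive : ∀ a → inv (inv a) ≡ a
  inv-involutive a with a ≟ ι 0
  ... | yes refl = trans (cong inv inv-0) inv-0
  ... | no a≢0 = *-cancelˡ (inv-≢0 a≢0) (trans (*-invʳ (inv-≢0 a≢0)) (sym (*-invˡ a≢0)))

  a²≡b² : ∀ {a b} → a * a ≡ b * b → a ≡ b ⊎ a ≡ - b
  a²≡b² {a} {b} eq with *-≡0 {a - b} {a + b}
    (trans (solve 2 (λ a b → (a :- b) :* (a :+ b) := a :* a :- b :* b) refl a b) (a≡b⇒a-b≡0 eq))
  ... | inj₁ e = inj₁ (a-b≡0⇒a≡b e)
  ... | inj₂ e = inj₂ (a-b≡0⇒a≡b (trans (+-congˡ (-‿involutive b)) e))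

-- Sums of the quadratic character

-- Only the values of σ on the three kinds of elements are assumed; multiplicativity is derived from
-- them by counting.
record IsQuadraticCharacter {p : ℕ} (K : FiniteField p) (σ : Fin p → ℤ) : Set where
  open FiniteField K
  field
    σ-0         : σ (ι 0) ≡ + 0
    σ-square    : ∀ {x} → x ≢ ι 0 → σ (x * x) ≡ + 1
    σ-nonsquare : ∀ {a} → (∀ x → x * x ≢ a) → σ a ≡ -[1+ 0 ]

i+j≡0⇒j≡-i : ∀ i {j} → i ℤ.+ j ≡ + 0 → j ≡ ℤ.- i
i+j≡0⇒j≡-i i {j} eq = ℤₚ.i-j≡0⇒i≡j j (ℤ.- i) (trans (solve 2 (λ i j → j :- (:- i) := i :+ j) refl i j) eq)
  where open ℤSolver.+-*-Solver

i+j≡i⇒j≡0 : ∀ i {j} → i ℤ.+ j ≡ i → j ≡ + 0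
i+j≡i⇒j≡0 i {j} eq = trans (solve 2 (λ i j → j := (i :+ j) :- i) refl i j) (ℤₚ.i≡j⇒i-j≡0 eq)
  where open ℤSolver.+-*-Solver

module FieldSums {p : ℕ} (K : FiniteField p) where
  open FiniteField K
  open FieldProperties K

  sum-affine : ∀ {α} β → α ≢ ι 0 → (f : 𝔽 → ℤ) → sum (λ x → f (α * x + β)) ≡ sum f
  sum-affine {α} β α≢0 = sum-reindex (λ x → α * x + β) (λ y → inv α * (y - β))
    (λ y → trans (+-congʳ (inv-cancelʳ (y - β) α≢0)) (solve 2 (λ y b → (y :- b) :+ b := y) refl y β))
    (λ x → trans (*-congˡ (solve 2 (λ x b → (x :+ b) :- b := x) refl (α * x) β)) (inv-cancelˡ x α≢0))

  sum-scale : ∀ {α} → α ≢ ι 0 → (f : 𝔽 → ℤ) → sum (λ x → f (α * x)) ≡ sum f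
  sum-scale {α} α≢0 f = trans (sum-cong-≗ {p} (λ x → cong f (sym (+-identityʳ (α * x))))) (sum-affine (ι 0) α≢0 f)

  sum-shift : ∀ β (f : 𝔽 → ℤ) → sum (λ x → f (x + β)) ≡ sum f
  sum-shift β f = trans (sum-cong-≗ {p} (λ x → cong (λ y → f (y + β)) (sym (*-identityˡ x)))) (sum-affine β 1≢0 f)

  sum-inv : (f : 𝔽 → ℤ) → sum (f ∘ inv) ≡ sum f
  sum-inv = sum-reindex inv inv inv-involutive inv-involutive

module QuadraticCharacter {p : ℕ} (K : FiniteField p) (2≢0 : FiniteField.ι K 2 ≢ FiniteField.ι K 0)
    {σ : Fin p → ℤ} (isQuadraticCharacter : IsQuadraticCharacter K σ) where
  open FiniteField K
  open FieldProperties K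
  open FieldSums K
  open IsQuadraticCharacter isQuadraticCharacter public

  data SquareView (a : 𝔽) : Set where
    isZero      : a ≡ ι 0 → SquareView a
    isSquare    : ∀ s → s ≢ ι 0 → a ≡ s * s → SquareView a
    isNonsquare : (∀ x → x * x ≢ a) → SquareView a

  squareView : ∀ a → SquareView a
  squareView a with a ≟ ι 0 | any? (λ x → x * x ≟ a)
  ... | yes a≡0 | _            = isZero a≡0
  ... | no a≢0  | yes (s , eq) = isSquare s (λ { refl → a≢0 (trans (sym eq) (zeroˡ (ι 0))) }) (sym eq)
  ... | no _    | no ∄         = isNonsquare (λ x eq → ∄ (x , eq))

  x²≡0⇒x≡0 : ∀ {x} → x * x ≡ ι 0 → x ≡ ι 0
  x²≡0⇒x≡0 eq with *-≡0 eq
  ... | inj₁ e = e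
  ... | inj₂ e = e

  a≢-a : ∀ {a} → a ≢ ι 0 → a ≢ - a
  a≢-a {a} a≢0 eq = *-≢0 2≢0 a≢0 (trans (solve 1 (λ a → # 2 :* a := a :- (:- a)) refl a) (a≡b⇒a-b≡0 eq))

  count-square-roots : ∀ a → sum (λ x → 𝟙 (x * x ≟ a)) ≡ + 1 ℤ.+ σ a
  count-square-roots a with squareView a
  ... | isZero refl = begin
    sum (λ x → 𝟙 (x * x ≟ ι 0))   ≡⟨ sum-cong-≗ {p} (λ x → 𝟙-cong (x * x ≟ ι 0) (x ≟ ι 0) x²≡0⇒x≡0 (λ { refl → zeroˡ _ })) ⟩
    sum (λ x → 𝟙 (x ≟ ι 0))       ≡⟨ sum-𝟙 (ι 0) ⟩
    + 1                           ≡⟨ cong₂ ℤ._+_ (refl {x = + 1}) (sym σ-0) ⟩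
    + 1 ℤ.+ σ (ι 0)               ∎
    where open ≡-Reasoning
  ... | isSquare s s≢0 refl = begin
    sum (λ x → 𝟙 (x * x ≟ s * s))                ≡⟨ sum-cong-≗ {p} roots ⟩
    sum (λ x → 𝟙 (x ≟ s) ℤ.+ 𝟙 (x ≟ - s))        ≡⟨ sum-+ (λ x → 𝟙 (x ≟ s)) (λ x → 𝟙 (x ≟ - s)) ⟩
    sum (λ x → 𝟙 (x ≟ s)) ℤ.+ sum (λ x → 𝟙 (x ≟ - s)) ≡⟨ cong₂ ℤ._+_ (sum-𝟙 s) (sum-𝟙 (- s)) ⟩
    + 1 ℤ.+ + 1                                  ≡⟨ cong₂ ℤ._+_ (refl {x = + 1}) (sym (σ-square s≢0)) ⟩
    + 1 ℤ.+ σ (s * s)                            ∎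
    where
    open ≡-Reasoning
    roots : ∀ x → 𝟙 (x * x ≟ s * s) ≡ 𝟙 (x ≟ s) ℤ.+ 𝟙 (x ≟ - s)
    roots x with x ≟ s | x ≟ - s
    ... | yes refl | yes s≡-s = contradiction s≡-s (a≢-a s≢0)
    ... | yes refl | no _     = 𝟙-yes (x * x ≟ x * x) refl
    ... | no _     | yes refl = 𝟙-yes (x * x ≟ s * s) (solve 1 (λ s → :- s :* :- s := s :* s) refl s)
    ... | no x≢s   | no x≢-s  = 𝟙-no (x * x ≟ s * s) λ eq → case-⊎ (a²≡b² eq)
      where
      case-⊎ : ¬ (x ≡ s ⊎ x ≡ - s)
      case-⊎ (inj₁ e) = x≢s e
      case-⊎ (inj₂ e) = x≢-s e
  ... | isNonsquare ∄ = begin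
    sum (λ x → 𝟙 (x * x ≟ a))   ≡⟨ sum-cong-≗ {p} (λ x → 𝟙-no (x * x ≟ a) (∄ x)) ⟩
    sum {p} (λ _ → + 0)         ≡⟨ sum-0 p ⟩
    + 0                         ≡⟨ cong₂ ℤ._+_ (refl {x = + 1}) (sym (σ-nonsquare ∄)) ⟩
    + 1 ℤ.+ σ a                 ∎
    where open ≡-Reasoning

  sum-over-squares : (f : 𝔽 → ℤ) → sum (λ x → f (x * x)) ≡ sum (λ a → (+ 1 ℤ.+ σ a) ℤ.* f a)
  sum-over-squares f = trans (sum-fibres (λ x → x * x) f)
    (sum-cong-≗ {p} (λ a → cong (ℤ._* f a) (count-square-roots a)))

  -- Every x is a square root of exactly one a, so the counts 1 + σ a add up to p.
  sum-σ : sum σ ≡ + 0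
  sum-σ = i+j≡i⇒j≡0 (+ p) (begin
    + p ℤ.+ sum σ                         ≡⟨ cong (ℤ._+ sum σ) (sum-1 p) ⟨
    sum {p} (λ _ → + 1) ℤ.+ sum σ         ≡⟨ sum-+ (λ _ → + 1) σ ⟨
    sum (λ a → + 1 ℤ.+ σ a)               ≡⟨ sum-cong-≗ {p} (λ a → ℤₚ.*-identityʳ (+ 1 ℤ.+ σ a)) ⟨
    sum (λ a → (+ 1 ℤ.+ σ a) ℤ.* + 1)     ≡⟨ sum-over-squares (λ _ → + 1) ⟨
    sum {p} (λ _ → + 1)                   ≡⟨ sum-1 p ⟩
    + p                                   ∎)
    where open ≡-Reasoning

  sum-σ-affine : ∀ {α} β → α ≢ ι 0 → sum (λ x → σ (α * x + β)) ≡ + 0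
  sum-σ-affine β α≢0 = trans (sum-affine β α≢0 σ) sum-σ

  σ-1 : σ (ι 1) ≡ + 1
  σ-1 = trans (cong σ (sym (*-identityˡ (ι 1)))) (σ-square 1≢0)

  -- Multiplication by s matches the square roots of b with those of s² b, and σ can be read off
  -- from the number of square roots.
  σ-square-* : ∀ {s} b → s ≢ ι 0 → σ ((s * s) * b) ≡ σ b
  σ-square-* {s} b s≢0 = ℤ+.∙-cancelˡ (+ 1) _ _ (begin
    + 1 ℤ.+ σ ((s * s) * b)                     ≡⟨ count-square-roots ((s * s) * b) ⟨
    sum (λ x → 𝟙 (x * x ≟ (s * s) * b))         ≡⟨ sum-scale s≢0 (λ x → 𝟙 (x * x ≟ (s * s) * b)) ⟨
    sum (λ x → 𝟙 ((s * x) * (s * x) ≟ (s * s) * b)) ≡⟨ sum-cong-≗ {p} (λ x → 𝟙-cong ((s * x) * (s * x) ≟ (s * s) * b) (x * x ≟ b)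
                                                        (λ eq → *-cancelˡ (*-≢0 s≢0 s≢0) (trans (sym (rearr x)) eq))
                                                        (λ eq → trans (rearr x) (*-congˡ eq))) ⟩
    sum (λ x → 𝟙 (x * x ≟ b))                   ≡⟨ count-square-roots b ⟩
    + 1 ℤ.+ σ b                                 ∎)
    where
    open ≡-Reasoning
    rearr : ∀ x → (s * x) * (s * x) ≡ (s * s) * (x * x)
    rearr x = solve 2 (λ s x → (s :* x) :* (s :* x) := (s :* s) :* (x :* x)) refl s x

  σ≤1 : ∀ a → σ a ℤ.≤ + 1
  σ≤1 a with squareView a
  ... | isZero refl         = subst (ℤ._≤ + 1) (sym σ-0) (ℤ.+≤+ ℕ.z≤n)
  ... | isSquare s s≢0 refl = ℤₚ.≤-reflexive (σ-square s≢0)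
  ... | isNonsquare ∄       = subst (ℤ._≤ + 1) (sym (σ-nonsquare ∄)) ℤ.-≤+

  -- The values of b ↦ σ b + σ (n b) are at most 0 and have sum 0.
  σ-nonsquare-* : ∀ {n} b → (∀ x → x * x ≢ n) → σ (n * b) ≡ ℤ.- σ b
  σ-nonsquare-* {n} b ∄ = i+j≡0⇒j≡-i (σ b) (pointwise-≤∧sum-≡⇒≡ ≤0 sums≡ b)
    where
    n≢0 : n ≢ ι 0
    n≢0 refl = ∄ (ι 0) (zeroˡ (ι 0))
    ≤0 : ∀ b → σ b ℤ.+ σ (n * b) ℤ.≤ + 0
    ≤0 b with squareView b
    ... | isZero refl = ℤₚ.≤-reflexive (cong₂ ℤ._+_ σ-0 (trans (cong σ (zeroʳ n)) σ-0))
    ... | isSquare s s≢0 refl = ℤₚ.≤-reflexive (cong₂ ℤ._+_ (σ-square s≢0)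
          (trans (cong σ (*-comm n (s * s))) (trans (σ-square-* n s≢0) (σ-nonsquare ∄))))
    ... | isNonsquare ∄b = subst (λ v → v ℤ.+ σ (n * b) ℤ.≤ + 0) (sym (σ-nonsquare ∄b))
          (ℤₚ.+-monoʳ-≤ -[1+ 0 ] (σ≤1 (n * b)))
    sums≡ : sum (λ b → σ b ℤ.+ σ (n * b)) ≡ sum {p} (λ _ → + 0)
    sums≡ = begin
      sum (λ b → σ b ℤ.+ σ (n * b))           ≡⟨ sum-+ σ (λ b → σ (n * b)) ⟩
      sum σ ℤ.+ sum (λ b → σ (n * b))         ≡⟨ cong₂ ℤ._+_ sum-σ (trans (sum-scale n≢0 σ) sum-σ) ⟩
      + 0                                     ≡⟨ sum-0 p ⟨
      sum {p} (λ _ → + 0)                     ∎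
      where open ≡-Reasoning

  σ-* : ∀ a b → σ (a * b) ≡ σ a ℤ.* σ b
  σ-* a b with squareView a
  ... | isZero refl = trans (cong σ (zeroˡ b)) (trans σ-0 (cong (ℤ._* σ b) (sym σ-0)))
  ... | isSquare s s≢0 refl = trans (σ-square-* b s≢0)
          (trans (sym (ℤₚ.*-identityˡ (σ b))) (cong (ℤ._* σ b) (sym (σ-square s≢0))))
  ... | isNonsquare ∄ = trans (σ-nonsquare-* b ∄)
          (trans (sym (ℤₚ.-1*i≡-i (σ b))) (cong (ℤ._* σ b) (sym (σ-nonsquare ∄))))

  σ-cube : ∀ a → σ ((a * a) * a) ≡ σ a
  σ-cube a with a ≟ ι 0
  ... | yes refl = cong σ (trans (zeroʳ _) refl)
  ... | no a≢0   = σ-square-* a a≢0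

  σ*σ : ∀ a → σ a ℤ.* σ a ≡ + 1 ℤ.- 𝟙 (a ≟ ι 0)
  σ*σ a with a ≟ ι 0
  ... | yes refl = cong₂ ℤ._*_ σ-0 σ-0
  ... | no a≢0   = trans (sym (σ-* a a)) (σ-square a≢0)

  -- For a ≠ 0 the product is σ (a² (1 + e/a)); then a ↦ 1/a makes the sum linear.
  sum-σ*σ-shift₀ : ∀ e → sum (λ a → σ a ℤ.* σ (a + e)) ≡ + p ℤ.* 𝟙 (e ≟ ι 0) ℤ.- + 1
  sum-σ*σ-shift₀ e with e ≟ ι 0
  ... | yes refl = begin
    sum (λ a → σ a ℤ.* σ (a + ι 0))           ≡⟨ sum-cong-≗ {p} (λ a → trans (cong (λ b → σ a ℤ.* σ b) (+-identityʳ a)) (σ*σ a)) ⟩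
    sum (λ a → + 1 ℤ.- 𝟙 (a ≟ ι 0))           ≡⟨ sum-− {p} (λ _ → + 1) (λ a → 𝟙 (a ≟ ι 0)) ⟩
    sum {p} (λ _ → + 1) ℤ.- sum (λ a → 𝟙 (a ≟ ι 0)) ≡⟨ cong₂ ℤ._-_ (trans (sum-1 p) (sym (ℤₚ.*-identityʳ (+ p)))) (sum-𝟙 (ι 0)) ⟩
    + p ℤ.* + 1 ℤ.- + 1                       ∎
    where open ≡-Reasoning
  ... | no e≢0 = begin
    sum (λ a → σ a ℤ.* σ (a + e))                     ≡⟨ sum-cong-≗ {p} pointwise ⟩
    sum (λ a → σ (e * inv a + ι 1) ℤ.- 𝟙 (a ≟ ι 0))   ≡⟨ sum-− {p} (λ a → σ (e * inv a + ι 1)) (λ a → 𝟙 (a ≟ ι 0)) ⟩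
    sum (λ a → σ (e * inv a + ι 1)) ℤ.- sum (λ a → 𝟙 (a ≟ ι 0))
                                                      ≡⟨ cong₂ ℤ._-_ (trans (sum-inv (λ a → σ (e * a + ι 1))) (sum-σ-affine (ι 1) e≢0)) (sum-𝟙 (ι 0)) ⟩
    + 0 ℤ.- + 1                                       ≡⟨ cong (ℤ._- + 1) (ℤₚ.*-zeroʳ (+ p)) ⟨
    + p ℤ.* + 0 ℤ.- + 1                               ∎
    where
    open ≡-Reasoning
    pointwise : ∀ a → σ a ℤ.* σ (a + e) ≡ σ (e * inv a + ι 1) ℤ.- 𝟙 (a ≟ ι 0)
    pointwise a with a ≟ ι 0
    -- Here 1/0 = 0 yields σ 1 = 1 in place of the true value 0; the indicator cancels it.
    ... | yes refl = trans (cong (ℤ._* σ (ι 0 + e)) σ-0) (sym (cong (ℤ._- + 1)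
          (trans (cong σ (trans (cong (λ i → e * i + ι 1) inv-0) (trans (+-congʳ (zeroʳ e)) (+-identityˡ (ι 1))))) σ-1)))
    ... | no a≢0 = begin
          σ a ℤ.* σ (a + e)                   ≡⟨ σ-* a (a + e) ⟨
          σ (a * (a + e))                     ≡⟨ cong (λ b → σ (a * (a + b))) (inv-cancelʳ e a≢0) ⟨
          σ (a * (a + a * (inv a * e)))       ≡⟨ cong σ (solve 3 (λ a i e → a :* (a :+ a :* (i :* e)) := (a :* a) :* (e :* i :+ # 1)) refl a (inv a) e) ⟩
          σ ((a * a) * (e * inv a + ι 1))     ≡⟨ σ-square-* _ a≢0 ⟩
          σ (e * inv a + ι 1)                 ≡⟨ ℤₚ.+-identityʳ _ ⟨
          σ (e * inv a + ι 1) ℤ.- + 0         ∎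

  -- Orthogonality of the translates of σ: after a shift by u only the difference v - u matters.
  sum-σ*σ-shift : ∀ u v → sum (λ a → σ (u + a) ℤ.* σ (v + a)) ≡ + p ℤ.* 𝟙 (v ≟ u) ℤ.- + 1
  sum-σ*σ-shift u v = begin
    sum (λ a → σ (u + a) ℤ.* σ (v + a))            ≡⟨ sum-cong-≗ {p} (λ a → cong₂ (λ b c → σ b ℤ.* σ c) (+-comm u a)
                                                       (solve 3 (λ u v a → v :+ a := (a :+ u) :+ (v :- u)) refl u v a)) ⟩
    sum (λ a → σ (a + u) ℤ.* σ ((a + u) + (v - u))) ≡⟨ sum-shift u (λ a → σ a ℤ.* σ (a + (v - u))) ⟩
    sum (λ a → σ a ℤ.* σ (a + (v - u)))            ≡⟨ sum-σ*σ-shift₀ (v - u) ⟩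
    + p ℤ.* 𝟙 (v - u ≟ ι 0) ℤ.- + 1                ≡⟨ cong (λ d → + p ℤ.* d ℤ.- + 1) (𝟙-cong (v - u ≟ ι 0) (v ≟ u) a-b≡0⇒a≡b a≡b⇒a-b≡0) ⟩
    + p ℤ.* 𝟙 (v ≟ u) ℤ.- + 1                      ∎
    where open ≡-Reasoning

  -- Each a is a square 1 + σ a times. The part with weight 1 is a complete sum of σ and vanishes;
  -- the part with weight σ a is the product of σ with a translate.
  sum-σ-x²+e : ∀ e → sum (λ x → σ (x * x + e)) ≡ + p ℤ.* 𝟙 (e ≟ ι 0) ℤ.- + 1
  sum-σ-x²+e e = begin
    sum (λ x → σ (x * x + e))                         ≡⟨ sum-over-squares (λ a → σ (a + e)) ⟩
    sum (λ a → (+ 1 ℤ.+ σ a) ℤ.* σ (a + e))           ≡⟨ sum-cong-≗ {p} (λ a → ℤₚ.*-distribʳ-+ (σ (a + e)) (+ 1) (σ a)) ⟩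
    sum (λ a → + 1 ℤ.* σ (a + e) ℤ.+ σ a ℤ.* σ (a + e)) ≡⟨ sum-+ (λ a → + 1 ℤ.* σ (a + e)) (λ a → σ a ℤ.* σ (a + e)) ⟩
    sum (λ a → + 1 ℤ.* σ (a + e)) ℤ.+ sum (λ a → σ a ℤ.* σ (a + e))
                                                      ≡⟨ cong₂ ℤ._+_ (trans (sum-cong-≗ {p} (λ a → ℤₚ.*-identityˡ (σ (a + e)))) (trans (sum-shift e σ) sum-σ))
                                                          (sum-σ*σ-shift₀ e) ⟩
    + 0 ℤ.+ (+ p ℤ.* 𝟙 (e ≟ ι 0) ℤ.- + 1)             ≡⟨ ℤₚ.+-identityˡ _ ⟩
    + p ℤ.* 𝟙 (e ≟ ι 0) ℤ.- + 1                       ∎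
    where open ≡-Reasoning

  4≢0 : ι 2 * ι 2 ≢ ι 0
  4≢0 = *-≢0 2≢0 2≢0

  -- The product of σ α with σ of the quadratic is σ of 4α times the quadratic, a completed square.
  sum-σ-quadratic : ∀ {α} β γ → α ≢ ι 0 →
    sum (λ x → σ (α * (x * x) + β * x + γ)) ≡
      σ α ℤ.* (+ p ℤ.* 𝟙 (β * β - ι 4 * (α * γ) ≟ ι 0) ℤ.- + 1)
  sum-σ-quadratic {α} β γ α≢0 = begin
    sum (λ x → σ (α * (x * x) + β * x + γ))             ≡⟨ sum-cong-≗ {p} pointwise ⟩
    sum (λ x → σ α ℤ.* σ (sq x))                        ≡⟨ sum-* (σ α) (λ x → σ (sq x)) ⟩
    σ α ℤ.* sum (λ x → σ (sq x))                        ≡⟨ cong (σ α ℤ.*_) (sum-affine β (*-≢0 2≢0 α≢0) (λ u → σ (u * u + - Δ))) ⟩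
    σ α ℤ.* sum (λ u → σ (u * u + - Δ))                 ≡⟨ cong (σ α ℤ.*_) (sum-σ-x²+e (- Δ)) ⟩
    σ α ℤ.* (+ p ℤ.* 𝟙 (- Δ ≟ ι 0) ℤ.- + 1)             ≡⟨ cong (λ d → σ α ℤ.* (+ p ℤ.* d ℤ.- + 1)) (𝟙-cong (- Δ ≟ ι 0) (Δ ≟ ι 0)
                                                             (λ eq → trans (sym (-‿involutive Δ)) (trans (cong -_ eq) -0#≈0#))
                                                             (λ eq → trans (cong -_ eq) -0#≈0#)) ⟩
    σ α ℤ.* (+ p ℤ.* 𝟙 (Δ ≟ ι 0) ℤ.- + 1)               ∎
    where
    open ≡-Reasoning
    Δ : 𝔽
    Δ = β * β - ι 4 * (α * γ)
    sq : 𝔽 → 𝔽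
    sq x = (ι 2 * α * x + β) * (ι 2 * α * x + β) + - Δ
    pointwise : ∀ x → σ (α * (x * x) + β * x + γ) ≡ σ α ℤ.* σ (sq x)
    pointwise x = begin
      σ (α * (x * x) + β * x + γ)                         ≡⟨ σ-square-* _ (*-≢0 2≢0 α≢0) ⟨
      σ ((ι 2 * α * (ι 2 * α)) * (α * (x * x) + β * x + γ))   ≡⟨ cong σ (solve 4 (λ α β γ x →
          ((# 2 :* α :* (# 2 :* α)) :* (α :* (x :* x) :+ β :* x :+ γ)) :=
          α :* ((# 2 :* α :* x :+ β) :* (# 2 :* α :* x :+ β) :+ :- (β :* β :- # 4 :* (α :* γ)))) refl α β γ x) ⟩
      σ (α * sq x)                                        ≡⟨ σ-* α (sq x) ⟩
      σ α ℤ.* σ (sq x)                                    ∎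

  -- Multiplication by 4α completes the square, and u = 2αx + β matches the roots with the square
  -- roots of the discriminant.
  count-quadratic-roots : ∀ {α} β γ → α ≢ ι 0 →
    sum (λ x → 𝟙 (α * (x * x) + β * x + γ ≟ ι 0)) ≡ + 1 ℤ.+ σ (β * β - ι 4 * (α * γ))
  count-quadratic-roots {α} β γ α≢0 = begin
    sum (λ x → 𝟙 (α * (x * x) + β * x + γ ≟ ι 0))       ≡⟨ sum-cong-≗ {p} (λ x → 𝟙-cong (_ ≟ ι 0) (sq x ≟ Δ)
                                                             (λ eq → a-b≡0⇒a≡b (trans (sym (complete x)) (trans (*-congˡ eq) (zeroʳ _))))
                                                             (λ eq → *-cancelˡ (*-≢0 4≢0 α≢0) (trans (complete x) (trans (a≡b⇒a-b≡0 eq) (sym (zeroʳ _)))))) ⟩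
    sum (λ x → 𝟙 (sq x ≟ Δ))                            ≡⟨ sum-affine β (*-≢0 2≢0 α≢0) (λ u → 𝟙 (u * u ≟ Δ)) ⟩
    sum (λ u → 𝟙 (u * u ≟ Δ))                           ≡⟨ count-square-roots Δ ⟩
    + 1 ℤ.+ σ Δ                                         ∎
    where
    open ≡-Reasoning
    Δ : 𝔽
    Δ = β * β - ι 4 * (α * γ)
    sq : 𝔽 → 𝔽
    sq x = (ι 2 * α * x + β) * (ι 2 * α * x + β)
    complete : ∀ x → (ι 2 * ι 2 * α) * (α * (x * x) + β * x + γ) ≡ sq x - Δ
    complete x = solve 4 (λ α β γ x →
      (# 2 :* # 2 :* α) :* (α :* (x :* x) :+ β :* x :+ γ) :=
      (# 2 :* α :* x :+ β) :* (# 2 :* α :* x :+ β) :- (β :* β :- # 4 :* (α :* γ))) refl α β γ x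

-- The cubic sum and the representation p = A² + 3B²

-- Permits the division by p - 1 in `S-norm`.
cardinality≢1 : ∀ {p} → FiniteField p → p ≢ 1
cardinality≢1 K refl = FiniteField.1≢0 K (unique _ _)
  where
  unique : (a b : Fin 1) → a ≡ b
  unique zero zero = refl

prime∣i*j⇒prime∣i∨prime∣j : ∀ {q} → Prime q → ∀ i j → + q ∣ i ℤ.* j → + q ∣ i ⊎ + q ∣ j
prime∣i*j⇒prime∣i∨prime∣j {q} q-prime i j q∣ij
  with euclidsLemma ℤ.∣ i ∣ ℤ.∣ j ∣ q-prime (subst (q ℕ.∣_) (ℤₚ.abs-* i j) (∣⇒∣ᵤ q∣ij))
... | inj₁ q∣i = inj₁ (∣ᵤ⇒∣ q∣i)
... | inj₂ q∣j = inj₂ (∣ᵤ⇒∣ q∣j)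

private
  i*i≡+∣i∣*∣i∣ : ∀ i → i ℤ.* i ≡ + (ℤ.∣ i ∣ ℕ.* ℤ.∣ i ∣)
  i*i≡+∣i∣*∣i∣ (+ n)    = sym (ℤₚ.pos-* n n)
  i*i≡+∣i∣*∣i∣ -[1+ n ] = refl

  -- A nonzero q makes 3 (q p)² at least 3p², which already exceeds p².
  p²≡w²+3[qp]²⇒q≡0 : ∀ p .{{_ : ℕ.NonZero p}} q w →
    + p ℤ.* + p ≡ w ℤ.* w ℤ.+ + 3 ℤ.* (q ℤ.* + p ℤ.* (q ℤ.* + p)) → q ≡ + 0
  p²≡w²+3[qp]²⇒q≡0 p q w eq = by-abs ℤ.∣ q ∣ refl
    where
    by-abs : ∀ n → ℤ.∣ q ∣ ≡ n → q ≡ + 0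
    by-abs zero    ∣q∣≡ = ℤₚ.∣i∣≡0⇒i≡0 ∣q∣≡
    by-abs (suc k) ∣q∣≡ = contradiction (ℤₚ.+-injective (trans (ℤₚ.pos-* p p) (trans eq eq′))) (ℕₚ.<⇒≢ (begin-strict
      p ℕ.* p                                                       <⟨ ℕₚ.m<m+n (p ℕ.* p) (ℕ.>-nonZero⁻¹ _ {{ℕₚ.m*n≢0 2 (p ℕ.* p) {{_}} {{ℕₚ.m*n≢0 p p}}}}) ⟩
      3 ℕ.* (p ℕ.* p)                                               ≤⟨ ℕₚ.*-monoʳ-≤ 3 (ℕₚ.*-mono-≤ (ℕₚ.m≤m+n p (k ℕ.* p)) (ℕₚ.m≤m+n p (k ℕ.* p))) ⟩
      3 ℕ.* (suc k ℕ.* p ℕ.* (suc k ℕ.* p))                         ≤⟨ ℕₚ.m≤n+m _ (ℤ.∣ w ∣ ℕ.* ℤ.∣ w ∣) ⟩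
      ℤ.∣ w ∣ ℕ.* ℤ.∣ w ∣ ℕ.+ 3 ℕ.* (suc k ℕ.* p ℕ.* (suc k ℕ.* p))   ∎))
      where
      open ℕₚ.≤-Reasoning
      eq′ : w ℤ.* w ℤ.+ + 3 ℤ.* (q ℤ.* + p ℤ.* (q ℤ.* + p)) ≡ + (ℤ.∣ w ∣ ℕ.* ℤ.∣ w ∣ ℕ.+ 3 ℕ.* (suc k ℕ.* p ℕ.* (suc k ℕ.* p)))
      eq′ = cong₂ ℤ._+_ (i*i≡+∣i∣*∣i∣ w) (trans (cong (+ 3 ℤ.*_) (trans (i*i≡+∣i∣*∣i∣ (q ℤ.* + p))
        (cong (λ a → + (a ℕ.* a)) (trans (ℤₚ.abs-* q (+ p)) (cong (ℕ._* p) ∣q∣≡))))) (sym (ℤₚ.pos-* 3 (suc k ℕ.* p ℕ.* (suc k ℕ.* p)))))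

  -- Brahmagupta's identity reads p² = w² + 3u² with u = A B′ - A′ B. If p divides u, then u = 0 by
  -- size, and A² p - A′² p, being a multiple of u, vanishes.
  A²-unique : ∀ {p A B A′ B′} → Prime p → + p ≡ A ℤ.* A ℤ.+ + 3 ℤ.* (B ℤ.* B) → + p ≡ A′ ℤ.* A′ ℤ.+ + 3 ℤ.* (B′ ℤ.* B′) →
    + p ∣ A ℤ.* B′ ℤ.- A′ ℤ.* B → A ℤ.* A ≡ A′ ℤ.* A′
  A²-unique {p} {A} {B} {A′} {B′} p-prime eq eq′ (divides q u≡) =
    ℤₚ.*-cancelʳ-≡ _ _ (+ p) (begin
      A ℤ.* A ℤ.* + p                                          ≡⟨ cong (A ℤ.* A ℤ.*_) eq′ ⟩
      A ℤ.* A ℤ.* (A′ ℤ.* A′ ℤ.+ + 3 ℤ.* (B′ ℤ.* B′))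
        ≡⟨ solve 4 (λ A B A′ B′ → A :* A :* (A′ :* A′ :+ con (+ 3) :* (B′ :* B′)) :=
             A′ :* A′ :* (A :* A :+ con (+ 3) :* (B :* B)) :+ con (+ 3) :* ((A :* B′ :- A′ :* B) :* (A :* B′ :+ A′ :* B))) refl A B A′ B′ ⟩
      A′ ℤ.* A′ ℤ.* (A ℤ.* A ℤ.+ + 3 ℤ.* (B ℤ.* B)) ℤ.+ + 3 ℤ.* ((A ℤ.* B′ ℤ.- A′ ℤ.* B) ℤ.* (A ℤ.* B′ ℤ.+ A′ ℤ.* B))
        ≡⟨ cong₂ (λ p u → A′ ℤ.* A′ ℤ.* p ℤ.+ + 3 ℤ.* (u ℤ.* (A ℤ.* B′ ℤ.+ A′ ℤ.* B))) (sym eq) u≡0 ⟩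
      A′ ℤ.* A′ ℤ.* + p ℤ.+ + 0                                ≡⟨ ℤₚ.+-identityʳ _ ⟩
      A′ ℤ.* A′ ℤ.* + p                                        ∎)
    where
    open ≡-Reasoning
    open ℤSolver.+-*-Solver
    instance _ = prime⇒nonZero p-prime
    w : ℤ
    w = A ℤ.* A′ ℤ.+ + 3 ℤ.* (B ℤ.* B′)
    brahmagupta : + p ℤ.* + p ≡ w ℤ.* w ℤ.+ + 3 ℤ.* (q ℤ.* + p ℤ.* (q ℤ.* + p))
    brahmagupta = begin
      + p ℤ.* + p                                              ≡⟨ cong₂ ℤ._*_ eq eq′ ⟩
      (A ℤ.* A ℤ.+ + 3 ℤ.* (B ℤ.* B)) ℤ.* (A′ ℤ.* A′ ℤ.+ + 3 ℤ.* (B′ ℤ.* B′))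
        ≡⟨ solve 4 (λ A B A′ B′ → (A :* A :+ con (+ 3) :* (B :* B)) :* (A′ :* A′ :+ con (+ 3) :* (B′ :* B′)) :=
             (A :* A′ :+ con (+ 3) :* (B :* B′)) :* (A :* A′ :+ con (+ 3) :* (B :* B′)) :+
             con (+ 3) :* ((A :* B′ :- A′ :* B) :* (A :* B′ :- A′ :* B))) refl A B A′ B′ ⟩
      w ℤ.* w ℤ.+ + 3 ℤ.* ((A ℤ.* B′ ℤ.- A′ ℤ.* B) ℤ.* (A ℤ.* B′ ℤ.- A′ ℤ.* B))
        ≡⟨ cong (λ u → w ℤ.* w ℤ.+ + 3 ℤ.* (u ℤ.* u)) u≡ ⟩
      w ℤ.* w ℤ.+ + 3 ℤ.* (q ℤ.* + p ℤ.* (q ℤ.* + p)) ∎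
    u≡0 : A ℤ.* B′ ℤ.- A′ ℤ.* B ≡ + 0
    u≡0 = trans u≡ (cong (ℤ._* + p) (p²≡w²+3[qp]²⇒q≡0 p q w brahmagupta))

-- With s = 2α and α + b = 3β the relation s² + s b + b² = 3p becomes α² + 3β² = p.
half-norm-IsA₃ : ∀ p s b → + 2 ∣ s → + 3 ∣ s ℤ.- + 1 → s ℤ.* s ℤ.+ s ℤ.* b ℤ.+ b ℤ.* b ≡ + 3 ℤ.* + p →
  ∃[ A ] s ≡ + 2 ℤ.* A × IsA₃ p A
half-norm-IsA₃ p s b (divides α refl) 3∣s-1 norm = α , ℤₚ.*-comm α (+ 2) , (β , p≡) , ∣⇒∣ᵤ 3∣α+1
  where
  open ≡-Reasoning
  open ℤSolver.+-*-Solver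
  -- For s = 2α the norm form is (α + b)² + 3α².
  sq : (α ℤ.+ b) ℤ.* (α ℤ.+ b) ≡ (+ p ℤ.- α ℤ.* α) ℤ.* + 3
  sq = begin
    (α ℤ.+ b) ℤ.* (α ℤ.+ b)
      ≡⟨ solve 2 (λ α b → (α :+ b) :* (α :+ b) :=
           (α :* con (+ 2) :* (α :* con (+ 2)) :+ α :* con (+ 2) :* b :+ b :* b) :- con (+ 3) :* (α :* α)) refl α b ⟩
    (α ℤ.* + 2 ℤ.* (α ℤ.* + 2) ℤ.+ α ℤ.* + 2 ℤ.* b ℤ.+ b ℤ.* b) ℤ.- + 3 ℤ.* (α ℤ.* α)
      ≡⟨ cong (ℤ._- + 3 ℤ.* (α ℤ.* α)) norm ⟩
    + 3 ℤ.* + p ℤ.- + 3 ℤ.* (α ℤ.* α)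
      ≡⟨ solve 2 (λ p a → con (+ 3) :* p :- con (+ 3) :* a := (p :- a) :* con (+ 3)) refl (+ p) (α ℤ.* α) ⟩
    (+ p ℤ.- α ℤ.* α) ℤ.* + 3 ∎
  3∣α+b : + 3 ∣ α ℤ.+ b
  3∣α+b = [ id , id ]′ (prime∣i*j⇒prime∣i∨prime∣j (from-yes (prime? 3)) (α ℤ.+ b) (α ℤ.+ b) (divides (+ p ℤ.- α ℤ.* α) sq))
  β : ℤ
  β = _∣_.quotient 3∣α+b
  p≡ : + p ≡ α ℤ.* α ℤ.+ + 3 ℤ.* (β ℤ.* β)
  p≡ = ℤₚ.*-cancelʳ-≡ _ _ (+ 3) (begin
    + p ℤ.* + 3
      ≡⟨ solve 2 (λ p a → p :* con (+ 3) := (p :- a) :* con (+ 3) :+ a :* con (+ 3)) refl (+ p) (α ℤ.* α) ⟩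
    (+ p ℤ.- α ℤ.* α) ℤ.* + 3 ℤ.+ α ℤ.* α ℤ.* + 3
      ≡⟨ cong (ℤ._+ α ℤ.* α ℤ.* + 3) (trans (sym sq) (cong (λ v → v ℤ.* v) (_∣_.equality 3∣α+b))) ⟩
    β ℤ.* + 3 ℤ.* (β ℤ.* + 3) ℤ.+ α ℤ.* α ℤ.* + 3
      ≡⟨ solve 2 (λ α β → β :* con (+ 3) :* (β :* con (+ 3)) :+ α :* α :* con (+ 3) :=
           (α :* α :+ con (+ 3) :* (β :* β)) :* con (+ 3)) refl α β ⟩
    (α ℤ.* α ℤ.+ + 3 ℤ.* (β ℤ.* β)) ℤ.* + 3 ∎)
  -- This is 2α ≡ 1 modulo 3 solved for α; it selects the sign of A₃.
  3∣α+1 : + 3 ∣ α ℤ.+ + 1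
  3∣α+1 = subst (+ 3 ∣_) (solve 1 (λ α → con (+ 3) :* α :- (α :* con (+ 2) :- con (+ 1)) := α :+ con (+ 1)) refl α)
    (∣m∣n⇒∣m-n (divides α (ℤₚ.*-comm (+ 3) α)) 3∣s-1)

-- The product of A B′ - A′ B and -A B′ - A′ B is (B² - B′²) p, so p divides one of them. The second
-- factor is the first with B′ negated, which leaves p = A′² + 3B′² intact, so `A²-unique` applies
-- in both cases. If A = -A′, the two congruences would add up to 3 dividing 2.
IsA₃-unique : ∀ {p A A′} → Prime p → IsA₃ p A → IsA₃ p A′ → A ≡ A′
IsA₃-unique {p} {A} {A′} p-prime ((B , eq) , 3∣A+1) ((B′ , eq′) , 3∣A′+1) = by-sign
  (ℤₚ.i*j≡0⇒i≡0∨j≡0 (A ℤ.- A′) (trans (solve 2 (λ a b → (a :- b) :* (a :+ b) := a :* a :- b :* b) refl A A′) (ℤₚ.i≡j⇒i-j≡0 A²≡A′²)))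
  where
  open ℤSolver.+-*-Solver
  p∣ : + p ∣ (A ℤ.* B′ ℤ.- A′ ℤ.* B) ℤ.* (A ℤ.* ℤ.- B′ ℤ.- A′ ℤ.* B)
  p∣ = divides (B ℤ.* B ℤ.- B′ ℤ.* B′) (begin
    (A ℤ.* B′ ℤ.- A′ ℤ.* B) ℤ.* (A ℤ.* ℤ.- B′ ℤ.- A′ ℤ.* B)
      ≡⟨ solve 4 (λ A B A′ B′ → (A :* B′ :- A′ :* B) :* (A :* (:- B′) :- A′ :* B) :=
           B :* B :* (A′ :* A′ :+ con (+ 3) :* (B′ :* B′)) :- B′ :* B′ :* (A :* A :+ con (+ 3) :* (B :* B))) refl A B A′ B′ ⟩
    B ℤ.* B ℤ.* (A′ ℤ.* A′ ℤ.+ + 3 ℤ.* (B′ ℤ.* B′)) ℤ.- B′ ℤ.* B′ ℤ.* (A ℤ.* A ℤ.+ + 3 ℤ.* (B ℤ.* B))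
      ≡⟨ cong₂ (λ u v → B ℤ.* B ℤ.* u ℤ.- B′ ℤ.* B′ ℤ.* v) eq′ eq ⟨
    B ℤ.* B ℤ.* + p ℤ.- B′ ℤ.* B′ ℤ.* + p
      ≡⟨ solve 3 (λ b b′ p → b :* p :- b′ :* p := (b :- b′) :* p) refl (B ℤ.* B) (B′ ℤ.* B′) (+ p) ⟩
    (B ℤ.* B ℤ.- B′ ℤ.* B′) ℤ.* + p ∎)
    where open ≡-Reasoning
  A²≡A′² : A ℤ.* A ≡ A′ ℤ.* A′
  A²≡A′² = [ A²-unique {p} {A} {B} {A′} {B′} p-prime eq eq′ ,
             A²-unique {p} {A} {B} {A′} {ℤ.- B′} p-prime eq
               (trans eq′ (solve 2 (λ a b → a :+ con (+ 3) :* (b :* b) := a :+ con (+ 3) :* (:- b :* :- b)) refl (A′ ℤ.* A′) B′)) ]′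
    (prime∣i*j⇒prime∣i∨prime∣j p-prime (A ℤ.* B′ ℤ.- A′ ℤ.* B) (A ℤ.* ℤ.- B′ ℤ.- A′ ℤ.* B) p∣)
  by-sign : A ℤ.- A′ ≡ + 0 ⊎ A ℤ.+ A′ ≡ + 0 → A ≡ A′
  by-sign (inj₁ e) = ℤₚ.i-j≡0⇒i≡j A A′ e
  by-sign (inj₂ e) = contradiction (∣⇒∣ᵤ (subst (+ 3 ∣_) sum≡2 (∣m∣n⇒∣m+n (∣ᵤ⇒∣ {+ 3} {A ℤ.+ + 1} 3∣A+1) (∣ᵤ⇒∣ {+ 3} {A′ ℤ.+ + 1} 3∣A′+1)))) (from-no (3 ℕ.∣? 2))
    where
    sum≡2 : (A ℤ.+ + 1) ℤ.+ (A′ ℤ.+ + 1) ≡ + 2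
    sum≡2 = trans (solve 2 (λ a b → (a :+ con (+ 1)) :+ (b :+ con (+ 1)) := (a :+ b) :+ con (+ 2)) refl A A′) (cong (ℤ._+ + 2) e)

-- Cube roots and the sums of σ (x³ + a)

module _ {p : ℕ} (K : FiniteField p) where
  open FiniteField K
  open FieldProperties K

  module CubicSums (2≢0 : ι 2 ≢ ι 0) (3≢0 : ι 3 ≢ ι 0)
      {σ : Fin p → ℤ} (isQuadraticCharacter : IsQuadraticCharacter K σ)
      (ω : Fin p) (ω²+ω+1≡0 : ω * ω + ω + ι 1 ≡ ι 0) where
    open FieldSums K
    open QuadraticCharacter K 2≢0 isQuadraticCharacter

    cube : 𝔽 → 𝔽
    cube x = (x * x) * x

    cube-* : ∀ x y → cube (x * y) ≡ cube x * cube y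
    cube-* x y = solve 2 (λ x y → (x :* y) :* (x :* y) :* (x :* y) := (x :* x :* x) :* (y :* y :* y)) refl x y

    cube-0 : cube (ι 0) ≡ ι 0
    cube-0 = zeroʳ _

    cube-≢0 : ∀ {x} → x ≢ ι 0 → cube x ≢ ι 0
    cube-≢0 x≢0 = *-≢0 (*-≢0 x≢0 x≢0) x≢0

    cube≡0⇒≡0 : ∀ {x} → cube x ≡ ι 0 → x ≡ ι 0
    cube≡0⇒≡0 {x} eq with x ≟ ι 0
    ... | yes x≡0 = x≡0
    ... | no x≢0  = contradiction eq (cube-≢0 x≢0)

    -- Equal to ω², the other primitive cube root of unity.
    ω̄ : 𝔽
    ω̄ = - (ω + ι 1)

    private
      cubes-factor : ∀ x s → (x - s) * ((x - ω * s) * (x - ω̄ * s)) ≡ cube x - cube s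
      cubes-factor x s = begin
        (x - s) * ((x - ω * s) * (x - ω̄ * s))
          ≡⟨ solve 3 (λ x s w → (x :- s) :* ((x :- w :* s) :* (x :- (:- (w :+ # 1)) :* s)) :=
               (x :* x :* x :- s :* s :* s) :- (x :- s) :* (s :* s) :* (w :* w :+ w :+ # 1)) refl x s ω ⟩
        (cube x - cube s) - (x - s) * (s * s) * (ω * ω + ω + ι 1)
          ≡⟨ cong (λ e → (cube x - cube s) - (x - s) * (s * s) * e) ω²+ω+1≡0 ⟩
        (cube x - cube s) - (x - s) * (s * s) * ι 0
          ≡⟨ solve 2 (λ u v → u :- v :* # 0 := u) refl (cube x - cube s) ((x - s) * (s * s)) ⟩
        cube x - cube s ∎
        where open ≡-Reasoning

      -- Each difference of two cube roots of unity divides 3, modulo ω² + ω + 1.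
      factor-of-3≢0 : ∀ {d} e → d * e + (ω * ω + ω + ι 1) ≡ ι 3 → d ≢ ι 0
      factor-of-3≢0 {d} e eq refl = 3≢0 (begin
        ι 3                                 ≡⟨ eq ⟨
        ι 0 * e + (ω * ω + ω + ι 1)         ≡⟨ +-congˡ ω²+ω+1≡0 ⟩
        ι 0 * e + ι 0                       ≡⟨ solve 1 (λ e → # 0 :* e :+ # 0 := # 0) refl e ⟩
        ι 0                                 ∎)
        where open ≡-Reasoning

      1-ω≢0 : ι 1 - ω ≢ ι 0
      1-ω≢0 = factor-of-3≢0 (ω + ι 2) (solve 1 (λ w → (# 1 :- w) :* (w :+ # 2) :+ (w :* w :+ w :+ # 1) := # 3) refl ω)

      1-ω̄≢0 : ι 1 - ω̄ ≢ ι 0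
      1-ω̄≢0 = factor-of-3≢0 (ι 1 - ω) (solve 1 (λ w → (# 1 :- (:- (w :+ # 1))) :* (# 1 :- w) :+ (w :* w :+ w :+ # 1) := # 3) refl ω)

      ω-ω̄≢0 : ω - ω̄ ≢ ι 0
      ω-ω̄≢0 eq = 3≢0 (begin
        ι 3                                                ≡⟨ solve 1 (λ w → # 3 := # 4 :* (w :* w :+ w :+ # 1) :-
                                                                (w :- (:- (w :+ # 1))) :* (w :- (:- (w :+ # 1)))) refl ω ⟩
        ι 4 * (ω * ω + ω + ι 1) - (ω - ω̄) * (ω - ω̄)       ≡⟨ cong₂ (λ a b → ι 4 * a - b * b) ω²+ω+1≡0 eq ⟩
        ι 4 * ι 0 - ι 0 * ι 0                              ≡⟨ solve 0 (# 4 :* # 0 :- # 0 :* # 0 := # 0) refl ⟩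
        ι 0                                                ∎)
        where open ≡-Reasoning

      scaled-≢ : ∀ {a b s} → a - b ≢ ι 0 → s ≢ ι 0 → a * s ≢ b * s
      scaled-≢ {a} {b} {s} a-b≢0 s≢0 eq = *-≢0 a-b≢0 s≢0
        (trans (solve 3 (λ a b s → (a :- b) :* s := a :* s :- b :* s) refl a b s) (a≡b⇒a-b≡0 eq))

    data CubeView (a : 𝔽) : Set where
      isZero    : a ≡ ι 0 → CubeView a
      isCube    : ∀ s → s ≢ ι 0 → a ≡ cube s → CubeView a
      isNoncube : (∀ x → cube x ≢ a) → CubeView a

    cubeView : ∀ a → CubeView a
    cubeView a with a ≟ ι 0 | any? (λ x → cube x ≟ a)
    ... | yes a≡0 | _            = isZero a≡0
    ... | no a≢0  | yes (s , eq) = isCube s (λ { refl → a≢0 (trans (sym eq) cube-0) }) (sym eq)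
    ... | no _    | no ∄         = isNoncube (λ x eq → ∄ (x , eq))

    #∛ : 𝔽 → ℤ
    #∛ a = sum (λ x → 𝟙 (cube x ≟ a))

    #∛-0 : #∛ (ι 0) ≡ + 1
    #∛-0 = trans (sum-cong-≗ {p} (λ x → 𝟙-cong (cube x ≟ ι 0) (x ≟ ι 0) cube≡0⇒≡0 (λ { refl → cube-0 }))) (sum-𝟙 (ι 0))

    #∛-noncube : ∀ {a} → (∀ x → cube x ≢ a) → #∛ a ≡ + 0
    #∛-noncube {a} ∄ = trans (sum-cong-≗ {p} (λ x → 𝟙-no (cube x ≟ a) (∄ x))) (sum-0 p)

    #∛-cube : ∀ {s} → s ≢ ι 0 → #∛ (cube s) ≡ + 3
    #∛-cube {s} s≢0 = begin
      sum (λ x → 𝟙 (cube x ≟ cube s))                                   ≡⟨ sum-cong-≗ {p} roots ⟩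
      sum (λ x → 𝟙 (x ≟ s) ℤ.+ (𝟙 (x ≟ ω * s) ℤ.+ 𝟙 (x ≟ ω̄ * s)))       ≡⟨ sum-+ (λ x → 𝟙 (x ≟ s)) (λ x → 𝟙 (x ≟ ω * s) ℤ.+ 𝟙 (x ≟ ω̄ * s)) ⟩
      sum (λ x → 𝟙 (x ≟ s)) ℤ.+ sum (λ x → 𝟙 (x ≟ ω * s) ℤ.+ 𝟙 (x ≟ ω̄ * s))
        ≡⟨ cong₂ ℤ._+_ (sum-𝟙 s) (trans (sum-+ (λ x → 𝟙 (x ≟ ω * s)) (λ x → 𝟙 (x ≟ ω̄ * s))) (cong₂ ℤ._+_ (sum-𝟙 (ω * s)) (sum-𝟙 (ω̄ * s)))) ⟩
      + 3 ∎
      where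
      open ≡-Reasoning
      s≢ωs : s ≢ ω * s
      s≢ωs eq = scaled-≢ 1-ω≢0 s≢0 (trans (*-identityˡ s) eq)
      s≢ω̄s : s ≢ ω̄ * s
      s≢ω̄s eq = scaled-≢ 1-ω̄≢0 s≢0 (trans (*-identityˡ s) eq)
      ωs≢ω̄s : ω * s ≢ ω̄ * s
      ωs≢ω̄s = scaled-≢ ω-ω̄≢0 s≢0
      root : ∀ {x} → (x - s) * ((x - ω * s) * (x - ω̄ * s)) ≡ ι 0 → cube x ≡ cube s
      root {x} eq = a-b≡0⇒a≡b (trans (sym (cubes-factor x s)) eq)
      roots : ∀ x → 𝟙 (cube x ≟ cube s) ≡ 𝟙 (x ≟ s) ℤ.+ (𝟙 (x ≟ ω * s) ℤ.+ 𝟙 (x ≟ ω̄ * s))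
      roots x with x ≟ s | x ≟ ω * s | x ≟ ω̄ * s
      ... | yes refl | yes e    | _        = contradiction e s≢ωs
      ... | yes refl | no _     | yes e    = contradiction e s≢ω̄s
      ... | yes refl | no _     | no _     = 𝟙-yes (cube x ≟ cube x) refl
      ... | no _     | yes refl | yes e    = contradiction e ωs≢ω̄s
      ... | no _     | yes refl | no _     = 𝟙-yes (cube x ≟ cube s) (root
            (trans (*-congˡ (trans (*-congʳ (-‿inverseʳ x)) (zeroˡ _))) (zeroʳ _)))
      ... | no _     | no _     | yes refl = 𝟙-yes (cube x ≟ cube s) (root
            (trans (*-congˡ (trans (*-congˡ (-‿inverseʳ x)) (zeroʳ _))) (zeroʳ _)))
      ... | no x≢s   | no x≢ωs  | no x≢ω̄s  = 𝟙-no (cube x ≟ cube s) λ eq →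
            *-≢0 (a≢b⇒a-b≢0 x≢s) (*-≢0 (a≢b⇒a-b≢0 x≢ωs) (a≢b⇒a-b≢0 x≢ω̄s)) (trans (cubes-factor x s) (a≡b⇒a-b≡0 eq))

    sum-over-cubes : (f : 𝔽 → ℤ) → sum (λ x → f (cube x)) ≡ sum (λ a → #∛ a ℤ.* f a)
    sum-over-cubes = sum-fibres cube

    sum-#∛ : sum #∛ ≡ + p
    sum-#∛ = trans (sum-cong-≗ {p} (λ a → sym (ℤₚ.*-identityʳ (#∛ a))))
      (trans (sym (sum-over-cubes (λ _ → + 1))) (sum-1 p))

    #∛-scale : ∀ {s} a → s ≢ ι 0 → #∛ (cube s * a) ≡ #∛ a
    #∛-scale {s} a s≢0 = begin
      sum (λ x → 𝟙 (cube x ≟ cube s * a))          ≡⟨ sum-scale s≢0 (λ x → 𝟙 (cube x ≟ cube s * a)) ⟨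
      sum (λ x → 𝟙 (cube (s * x) ≟ cube s * a))    ≡⟨ sum-cong-≗ {p} (λ x → 𝟙-cong (cube (s * x) ≟ cube s * a) (cube x ≟ a)
                                                        (λ eq → *-cancelˡ (cube-≢0 s≢0) (trans (sym (cube-* s x)) eq))
                                                        (λ eq → trans (cube-* s x) (*-congˡ eq))) ⟩
      sum (λ x → 𝟙 (cube x ≟ a))                   ∎
      where open ≡-Reasoning

    -- Otherwise every element has exactly one cube root, but 1 has three.
    ∃-noncube : ∃[ h ] (∀ x → cube x ≢ h)
    ∃-noncube with ¬∀⟶∃¬ p (λ a → ∃[ x ] cube x ≡ a) (λ a → any? (λ x → cube x ≟ a)) not-all
      where
      not-all : ¬ (∀ a → ∃[ x ] cube x ≡ a)
      not-all surj with trans (pointwise-≤∧sum-≡⇒≡ {p} {λ _ → + 1} {#∛} 1≤#∛ (trans (sum-1 p) (sym sum-#∛)) (cube (ι 1))) (#∛-cube 1≢0)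
        where
        1≤#∛ : ∀ a → + 1 ℤ.≤ #∛ a
        1≤#∛ a with cubeView a
        ... | isZero refl         = ℤₚ.≤-reflexive (sym #∛-0)
        ... | isCube s s≢0 refl   = subst (+ 1 ℤ.≤_) (sym (#∛-cube s≢0)) (ℤ.+≤+ (ℕ.s≤s ℕ.z≤n))
        ... | isNoncube ∄         = let x , eq = surj a in contradiction eq (∄ x)
      ... | ()
    ... | h , ∄ = h , λ x eq → ∄ (x , eq)

    -- The curve y² = x³ + a has p + `S a` affine points.
    S : 𝔽 → ℤ
    S a = sum (λ x → σ (cube x + a))

    S² : 𝔽 → ℤ
    S² a = S a ℤ.* S a

    S²-0 : S² (ι 0) ≡ + 0
    S²-0 = cong₂ ℤ._*_ S-0 S-0
      where
      S-0 : S (ι 0) ≡ + 0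
      S-0 = trans (sum-cong-≗ {p} (λ x → trans (cong σ (+-identityʳ (cube x))) (σ-cube x))) sum-σ

    -- The substitution of s x for x takes out a factor s³, and σ (s³) = σ s. So `S` is determined
    -- up to sign by the coset of a modulo cubes, and `S²` is constant on cosets.
    S-scale : ∀ {s} a → s ≢ ι 0 → S (cube s * a) ≡ σ s ℤ.* S a
    S-scale {s} a s≢0 = begin
      sum (λ x → σ (cube x + cube s * a))          ≡⟨ sum-scale s≢0 (λ x → σ (cube x + cube s * a)) ⟨
      sum (λ x → σ (cube (s * x) + cube s * a))    ≡⟨ sum-cong-≗ {p} (λ x → trans (cong σ (solve 3 (λ s x a →
                                                        (s :* x) :* (s :* x) :* (s :* x) :+ s :* s :* s :* a :=
                                                        (s :* s :* s) :* (x :* x :* x :+ a)) refl s x a))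
                                                        (trans (σ-* (cube s) (cube x + a)) (cong (ℤ._* σ (cube x + a)) (σ-cube s)))) ⟩
      sum (λ x → σ s ℤ.* σ (cube x + a))           ≡⟨ sum-* (σ s) (λ x → σ (cube x + a)) ⟩
      σ s ℤ.* S a                                  ∎
      where open ≡-Reasoning

    S²-scale : ∀ {s} a → s ≢ ι 0 → S² (cube s * a) ≡ S² a
    S²-scale {s} a s≢0 = begin
      S (cube s * a) ℤ.* S (cube s * a)       ≡⟨ cong (λ v → v ℤ.* v) (S-scale a s≢0) ⟩
      σ s ℤ.* S a ℤ.* (σ s ℤ.* S a)           ≡⟨ ℤS.solve 2 (λ u v → u ℤS.:* v ℤS.:* (u ℤS.:* v) ℤS.:= u ℤS.:* u ℤS.:* (v ℤS.:* v)) refl (σ s) (S a) ⟩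
      σ s ℤ.* σ s ℤ.* (S a ℤ.* S a)           ≡⟨ cong (ℤ._* S² a) (trans (sym (σ-* s s)) (σ-square s≢0)) ⟩
      + 1 ℤ.* S² a                            ≡⟨ ℤₚ.*-identityˡ (S² a) ⟩
      S² a                                    ∎
      where open ≡-Reasoning
            module ℤS = ℤSolver.+-*-Solver

    -- Replacing a by s² a moves s out of σ and into the number of cube roots. The factor to be
    -- taken out of σ must be a square, whence the square representatives for the cosets.
    S-square : ∀ {s} → s ≢ ι 0 → S (s * s) ≡ sum (λ a → #∛ ((s * s) * a) ℤ.* σ (a + ι 1))
    S-square {s} s≢0 = begin
      sum (λ x → σ (cube x + s * s))                                    ≡⟨ sum-over-cubes (λ a → σ (a + s * s)) ⟩
      sum (λ a → #∛ a ℤ.* σ (a + s * s))                                ≡⟨ sum-scale (*-≢0 s≢0 s≢0) (λ a → #∛ a ℤ.* σ (a + s * s)) ⟨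
      sum (λ a → #∛ ((s * s) * a) ℤ.* σ ((s * s) * a + s * s))          ≡⟨ sum-cong-≗ {p} (λ a → cong (#∛ ((s * s) * a) ℤ.*_)
                                                                              (trans (cong σ (solve 2 (λ q a → q :* a :+ q := q :* (a :+ # 1)) refl (s * s) a))
                                                                                (σ-square-* (a + ι 1) s≢0))) ⟩
      sum (λ a → #∛ ((s * s) * a) ℤ.* σ (a + ι 1))                      ∎
      where open ≡-Reasoning

    S-1 : S (ι 1) ≡ sum (λ a → #∛ a ℤ.* σ (a + ι 1))
    S-1 = sum-over-cubes (λ a → σ (a + ι 1))

    -- With the square expanded and the sum over a taken first, orthogonality gives p times the
    -- number of pairs with x³ = y³, minus p². There are 3 (p - 1) + 1 such pairs.
    sum-S² : sum S² ≡ + p ℤ.* (+ 3 ℤ.* + p ℤ.- + 2) ℤ.- + p ℤ.* + p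
    sum-S² = begin
      sum (λ a → S a ℤ.* S a)
        ≡⟨ sum-cong-≗ {p} (λ a → trans (*-distribʳ-sum (S a) (λ x → σ (cube x + a)))
             (sum-cong-≗ {p} (λ x → *-distribˡ-sum (σ (cube x + a)) (λ y → σ (cube y + a))))) ⟩
      sum (λ a → sum (λ x → sum (λ y → σ (cube x + a) ℤ.* σ (cube y + a))))
        ≡⟨ sum-comm (λ a x → sum (λ y → σ (cube x + a) ℤ.* σ (cube y + a))) ⟩
      sum (λ x → sum (λ a → sum (λ y → σ (cube x + a) ℤ.* σ (cube y + a))))
        ≡⟨ sum-cong-≗ {p} inner ⟩
      sum (λ x → + p ℤ.* (+ 3 ℤ.- + 2 ℤ.* 𝟙 (x ≟ ι 0)) ℤ.- + p)
        ≡⟨ sum-− {p} (λ x → + p ℤ.* (+ 3 ℤ.- + 2 ℤ.* 𝟙 (x ≟ ι 0))) (λ _ → + p) ⟩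
      sum (λ x → + p ℤ.* (+ 3 ℤ.- + 2 ℤ.* 𝟙 (x ≟ ι 0))) ℤ.- sum {p} (λ _ → + p)
        ≡⟨ cong₂ ℤ._-_ (trans (sum-* (+ p) (λ x → + 3 ℤ.- + 2 ℤ.* 𝟙 (x ≟ ι 0))) (cong (+ p ℤ.*_) count)) (sum-const p (+ p)) ⟩
      + p ℤ.* (+ 3 ℤ.* + p ℤ.- + 2) ℤ.- + p ℤ.* + p ∎
      where
      open ≡-Reasoning
      #∛-of-cube : ∀ x → #∛ (cube x) ≡ + 3 ℤ.- + 2 ℤ.* 𝟙 (x ≟ ι 0)
      #∛-of-cube x with x ≟ ι 0
      ... | yes refl = trans (cong #∛ cube-0) #∛-0
      ... | no x≢0   = #∛-cube x≢0
      inner : ∀ x → sum (λ a → sum (λ y → σ (cube x + a) ℤ.* σ (cube y + a))) ≡ + p ℤ.* (+ 3 ℤ.- + 2 ℤ.* 𝟙 (x ≟ ι 0)) ℤ.- + p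
      inner x = begin
        sum (λ a → sum (λ y → σ (cube x + a) ℤ.* σ (cube y + a)))
          ≡⟨ sum-comm (λ a y → σ (cube x + a) ℤ.* σ (cube y + a)) ⟩
        sum (λ y → sum (λ a → σ (cube x + a) ℤ.* σ (cube y + a)))
          ≡⟨ sum-cong-≗ {p} (λ y → sum-σ*σ-shift (cube x) (cube y)) ⟩
        sum (λ y → + p ℤ.* 𝟙 (cube y ≟ cube x) ℤ.- + 1)
          ≡⟨ sum-− {p} (λ y → + p ℤ.* 𝟙 (cube y ≟ cube x)) (λ _ → + 1) ⟩
        sum (λ y → + p ℤ.* 𝟙 (cube y ≟ cube x)) ℤ.- sum {p} (λ _ → + 1)
          ≡⟨ cong₂ ℤ._-_ (trans (sum-* (+ p) (λ y → 𝟙 (cube y ≟ cube x))) (cong (+ p ℤ.*_) (#∛-of-cube x))) (sum-1 p) ⟩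
        + p ℤ.* (+ 3 ℤ.- + 2 ℤ.* 𝟙 (x ≟ ι 0)) ℤ.- + p ∎
      count : sum (λ x → + 3 ℤ.- + 2 ℤ.* 𝟙 (x ≟ ι 0)) ≡ + 3 ℤ.* + p ℤ.- + 2
      count = trans (sum-− {p} (λ _ → + 3) (λ x → + 2 ℤ.* 𝟙 (x ≟ ι 0))) (cong₂ ℤ._-_
        (trans (sum-const p (+ 3)) (ℤₚ.*-comm (+ p) (+ 3)))
        (trans (sum-* (+ 2) (λ x → 𝟙 (x ≟ ι 0))) (cong (+ 2 ℤ.*_) (sum-𝟙 (ι 0)))))

    -- As a sum over cubes it has the same term `S² u` for every x ≠ 0, and the term for x = 0
    -- vanishes.
    sum-#∛*S² : ∀ u → sum (λ a → #∛ a ℤ.* S² (u * a)) ≡ (+ p ℤ.- + 1) ℤ.* S² u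
    sum-#∛*S² u = begin
      sum (λ a → #∛ a ℤ.* S² (u * a))               ≡⟨ sum-over-cubes (λ a → S² (u * a)) ⟨
      sum (λ x → S² (u * cube x))                   ≡⟨ sum-cong-≗ {p} pointwise ⟩
      sum (λ x → (+ 1 ℤ.- 𝟙 (x ≟ ι 0)) ℤ.* S² u)    ≡⟨ *-distribʳ-sum (S² u) (λ x → + 1 ℤ.- 𝟙 (x ≟ ι 0)) ⟨
      sum (λ x → + 1 ℤ.- 𝟙 (x ≟ ι 0)) ℤ.* S² u      ≡⟨ cong (ℤ._* S² u) (trans (sum-− {p} (λ _ → + 1) (λ x → 𝟙 (x ≟ ι 0))) (cong₂ ℤ._-_ (sum-1 p) (sum-𝟙 (ι 0)))) ⟩
      (+ p ℤ.- + 1) ℤ.* S² u                        ∎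
      where
      open ≡-Reasoning
      pointwise : ∀ x → S² (u * cube x) ≡ (+ 1 ℤ.- 𝟙 (x ≟ ι 0)) ℤ.* S² u
      pointwise x with x ≟ ι 0
      ... | yes refl = trans (cong S² (trans (*-congˡ cube-0) (zeroʳ u))) S²-0
      ... | no x≢0   = trans (trans (cong S² (*-comm u (cube x))) (S²-scale u x≢0)) (sym (ℤₚ.*-identityˡ (S² u)))

    private

      -- The three cosets of the cubes

      module CubicCosets (h : 𝔽) (h-noncube : ∀ x → cube x ≢ h) where

        g g² : 𝔽
        g  = h * h
        g² = g * g

        h≢0 : h ≢ ι 0
        h≢0 refl = h-noncube (ι 0) cube-0

        g≢0 : g ≢ ι 0
        g≢0 = *-≢0 h≢0 h≢0

        g²≢0 : g² ≢ ι 0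
        g²≢0 = *-≢0 g≢0 g≢0

        -- Since g h = h³, a cube root x of g would make h the cube of h/x.
        g-noncube : ∀ x → cube x ≢ g
        g-noncube x eq = h-noncube (inv x * h) (*-cancelˡ x³≢0 (begin
          cube x * cube (inv x * h)      ≡⟨ cube-* x (inv x * h) ⟨
          cube (x * (inv x * h))         ≡⟨ cong cube (inv-cancelʳ h (λ { refl → x³≢0 cube-0 })) ⟩
          g * h                          ≡⟨ *-congʳ eq ⟨
          cube x * h                     ∎))
          where
          open ≡-Reasoning
          x³≢0 : cube x ≢ ι 0
          x³≢0 = subst (_≢ ι 0) (sym eq) g≢0

        -- Since g² = h³ h, a cube root x of g² would make h the cube of x/h.
        g²-noncube : ∀ x → cube x ≢ g²
        g²-noncube x eq = h-noncube (inv h * x) (*-cancelˡ (cube-≢0 h≢0) (begin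
          cube h * cube (inv h * x)      ≡⟨ cube-* h (inv h * x) ⟨
          cube (h * (inv h * x))         ≡⟨ cong cube (inv-cancelʳ x h≢0) ⟩
          cube x                         ≡⟨ eq ⟩
          g²                             ≡⟨ *-assoc g h h ⟨
          cube h * h                     ∎))
          where open ≡-Reasoning

        #∛-cube*noncube : ∀ {n s} → s ≢ ι 0 → (∀ x → cube x ≢ n) → ∀ {a} → a ≡ cube s * n → #∛ a ≡ + 0
        #∛-cube*noncube {n} s≢0 ∄ refl = trans (#∛-scale n s≢0) (#∛-noncube ∄)

        -- For a ≠ 0 at most one of a, g a, g² a is a cube, because g and g² are not; this bounds
        -- the count by 3. The average over all a is exactly 3, so the bound is attained everywhere.
        coset-identity : ∀ a → #∛ a ℤ.+ (#∛ (g * a) ℤ.+ #∛ (g² * a)) ≡ + 3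
        coset-identity = pointwise-≤∧sum-≡⇒≡ bound total
          where
          open ≡-Reasoning
          shift₁ : ∀ a {s} → g * a ≡ cube s → s ≢ ι 0 → #∛ (g² * a) ≡ + 0
          shift₁ a {s} eq s≢0 = #∛-cube*noncube s≢0 g-noncube
            (trans (*-assoc g g a) (trans (*-congˡ eq) (*-comm g (cube s))))
          bound : ∀ a → #∛ a ℤ.+ (#∛ (g * a) ℤ.+ #∛ (g² * a)) ℤ.≤ + 3
          bound a with cubeView a | cubeView (g * a) | cubeView (g² * a)
          ... | isZero refl | _ | _ = ℤₚ.≤-reflexive (cong₂ ℤ._+_ #∛-0
                (cong₂ ℤ._+_ (trans (cong #∛ (zeroʳ g)) #∛-0) (trans (cong #∛ (zeroʳ g²)) #∛-0)))
          ... | isCube s s≢0 refl | _ | _ = ℤₚ.≤-reflexive (cong₂ ℤ._+_ (#∛-cube s≢0)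
                (cong₂ ℤ._+_ (#∛-cube*noncube s≢0 g-noncube (*-comm g (cube s)))
                             (#∛-cube*noncube s≢0 g²-noncube (*-comm g² (cube s)))))
          ... | isNoncube ∄ | isZero ga≡0 | _ = contradiction
                (trans cube-0 (sym (*-cancelˡ g≢0 (trans ga≡0 (sym (zeroʳ g)))))) (∄ (ι 0))
          ... | isNoncube ∄ | isCube s s≢0 eq | _ = ℤₚ.≤-reflexive (cong₂ ℤ._+_ (#∛-noncube ∄)
                (cong₂ ℤ._+_ (trans (cong #∛ eq) (#∛-cube s≢0)) (shift₁ a eq s≢0)))
          ... | isNoncube ∄ | isNoncube ∄₁ | isZero g²a≡0 = contradiction
                (trans cube-0 (sym (*-cancelˡ g²≢0 (trans g²a≡0 (sym (zeroʳ g²)))))) (∄ (ι 0))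
          ... | isNoncube ∄ | isNoncube ∄₁ | isCube s s≢0 eq = ℤₚ.≤-reflexive (cong₂ ℤ._+_ (#∛-noncube ∄)
                (cong₂ ℤ._+_ (#∛-noncube ∄₁) (trans (cong #∛ eq) (#∛-cube s≢0))))
          -- The bound tolerates three noncubes; only the tally rules them out.
          ... | isNoncube ∄ | isNoncube ∄₁ | isNoncube ∄₂ = subst (ℤ._≤ + 3) (sym (cong₂ ℤ._+_ (#∛-noncube ∄)
                (cong₂ ℤ._+_ (#∛-noncube ∄₁) (#∛-noncube ∄₂)))) (ℤ.+≤+ ℕ.z≤n)
          total : sum (λ a → #∛ a ℤ.+ (#∛ (g * a) ℤ.+ #∛ (g² * a))) ≡ sum {p} (λ _ → + 3)
          total = begin
            sum (λ a → #∛ a ℤ.+ (#∛ (g * a) ℤ.+ #∛ (g² * a)))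
              ≡⟨ trans (sum-+ #∛ (λ a → #∛ (g * a) ℤ.+ #∛ (g² * a))) (cong₂ ℤ._+_ (refl {x = sum #∛}) (sum-+ (λ a → #∛ (g * a)) (λ a → #∛ (g² * a)))) ⟩
            sum #∛ ℤ.+ (sum (λ a → #∛ (g * a)) ℤ.+ sum (λ a → #∛ (g² * a)))
              ≡⟨ cong₂ ℤ._+_ sum-#∛ (cong₂ ℤ._+_ (trans (sum-scale g≢0 #∛) sum-#∛) (trans (sum-scale g²≢0 #∛) sum-#∛)) ⟩
            + p ℤ.+ (+ p ℤ.+ + p)
              ≡⟨ ℤS.solve 1 (λ p → p ℤS.:+ (p ℤS.:+ p) ℤS.:= p ℤS.:* ℤS.con (+ 3)) refl (+ p) ⟩
            + p ℤ.* + 3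
              ≡⟨ sum-const p (+ 3) ⟨
            sum {p} (λ _ → + 3) ∎
            where module ℤS = ℤSolver.+-*-Solver

        private
          sum-cosets : (f : 𝔽 → ℤ) →
            sum (λ a → #∛ a ℤ.* f a) ℤ.+ (sum (λ a → #∛ (g * a) ℤ.* f a) ℤ.+ sum (λ a → #∛ (g² * a) ℤ.* f a)) ≡ + 3 ℤ.* sum f
          sum-cosets f = begin
            sum (λ a → #∛ a ℤ.* f a) ℤ.+ (sum (λ a → #∛ (g * a) ℤ.* f a) ℤ.+ sum (λ a → #∛ (g² * a) ℤ.* f a))
              ≡⟨ trans (sum-+ (λ a → #∛ a ℤ.* f a) (λ a → #∛ (g * a) ℤ.* f a ℤ.+ #∛ (g² * a) ℤ.* f a))
                   (cong₂ ℤ._+_ (refl {x = sum (λ a → #∛ a ℤ.* f a)}) (sum-+ (λ a → #∛ (g * a) ℤ.* f a) (λ a → #∛ (g² * a) ℤ.* f a))) ⟨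
            sum (λ a → #∛ a ℤ.* f a ℤ.+ (#∛ (g * a) ℤ.* f a ℤ.+ #∛ (g² * a) ℤ.* f a))
              ≡⟨ sum-cong-≗ {p} (λ a → trans
                   (ℤS.solve 4 (λ u v w x → u ℤS.:* x ℤS.:+ (v ℤS.:* x ℤS.:+ w ℤS.:* x) ℤS.:= (u ℤS.:+ (v ℤS.:+ w)) ℤS.:* x) refl (#∛ a) (#∛ (g * a)) (#∛ (g² * a)) (f a))
                   (cong (ℤ._* f a) (coset-identity a))) ⟩
            sum (λ a → + 3 ℤ.* f a)
              ≡⟨ sum-* (+ 3) f ⟩
            + 3 ℤ.* sum f ∎
            where open ≡-Reasoning
                  module ℤS = ℤSolver.+-*-Solver

        -- The three sums differ only in their weights, which add up to 3 and leave a complete sum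
        -- of σ.
        S-sum : S (ι 1) ℤ.+ (S g ℤ.+ S g²) ≡ + 0
        S-sum = begin
          S (ι 1) ℤ.+ (S g ℤ.+ S g²)               ≡⟨ cong₂ ℤ._+_ S-1 (cong₂ ℤ._+_ (S-square h≢0) (S-square g≢0)) ⟩
          _                                        ≡⟨ sum-cosets (λ a → σ (a + ι 1)) ⟩
          + 3 ℤ.* sum (λ a → σ (a + ι 1))          ≡⟨ cong (+ 3 ℤ.*_) (trans (sum-shift (ι 1) σ) sum-σ) ⟩
          + 0                                      ∎
          where open ≡-Reasoning

        -- Replacing a by g a in the sum for g², and by g² a in the sum for g, produces the argument
        -- g³ a, on which `S²` has the same value as on a. The weights then add up to 3.
        S²-sum : (+ p ℤ.- + 1) ℤ.* (S² (ι 1) ℤ.+ (S² g² ℤ.+ S² g)) ≡ + 3 ℤ.* sum S²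
        S²-sum = begin
          (+ p ℤ.- + 1) ℤ.* (S² (ι 1) ℤ.+ (S² g² ℤ.+ S² g))
            ≡⟨ ℤS.solve 4 (λ q u v w → q ℤS.:* (u ℤS.:+ (v ℤS.:+ w)) ℤS.:= q ℤS.:* u ℤS.:+ (q ℤS.:* v ℤS.:+ q ℤS.:* w)) refl
                 (+ p ℤ.- + 1) (S² (ι 1)) (S² g²) (S² g) ⟩
          (+ p ℤ.- + 1) ℤ.* S² (ι 1) ℤ.+ ((+ p ℤ.- + 1) ℤ.* S² g² ℤ.+ (+ p ℤ.- + 1) ℤ.* S² g)
            ≡⟨ cong₂ ℤ._+_ (sum-#∛*S² (ι 1)) (cong₂ ℤ._+_ (sum-#∛*S² g²) (sum-#∛*S² g)) ⟨
          sum (λ a → #∛ a ℤ.* S² (ι 1 * a)) ℤ.+ (sum (λ a → #∛ a ℤ.* S² (g² * a)) ℤ.+ sum (λ a → #∛ a ℤ.* S² (g * a)))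
            ≡⟨ cong₂ ℤ._+_ (sum-cong-≗ {p} (λ a → cong (λ b → #∛ a ℤ.* S² b) (*-identityˡ a)))
                 (cong₂ ℤ._+_ (sym (sum-scale g≢0 (λ a → #∛ a ℤ.* S² (g² * a)))) (sym (sum-scale g²≢0 (λ a → #∛ a ℤ.* S² (g * a))))) ⟩
          sum (λ a → #∛ a ℤ.* S² a) ℤ.+ (sum (λ a → #∛ (g * a) ℤ.* S² (g² * (g * a))) ℤ.+ sum (λ a → #∛ (g² * a) ℤ.* S² (g * (g² * a))))
            ≡⟨ cong₂ ℤ._+_ (refl {x = sum (λ a → #∛ a ℤ.* S² a)}) (cong₂ ℤ._+_
                 (sum-cong-≗ {p} (λ a → cong (#∛ (g * a) ℤ.*_) (trans (cong S² (sym (*-assoc g² g a))) (S²-scale a g≢0))))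
                 (sum-cong-≗ {p} (λ a → cong (#∛ (g² * a) ℤ.*_) (trans (cong S² (trans (sym (*-assoc g g² a)) (*-congʳ (*-comm g g²)))) (S²-scale a g≢0))))) ⟩
          sum (λ a → #∛ a ℤ.* S² a) ℤ.+ (sum (λ a → #∛ (g * a) ℤ.* S² a) ℤ.+ sum (λ a → #∛ (g² * a) ℤ.* S² a))
            ≡⟨ sum-cosets S² ⟩
          + 3 ℤ.* sum S² ∎
          where open ≡-Reasoning
                module ℤS = ℤSolver.+-*-Solver

    S-norm : ∃[ b ] S (ι 1) ℤ.* S (ι 1) ℤ.+ S (ι 1) ℤ.* b ℤ.+ b ℤ.* b ≡ + 3 ℤ.* + p
    -- The factor 2 comes from eliminating `S g²`, the factor p - 1 from the nonzero x in
    -- `sum-#∛*S²`.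
    S-norm = S g , ℤₚ.*-cancelˡ-≡ (+ 2 ℤ.* (+ p ℤ.- + 1)) _ _ {{ℤ.≢-nonZero 2[p-1]≢0}} (begin
      + 2 ℤ.* (+ p ℤ.- + 1) ℤ.* (S (ι 1) ℤ.* S (ι 1) ℤ.+ S (ι 1) ℤ.* S g ℤ.+ S g ℤ.* S g)
        ≡⟨ ℤS.solve 3 (λ q a b → ℤS.con (+ 2) ℤS.:* q ℤS.:* (a ℤS.:* a ℤS.:+ a ℤS.:* b ℤS.:+ b ℤS.:* b) ℤS.:=
             q ℤS.:* (a ℤS.:* a ℤS.:+ (ℤS.:- (a ℤS.:+ b) ℤS.:* ℤS.:- (a ℤS.:+ b) ℤS.:+ b ℤS.:* b))) refl (+ p ℤ.- + 1) (S (ι 1)) (S g) ⟩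
      (+ p ℤ.- + 1) ℤ.* (S² (ι 1) ℤ.+ (ℤ.- (S (ι 1) ℤ.+ S g) ℤ.* ℤ.- (S (ι 1) ℤ.+ S g) ℤ.+ S² g))
        ≡⟨ cong (λ c → (+ p ℤ.- + 1) ℤ.* (S² (ι 1) ℤ.+ (c ℤ.* c ℤ.+ S² g))) Sg²≡ ⟨
      (+ p ℤ.- + 1) ℤ.* (S² (ι 1) ℤ.+ (S² g² ℤ.+ S² g))
        ≡⟨ S²-sum ⟩
      + 3 ℤ.* sum S²
        ≡⟨ cong (+ 3 ℤ.*_) sum-S² ⟩
      + 3 ℤ.* (+ p ℤ.* (+ 3 ℤ.* + p ℤ.- + 2) ℤ.- + p ℤ.* + p)
        ≡⟨ ℤS.solve 1 (λ p → ℤS.con (+ 3) ℤS.:* (p ℤS.:* (ℤS.con (+ 3) ℤS.:* p ℤS.:- ℤS.con (+ 2)) ℤS.:- p ℤS.:* p) ℤS.:=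
             ℤS.con (+ 2) ℤS.:* (p ℤS.:- ℤS.con (+ 1)) ℤS.:* (ℤS.con (+ 3) ℤS.:* p)) refl (+ p) ⟩
      + 2 ℤ.* (+ p ℤ.- + 1) ℤ.* (+ 3 ℤ.* + p) ∎)
      where
      open ≡-Reasoning
      module ℤS = ℤSolver.+-*-Solver
      h : 𝔽
      h = proj₁ ∃-noncube
      h-noncube : ∀ x → cube x ≢ h
      h-noncube = proj₂ ∃-noncube
      open CubicCosets h h-noncube
      Sg²≡ : S g² ≡ ℤ.- (S (ι 1) ℤ.+ S g)
      Sg²≡ = i+j≡0⇒j≡-i (S (ι 1) ℤ.+ S g) (trans (ℤₚ.+-assoc (S (ι 1)) (S g) (S g²)) S-sum)
      2[p-1]≢0 : + 2 ℤ.* (+ p ℤ.- + 1) ≢ + 0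
      2[p-1]≢0 eq with ℤₚ.i*j≡0⇒i≡0∨j≡0 (+ 2) eq
      ... | inj₂ e = cardinality≢1 K (ℤₚ.+-injective (ℤₚ.i-j≡0⇒i≡j (+ p) (+ 1) e))

    -- The number of cube roots is 0 or 3 except at a = 0, where it is 1; modulo 3 only the term σ 1
    -- survives.
    3∣S-1 : + 3 ∣ S (ι 1) ℤ.- + 1
    3∣S-1 = subst (+ 3 ∣_) eq (sum-∣ {p} (λ a → (#∛ a ℤ.- 𝟙 (a ≟ ι 0)) ℤ.* σ (a + ι 1))
      (λ a → ∣m⇒∣m*n (σ (a + ι 1)) (3∣ a)))
      where
      open ≡-Reasoning
      3∣ : ∀ a → + 3 ∣ #∛ a ℤ.- 𝟙 (a ≟ ι 0)
      3∣ a with a ≟ ι 0 | cubeView a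
      ... | yes refl | _                 = divides (+ 0) (cong (ℤ._- + 1) #∛-0)
      ... | no a≢0   | isZero a≡0        = contradiction a≡0 a≢0
      ... | no _     | isCube s s≢0 refl = divides (+ 1) (cong (ℤ._- + 0) (#∛-cube s≢0))
      ... | no _     | isNoncube ∄       = divides (+ 0) (cong (ℤ._- + 0) (#∛-noncube ∄))
      eq : sum (λ a → (#∛ a ℤ.- 𝟙 (a ≟ ι 0)) ℤ.* σ (a + ι 1)) ≡ S (ι 1) ℤ.- + 1
      eq = begin
        sum (λ a → (#∛ a ℤ.- 𝟙 (a ≟ ι 0)) ℤ.* σ (a + ι 1))
          ≡⟨ sum-cong-≗ {p} (λ a → ℤS.solve 3 (λ u v w → (u ℤS.:- v) ℤS.:* w ℤS.:= u ℤS.:* w ℤS.:- v ℤS.:* w) refl (#∛ a) (𝟙 (a ≟ ι 0)) (σ (a + ι 1))) ⟩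
        sum (λ a → #∛ a ℤ.* σ (a + ι 1) ℤ.- 𝟙 (a ≟ ι 0) ℤ.* σ (a + ι 1))
          ≡⟨ sum-− {p} (λ a → #∛ a ℤ.* σ (a + ι 1)) (λ a → 𝟙 (a ≟ ι 0) ℤ.* σ (a + ι 1)) ⟩
        sum (λ a → #∛ a ℤ.* σ (a + ι 1)) ℤ.- sum (λ a → 𝟙 (a ≟ ι 0) ℤ.* σ (a + ι 1))
          ≡⟨ cong₂ ℤ._-_ (sym S-1) (trans (sum-𝟙-≡ (ι 0) (λ a → σ (a + ι 1))) (trans (cong σ (+-identityˡ (ι 1))) σ-1)) ⟩
        S (ι 1) ℤ.- + 1 ∎
        where module ℤS = ℤSolver.+-*-Solver

    private
      σ-parity : ∀ v → + 2 ∣ σ v ℤ.- (+ 1 ℤ.- 𝟙 (v ≟ ι 0))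
      σ-parity v with v ≟ ι 0 | squareView v
      ... | yes refl | _                   = divides (+ 0) (cong (ℤ._- + 0) σ-0)
      ... | no v≢0   | isZero v≡0          = contradiction v≡0 v≢0
      ... | no _     | isSquare s s≢0 refl = divides (+ 0) (cong (ℤ._- + 1) (σ-square s≢0))
      ... | no _     | isNonsquare ∄       = divides -[1+ 0 ] (cong (ℤ._- + 1) (σ-nonsquare ∄))

      sum-σ-parity : (f : 𝔽 → 𝔽) → + 2 ∣ sum (σ ∘ f) ℤ.- (+ p ℤ.- sum (λ x → 𝟙 (f x ≟ ι 0)))
      sum-σ-parity f = subst (+ 2 ∣_) eq (sum-∣ {p} (λ x → σ (f x) ℤ.- (+ 1 ℤ.- 𝟙 (f x ≟ ι 0))) (σ-parity ∘ f))
        where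
        eq : sum (λ x → σ (f x) ℤ.- (+ 1 ℤ.- 𝟙 (f x ≟ ι 0))) ≡ sum (σ ∘ f) ℤ.- (+ p ℤ.- sum (λ x → 𝟙 (f x ≟ ι 0)))
        eq = trans (sum-− {p} (σ ∘ f) (λ x → + 1 ℤ.- 𝟙 (f x ≟ ι 0)))
          (cong₂ ℤ._-_ (refl {x = sum (σ ∘ f)}) (trans (sum-− {p} (λ _ → + 1) (λ x → 𝟙 (f x ≟ ι 0)))
            (cong (ℤ._- sum (λ x → 𝟙 (f x ≟ ι 0))) (sum-1 p))))

    -- Modulo 2 a sum of values of σ counts nonzero arguments: x³ + 1 has three zeros, and ∑ σ = 0 shows p odd.
    2∣S : + 2 ∣ S (ι 1)
    2∣S = subst (+ 2 ∣_)
      (ℤS.solve 2 (λ s p → (s ℤS.:- (p ℤS.:- ℤS.con (+ 3))) ℤS.:- (ℤS.con (+ 0) ℤS.:- (p ℤS.:- ℤS.con (+ 1))) ℤS.:+ ℤS.con (ℤ.- + 2) ℤS.:= s) refl (S (ι 1)) (+ p))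
      (∣m∣n⇒∣m+n (∣m∣n⇒∣m-n
        (subst (λ z → + 2 ∣ S (ι 1) ℤ.- (+ p ℤ.- z)) zeros (sum-σ-parity (λ x → cube x + ι 1)))
        (subst₂ (λ s z → + 2 ∣ s ℤ.- (+ p ℤ.- z)) sum-σ (sum-𝟙 (ι 0)) (sum-σ-parity (λ x → x))))
        (divides (ℤ.- + 1) refl))
      where
      module ℤS = ℤSolver.+-*-Solver
      -1≢0 : - ι 1 ≢ ι 0
      -1≢0 e = 1≢0 (trans (sym (-‿involutive (ι 1))) (trans (cong -_ e) -0#≈0#))
      cube-+1 : ∀ x → cube x + ι 1 ≡ cube x - cube (- ι 1)
      cube-+1 x = solve 1 (λ x → x :* x :* x :+ # 1 := x :* x :* x :- (:- # 1) :* (:- # 1) :* (:- # 1)) refl x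
      zeros : sum (λ x → 𝟙 (cube x + ι 1 ≟ ι 0)) ≡ + 3
      zeros = trans (sum-cong-≗ {p} (λ x → 𝟙-cong (cube x + ι 1 ≟ ι 0) (cube x ≟ cube (- ι 1))
        (λ e → a-b≡0⇒a≡b (trans (sym (cube-+1 x)) e)) (λ e → trans (cube-+1 x) (a≡b⇒a-b≡0 e)))) (#∛-cube -1≢0)

    S≡2A₃ : ∀ {A} → Prime p → IsA₃ p A → S (ι 1) ≡ + 2 ℤ.* A
    S≡2A₃ p-prime A-isA₃ = let _ , S≡2A′ , A′-isA₃ = half-norm-IsA₃ p (S (ι 1)) (proj₁ S-norm) 2∣S 3∣S-1 (proj₂ S-norm) in
      trans S≡2A′ (cong (+ 2 ℤ.*_) (IsA₃-unique p-prime A′-isA₃ A-isA₃))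

-- Counting points on the surface

module _ {p : ℕ} (K : FiniteField p) where
  open FiniteField K
  open FieldProperties K

  module Surface (2≢0 : ι 2 ≢ ι 0) (3≢0 : ι 3 ≢ ι 0)
      {σ : Fin p → ℤ} (isQuadraticCharacter : IsQuadraticCharacter K σ)
      (ω : Fin p) (ω²+ω+1≡0 : ω * ω + ω + ι 1 ≡ ι 0)
      (J T : Fin p) (J≢2 : J ≢ ι 2) (J≢-2 : J ≢ - ι 2) (J≢-1 : J ≢ - ι 1)
      (C≢0 : ι 3 * J ^ 2 - ι 4 ≢ ι 0) (J+1≡T³[J-2] : J + ι 1 ≡ T ^ 3 * (J - ι 2)) where
    open FieldSums K
    open QuadraticCharacter K 2≢0 isQuadraticCharacter
    open CubicSums K 2≢0 3≢0 isQuadraticCharacter ω ω²+ω+1≡0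

    C D m n : 𝔽
    C = ι 3 * J ^ 2 - ι 4
    D = ι 9 * J ^ 3 - ι 36 * J - ι 28
    m = J - ι 2
    n = J + ι 2

    private
      :C :D :m :n : ∀ {k} → Polynomial k → Polynomial k
      :C J = # 3 :* J :^ 2 :- # 4
      :D J = # 9 :* J :^ 3 :- # 36 :* J :- # 28
      :m J = J :- # 2
      :n J = J :+ # 2

    m≢0 : m ≢ ι 0
    m≢0 = a≢b⇒a-b≢0 J≢2

    n≢0 : n ≢ ι 0
    n≢0 eq = J≢-2 (a-b≡0⇒a≡b (trans (+-congˡ (-‿involutive (ι 2))) eq))

    J+1≢0 : J + ι 1 ≢ ι 0
    J+1≢0 eq = J≢-1 (a-b≡0⇒a≡b (trans (+-congˡ (-‿involutive (ι 1))) eq))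

    mT³≡m+3 : m * cube T ≡ m + ι 3
    mT³≡m+3 = begin
      m * cube T            ≡⟨ solve 2 (λ m T → m :* (T :* T :* T) := T :^ 3 :* m) refl m T ⟩
      T ^ 3 * m             ≡⟨ J+1≡T³[J-2] ⟨
      J + ι 1               ≡⟨ solve 1 (λ J → J :+ # 1 := (J :- # 2) :+ # 3) refl J ⟩
      m + ι 3               ∎
      where open ≡-Reasoning

    T≢0 : T ≢ ι 0
    T≢0 refl = J+1≢0 (trans J+1≡T³[J-2] (trans (*-congʳ (zeroˡ _)) (zeroˡ m)))

    m[T³-1]≡3 : m * (cube T - ι 1) ≡ ι 3
    m[T³-1]≡3 = begin
      m * (cube T - ι 1)    ≡⟨ solve 2 (λ m t → m :* (t :- # 1) := m :* t :- m) refl m (cube T) ⟩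
      m * cube T - m        ≡⟨ cong (_- m) mT³≡m+3 ⟩
      (m + ι 3) - m         ≡⟨ solve 1 (λ m → (m :+ # 3) :- m := # 3) refl m ⟩
      ι 3                   ∎
      where open ≡-Reasoning

    -- The common value of `f`, `γ` and every `disc x z` at x = -2. That it is nonzero keeps -2 out
    -- of the roots of `f` and leaves `disc (- ι 2)` without roots.
    9mn³ : 𝔽
    9mn³ = ι 9 * (m * cube n)

    9≢0 : ι 9 ≢ ι 0
    9≢0 eq = *-≢0 3≢0 3≢0 (trans (solve 0 (# 3 :* # 3 := # 9) refl) eq)

    9mn³≢0 : 9mn³ ≢ ι 0
    9mn³≢0 = *-≢0 9≢0 (*-≢0 m≢0 (cube-≢0 n≢0))

    f : 𝔽 → 𝔽
    f x = (x - ι 2) * (x * x + C * x - D) + C * C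

    f[-2] : f (- ι 2) ≡ 9mn³
    f[-2] = solve 1 (λ J → (:- # 2 :- # 2) :* (:- # 2 :* :- # 2 :+ :C J :* :- # 2 :- :D J) :+ :C J :* :C J :=
      # 9 :* (:m J :* (:n J :* :n J :* :n J))) refl J

    f[2]≢0 : f (ι 2) ≢ ι 0
    f[2]≢0 eq = *-≢0 C≢0 C≢0 (trans (solve 2 (λ C D → C :* C := (# 2 :- # 2) :* (# 2 :* # 2 :+ C :* # 2 :- D) :+ C :* C) refl C D) eq)

    -- As a fractional linear map `v` sends -2 to infinity and infinity to -1. With 1/0 = 0 it sends
    -- -2 to -1 instead and becomes a permutation of the field.
    t v : 𝔽 → 𝔽
    t x = inv n * x + inv n * ι 2
    v x = ι 3 * inv (t x) + - ι 1

    nt≡x+2 : ∀ x → n * t x ≡ x + ι 2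
    nt≡x+2 x = trans (*-congˡ (sym (distribˡ (inv n) x (ι 2)))) (inv-cancelʳ (x + ι 2) n≢0)

    t≢0 : ∀ {x} → x ≢ - ι 2 → t x ≢ ι 0
    t≢0 {x} x≢-2 t≡0 = x≢-2 (a-b≡0⇒a≡b (trans (+-congˡ (-‿involutive (ι 2))) (trans (sym (nt≡x+2 x)) (trans (*-congˡ t≡0) (zeroʳ n)))))

    v[-2] : v (- ι 2) ≡ - ι 1
    v[-2] = begin
      ι 3 * inv (t (- ι 2)) + - ι 1      ≡⟨ cong (λ s → ι 3 * inv s + - ι 1) (solve 1 (λ i → i :* :- # 2 :+ i :* # 2 := # 0) refl (inv n)) ⟩
      ι 3 * inv (ι 0) + - ι 1            ≡⟨ cong (λ s → ι 3 * s + - ι 1) inv-0 ⟩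
      ι 3 * ι 0 + - ι 1                  ≡⟨ solve 0 (# 3 :* # 0 :+ :- # 1 := :- # 1) refl ⟩
      - ι 1                              ∎
      where open ≡-Reasoning

    sum-∘v : (g : 𝔽 → ℤ) → sum (λ x → g (v x)) ≡ sum g
    sum-∘v g = begin
      sum (λ x → g (ι 3 * inv (t x) + - ι 1))    ≡⟨ sum-affine (inv n * ι 2) (inv-≢0 n≢0) (λ t → g (ι 3 * inv t + - ι 1)) ⟩
      sum (λ t → g (ι 3 * inv t + - ι 1))        ≡⟨ sum-inv (λ w → g (ι 3 * w + - ι 1)) ⟩
      sum (λ w → g (ι 3 * w + - ι 1))            ≡⟨ sum-affine (- ι 1) 3≢0 g ⟩
      sum g                                      ∎
      where open ≡-Reasoning

    -- In terms of t the cubic is n³ (t³ + 3m t² - 9m t + 9m). Multiplied by 3w³ with w = 1/t, the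
    -- bracket becomes m (3w - 1)³ + m + 3, and m + 3 = m T³.
    f-as-cubes : ∀ {x} → x ≢ - ι 2 → ι 3 * cube (inv (t x)) * f x ≡ cube n * (m * (cube (v x) + cube T))
    f-as-cubes {x} x≢-2 = begin
      ι 3 * cube w * f x
        ≡⟨ cong (λ y → ι 3 * cube w * f y) (trans (solve 1 (λ x → x := (x :+ # 2) :- # 2) refl x) (cong (_- ι 2) (sym (nt≡x+2 x)))) ⟩
      ι 3 * cube w * f (n * t x - ι 2)
        -- The product e = w t is kept as a formal quantity, so that this is a polynomial identity;
        -- afterwards e is set to 1.
        ≡⟨ solve 3 (λ J t w →
             let x = :n J :* t :- # 2; e = w :* t in
             # 3 :* (w :* w :* w) :* ((x :- # 2) :* (x :* x :+ :C J :* x :- :D J) :+ :C J :* :C J) :=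
             (:n J :* :n J :* :n J) :* (# 3 :* (e :* e :* e) :+ # 9 :* :m J :* (e :* e) :* w :- # 27 :* :m J :* e :* (w :* w) :+ # 27 :* :m J :* (w :* w :* w)))
           refl J (t x) w ⟩
      g (w * t x)
        ≡⟨ cong g (*-invˡ (t≢0 x≢-2)) ⟩
      g (ι 1)
        ≡⟨ solve 3 (λ N m w → N :* (# 3 :* (# 1 :* # 1 :* # 1) :+ # 9 :* m :* (# 1 :* # 1) :* w :- # 27 :* m :* # 1 :* (w :* w) :+ # 27 :* m :* (w :* w :* w)) :=
             N :* (m :* ((# 3 :* w :+ :- # 1) :* (# 3 :* w :+ :- # 1) :* (# 3 :* w :+ :- # 1)) :+ (m :+ # 3))) refl (cube n) m w ⟩
      cube n * (m * cube (v x) + (m + ι 3))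
        ≡⟨ cong (λ r → cube n * (m * cube (v x) + r)) mT³≡m+3 ⟨
      cube n * (m * cube (v x) + m * cube T)
        ≡⟨ *-congˡ (sym (distribˡ m (cube (v x)) (cube T))) ⟩
      cube n * (m * (cube (v x) + cube T)) ∎
      where
      open ≡-Reasoning
      w : 𝔽
      w = inv (t x)
      g : 𝔽 → 𝔽
      g e = cube n * (ι 3 * (e * e * e) + ι 9 * m * (e * e) * w - ι 27 * m * e * (w * w) + ι 27 * m * (w * w * w))

    f≡0⇒cube : ∀ {x} → f x ≡ ι 0 → cube (v x) + cube T ≡ ι 0
    f≡0⇒cube {x} fx≡0 = *-cancelˡ m≢0 (*-cancelˡ (cube-≢0 n≢0) (begin
      cube n * (m * (cube (v x) + cube T))    ≡⟨ f-as-cubes (λ { refl → 9mn³≢0 (trans (sym f[-2]) fx≡0) }) ⟨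
      ι 3 * cube (inv (t x)) * f x            ≡⟨ *-congˡ fx≡0 ⟩
      ι 3 * cube (inv (t x)) * ι 0            ≡⟨ solve 3 (λ a n m → a :* # 0 := n :* (m :* # 0)) refl (ι 3 * cube (inv (t x))) (cube n) m ⟩
      cube n * (m * ι 0)                      ∎))
      where open ≡-Reasoning

    cube⇒f≡0 : ∀ {x} → cube (v x) + cube T ≡ ι 0 → f x ≡ ι 0
    cube⇒f≡0 {x} eq with x ≟ - ι 2
    -- At x = -2 the value v = -1 would force T³ = 1, against m (T³ - 1) = 3.
    ... | yes refl = contradiction (begin
      ι 3                          ≡⟨ m[T³-1]≡3 ⟨
      m * (cube T - ι 1)           ≡⟨ *-congˡ (solve 1 (λ t → t :- # 1 := :- # 1 :* :- # 1 :* :- # 1 :+ t) refl (cube T)) ⟩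
      m * (cube (- ι 1) + cube T)  ≡⟨ cong (λ u → m * (cube u + cube T)) v[-2] ⟨
      m * (cube (v x) + cube T)    ≡⟨ *-congˡ eq ⟩
      m * ι 0                      ≡⟨ zeroʳ m ⟩
      ι 0                          ∎) 3≢0
      where open ≡-Reasoning
    ... | no x≢-2 = *-cancelˡ (*-≢0 3≢0 (cube-≢0 (inv-≢0 (t≢0 x≢-2)))) (begin
      ι 3 * cube (inv (t x)) * f x            ≡⟨ f-as-cubes x≢-2 ⟩
      cube n * (m * (cube (v x) + cube T))    ≡⟨ cong (λ e → cube n * (m * e)) eq ⟩
      cube n * (m * ι 0)                      ≡⟨ solve 3 (λ a n m → n :* (m :* # 0) := a :* # 0) refl (ι 3 * cube (inv (t x))) (cube n) m ⟩
      ι 3 * cube (inv (t x)) * ι 0            ∎)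
      where open ≡-Reasoning

    count-roots-f : sum (λ x → 𝟙 (f x ≟ ι 0)) ≡ + 3
    count-roots-f = begin
      sum (λ x → 𝟙 (f x ≟ ι 0))                ≡⟨ sum-cong-≗ {p} (λ x → 𝟙-cong (f x ≟ ι 0) (cube (v x) ≟ cube (- T))
                                                    (λ e → a-b≡0⇒a≡b (trans (sum≡diff (v x)) (f≡0⇒cube e)))
                                                    (λ e → cube⇒f≡0 (trans (sym (sum≡diff (v x))) (a≡b⇒a-b≡0 e)))) ⟩
      sum (λ x → 𝟙 (cube (v x) ≟ cube (- T)))  ≡⟨ sum-∘v (λ u → 𝟙 (cube u ≟ cube (- T))) ⟩
      #∛ (cube (- T))                          ≡⟨ #∛-cube (λ e → T≢0 (trans (sym (-‿involutive T)) (trans (cong -_ e) -0#≈0#))) ⟩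
      + 3                                      ∎
      where
      open ≡-Reasoning
      sum≡diff : ∀ u → cube u - cube (- T) ≡ cube u + cube T
      sum≡diff u = solve 2 (λ u T → u :* u :* u :- :- T :* :- T :* :- T := u :* u :* u :+ T :* T :* T) refl u T

    -- The square (3w²)² turns (x + 2) f x into n⁴ times 3m (v³ + T³). At x = -2 the left side is 0,
    -- while v = -1 makes the product on the right σ (3m (T³ - 1)) = σ 9 = 1; the indicator
    -- subtracts it.
    σ-[x+2]f : ∀ x → σ ((x + ι 2) * f x) ≡ σ (ι 3 * m) ℤ.* σ (cube (v x) + cube T) ℤ.- 𝟙 (x ≟ - ι 2)
    σ-[x+2]f x with x ≟ - ι 2
    ... | yes refl = begin
      σ ((- ι 2 + ι 2) * f x)                                 ≡⟨ cong σ (trans (*-congʳ (-‿inverseˡ (ι 2))) (zeroˡ _)) ⟩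
      σ (ι 0)                                                 ≡⟨ σ-0 ⟩
      + 0                                                     ≡⟨ cong (ℤ._- + 1) (trans (sym (σ-square 3≢0)) (cong σ (*-congˡ (sym m[T³-1]≡3)))) ⟩
      σ (ι 3 * (m * (cube T - ι 1))) ℤ.- + 1                  ≡⟨ cong (λ u → σ u ℤ.- + 1) (solve 2 (λ m t → # 3 :* (m :* (t :- # 1)) :=
                                                                   # 3 :* m :* (:- # 1 :* :- # 1 :* :- # 1 :+ t)) refl m (cube T)) ⟩
      σ (ι 3 * m * (cube (- ι 1) + cube T)) ℤ.- + 1           ≡⟨ cong (λ u → σ (ι 3 * m * (cube u + cube T)) ℤ.- + 1) v[-2] ⟨
      σ (ι 3 * m * (cube (v x) + cube T)) ℤ.- + 1             ≡⟨ cong (ℤ._- + 1) (σ-* (ι 3 * m) _) ⟩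
      σ (ι 3 * m) ℤ.* σ (cube (v x) + cube T) ℤ.- + 1         ∎
      where open ≡-Reasoning
    ... | no x≢-2 = begin
      σ ((x + ι 2) * f x)                                     ≡⟨ σ-square-* _ (*-≢0 3≢0 (*-≢0 w≢0 w≢0)) ⟨
      σ ((ι 3 * (w * w)) * (ι 3 * (w * w)) * ((x + ι 2) * f x)) ≡⟨ cong σ squares ⟩
      σ ((n * n) * (n * n) * (ι 3 * m * (cube (v x) + cube T))) ≡⟨ σ-square-* _ (*-≢0 n≢0 n≢0) ⟩
      σ (ι 3 * m * (cube (v x) + cube T))                     ≡⟨ σ-* (ι 3 * m) _ ⟩
      σ (ι 3 * m) ℤ.* σ (cube (v x) + cube T)                 ≡⟨ ℤₚ.+-identityʳ _ ⟨
      σ (ι 3 * m) ℤ.* σ (cube (v x) + cube T) ℤ.- + 0         ∎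
      where
      open ≡-Reasoning
      w : 𝔽
      w = inv (t x)
      w≢0 : w ≢ ι 0
      w≢0 = inv-≢0 (t≢0 x≢-2)
      squares : (ι 3 * (w * w)) * (ι 3 * (w * w)) * ((x + ι 2) * f x) ≡ (n * n) * (n * n) * (ι 3 * m * (cube (v x) + cube T))
      squares = begin
        (ι 3 * (w * w)) * (ι 3 * (w * w)) * ((x + ι 2) * f x)
          ≡⟨ cong (λ s → (ι 3 * (w * w)) * (ι 3 * (w * w)) * (s * f x)) (nt≡x+2 x) ⟨
        (ι 3 * (w * w)) * (ι 3 * (w * w)) * (n * t x * f x)
          ≡⟨ solve 4 (λ w n t f → (# 3 :* (w :* w)) :* (# 3 :* (w :* w)) :* (n :* t :* f) :=
               # 3 :* n :* (w :* t) :* (# 3 :* (w :* w :* w) :* f)) refl w n (t x) (f x) ⟩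
        ι 3 * n * (w * t x) * (ι 3 * cube w * f x)
          ≡⟨ cong₂ (λ a b → ι 3 * n * a * b) (*-invˡ (t≢0 x≢-2)) (f-as-cubes x≢-2) ⟩
        ι 3 * n * ι 1 * (cube n * (m * (cube (v x) + cube T)))
          ≡⟨ solve 3 (λ n m c → # 3 :* n :* # 1 :* (n :* n :* n :* (m :* c)) := (n :* n) :* (n :* n) :* (# 3 :* m :* c)) refl n m (cube (v x) + cube T) ⟩
        (n * n) * (n * n) * (ι 3 * m * (cube (v x) + cube T)) ∎

    sum-σ-[x+2]f : sum (λ x → σ ((x + ι 2) * f x)) ≡ σ (ι 3 * m) ℤ.* (σ T ℤ.* S (ι 1)) ℤ.- + 1
    sum-σ-[x+2]f = begin
      sum (λ x → σ ((x + ι 2) * f x))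
        ≡⟨ sum-cong-≗ {p} σ-[x+2]f ⟩
      sum (λ x → σ (ι 3 * m) ℤ.* σ (cube (v x) + cube T) ℤ.- 𝟙 (x ≟ - ι 2))
        ≡⟨ sum-− {p} (λ x → σ (ι 3 * m) ℤ.* σ (cube (v x) + cube T)) (λ x → 𝟙 (x ≟ - ι 2)) ⟩
      sum (λ x → σ (ι 3 * m) ℤ.* σ (cube (v x) + cube T)) ℤ.- sum (λ x → 𝟙 (x ≟ - ι 2))
        ≡⟨ cong₂ ℤ._-_ (trans (sum-* (σ (ι 3 * m)) (λ x → σ (cube (v x) + cube T))) (cong (σ (ι 3 * m) ℤ.*_) inner)) (sum-𝟙 (- ι 2)) ⟩
      σ (ι 3 * m) ℤ.* (σ T ℤ.* S (ι 1)) ℤ.- + 1 ∎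
      where
      open ≡-Reasoning
      inner : sum (λ x → σ (cube (v x) + cube T)) ≡ σ T ℤ.* S (ι 1)
      inner = trans (sum-∘v (λ u → σ (cube u + cube T)))
        (trans (cong S (sym (*-identityʳ (cube T)))) (S-scale (ι 1) T≢0))

    -- The discriminant as a quadratic in z

    α β γ : 𝔽 → 𝔽
    α x = x * x - ι 4
    β x = - (ι 2 * C * (x + ι 2))
    γ x = C * C - ι 4 * (x * x) - ι 4 * C * x + ι 4 * D

    disc : 𝔽 → 𝔽 → 𝔽
    disc x z = α x * (z * z) + β x * z + γ x

    disc-disc : ∀ x → β x * β x - ι 4 * (α x * γ x) ≡ (ι 4 * ι 4) * ((x + ι 2) * f x)
    disc-disc x = solve 3 (λ x C D →
      :- (# 2 :* C :* (x :+ # 2)) :* :- (# 2 :* C :* (x :+ # 2)) :- # 4 :* ((x :* x :- # 4) :* (C :* C :- # 4 :* (x :* x) :- # 4 :* C :* x :+ # 4 :* D)) :=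
      # 4 :* # 4 :* ((x :+ # 2) :* ((x :- # 2) :* (x :* x :+ C :* x :- D) :+ C :* C))) refl x C D

    ι4≢0 : ι 4 ≢ ι 0
    ι4≢0 eq = 4≢0 (trans (solve 0 (# 2 :* # 2 := # 4) refl) eq)

    α-factor : ∀ x → α x ≡ (x - ι 2) * (x + ι 2)
    α-factor x = solve 1 (λ x → x :* x :- # 4 := (x :- # 2) :* (x :+ # 2)) refl x

    2≢-2 : ι 2 ≢ - ι 2
    2≢-2 = a≢-a 2≢0

    β[2]≢0 : β (ι 2) ≢ ι 0
    β[2]≢0 eq = *-≢0 (*-≢0 2≢0 C≢0) ι4≢0 (begin
      ι 2 * C * ι 4             ≡⟨ solve 1 (λ C → # 2 :* C :* # 4 := :- :- (# 2 :* C :* (# 2 :+ # 2))) refl C ⟩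
      - β (ι 2)                 ≡⟨ cong -_ eq ⟩
      - ι 0                     ≡⟨ -0#≈0# ⟩
      ι 0                       ∎)
      where open ≡-Reasoning

    β[-2]≡0 : β (- ι 2) ≡ ι 0
    β[-2]≡0 = solve 1 (λ C → :- (# 2 :* C :* (:- # 2 :+ # 2)) := # 0) refl C

    γ[-2] : γ (- ι 2) ≡ 9mn³
    γ[-2] = solve 1 (λ J → :C J :* :C J :- # 4 :* (:- # 2 :* :- # 2) :- # 4 :* :C J :* :- # 2 :+ # 4 :* :D J :=
      # 9 :* (:m J :* (:n J :* :n J :* :n J))) refl J

    σ-9mn³ : σ 9mn³ ≡ σ (m * n)
    σ-9mn³ = trans (cong σ (solve 2 (λ m n → # 9 :* (m :* (n :* n :* n)) := (# 3 :* n :* (# 3 :* n)) :* (m :* n)) refl m n))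
      (σ-square-* (m * n) (*-≢0 3≢0 n≢0))

    x≡±2⊎α≢0 : ∀ x → (x ≡ ι 2 ⊎ x ≡ - ι 2) ⊎ (x ≢ ι 2 × x ≢ - ι 2 × α x ≢ ι 0)
    x≡±2⊎α≢0 x with x ≟ ι 2 | x ≟ - ι 2
    ... | yes x≡2 | _        = inj₁ (inj₁ x≡2)
    ... | no _    | yes x≡-2 = inj₁ (inj₂ x≡-2)
    ... | no x≢2  | no x≢-2  = inj₂ (x≢2 , x≢-2 , λ eq → *-≢0 (a≢b⇒a-b≢0 x≢2)
      (λ e → x≢-2 (a-b≡0⇒a≡b (trans (+-congˡ (-‿involutive (ι 2))) e))) (trans (sym (α-factor x)) eq))

    α[2]≡0 : α (ι 2) ≡ ι 0
    α[2]≡0 = solve 0 (# 2 :* # 2 :- # 4 := # 0) refl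

    α[-2]≡0 : α (- ι 2) ≡ ι 0
    α[-2]≡0 = solve 0 (:- # 2 :* :- # 2 :- # 4 := # 0) refl

    disc[2] : ∀ z → disc (ι 2) z ≡ β (ι 2) * z + γ (ι 2)
    disc[2] z = trans (cong (λ a → a * (z * z) + β (ι 2) * z + γ (ι 2)) α[2]≡0)
      (solve 3 (λ z b c → # 0 :* (z :* z) :+ b :* z :+ c := b :* z :+ c) refl z (β (ι 2)) (γ (ι 2)))

    disc[-2] : ∀ z → disc (- ι 2) z ≡ 9mn³
    disc[-2] z = trans (cong₂ (λ a b → a * (z * z) + b * z + γ (- ι 2)) α[-2]≡0 β[-2]≡0)
      (trans (solve 2 (λ z c → # 0 :* (z :* z) :+ # 0 :* z :+ c := c) refl z (γ (- ι 2))) γ[-2])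

    disc-sym : ∀ x z → disc x z ≡ disc z x
    disc-sym x z = solve 4 (λ x z C D →
      (x :* x :- # 4) :* (z :* z) :+ :- (# 2 :* C :* (x :+ # 2)) :* z :+ (C :* C :- # 4 :* (x :* x) :- # 4 :* C :* x :+ # 4 :* D) :=
      (z :* z :- # 4) :* (x :* x) :+ :- (# 2 :* C :* (z :+ # 2)) :* x :+ (C :* C :- # 4 :* (z :* z) :- # 4 :* C :* z :+ # 4 :* D)) refl x z C D

    -- At a root, (3w)² (x² - 4) = m n (2a² + 2a - 1)² where a = -v, because a³ = T³ and 1 - a = 3w.
    σα-root : ∀ {x} → f x ≡ ι 0 → σ (α x) ≡ σ (m * n)
    σα-root {x} fx≡0 = begin
      σ (α x)                             ≡⟨ σ-square-* (α x) 3w≢0 ⟨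
      σ ((ι 3 * w) * (ι 3 * w) * α x)     ≡⟨ cong σ key ⟩
      σ (q * q * (m * n))                 ≡⟨ σ-square-* (m * n) q≢0 ⟩
      σ (m * n)                           ∎
      where
      open ≡-Reasoning
      x≢2 : x ≢ ι 2
      x≢2 refl = f[2]≢0 fx≡0
      x≢-2 : x ≢ - ι 2
      x≢-2 refl = 9mn³≢0 (trans (sym f[-2]) fx≡0)
      αx≢0 : α x ≢ ι 0
      αx≢0 = [ [ (λ e → contradiction e x≢2) , (λ e → contradiction e x≢-2) ]′ , (λ e → proj₂ (proj₂ e)) ]′ (x≡±2⊎α≢0 x)
      w a q : 𝔽
      w = inv (t x)
      a = ι 1 - ι 3 * w
      q = ι 2 * (a * a) + ι 2 * a - ι 1
      3w≢0 : ι 3 * w ≢ ι 0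
      3w≢0 = *-≢0 3≢0 (inv-≢0 (t≢0 x≢-2))
      [x+2]w≡n : (x + ι 2) * w ≡ n
      [x+2]w≡n = trans (cong (_* w) (sym (nt≡x+2 x))) (trans (*-assoc n (t x) w) (trans (*-congˡ (*-invʳ (t≢0 x≢-2))) (*-identityʳ n)))
      ma³≡m+3 : m * cube a ≡ m + ι 3
      ma³≡m+3 = begin
        m * cube a                        ≡⟨ *-congˡ (solve 2 (λ w c → (# 1 :- # 3 :* w) :* (# 1 :- # 3 :* w) :* (# 1 :- # 3 :* w) :=
                                               c :- ((# 3 :* w :+ :- # 1) :* (# 3 :* w :+ :- # 1) :* (# 3 :* w :+ :- # 1) :+ c)) refl w (cube T)) ⟩
        m * (cube T - (cube (v x) + cube T)) ≡⟨ cong (λ e → m * (cube T - e)) (f≡0⇒cube fx≡0) ⟩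
        m * (cube T - ι 0)                ≡⟨ solve 2 (λ m c → m :* (c :- # 0) := m :* c) refl m (cube T) ⟩
        m * cube T                        ≡⟨ mT³≡m+3 ⟩
        m + ι 3                           ∎
      key : (ι 3 * w) * (ι 3 * w) * α x ≡ q * q * (m * n)
      key = begin
        (ι 3 * w) * (ι 3 * w) * α x
          ≡⟨ solve 2 (λ x w → (# 3 :* w) :* (# 3 :* w) :* (x :* x :- # 4) := # 3 :* ((x :+ # 2) :* w) :* (# 3 :* ((x :+ # 2) :* w) :- # 4 :* (# 3 :* w))) refl x w ⟩
        ι 3 * ((x + ι 2) * w) * (ι 3 * ((x + ι 2) * w) - ι 4 * (ι 3 * w))
          ≡⟨ cong (λ k → ι 3 * k * (ι 3 * k - ι 4 * (ι 3 * w))) [x+2]w≡n ⟩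
        ι 3 * n * (ι 3 * n - ι 4 * (ι 3 * w))
          -- Both sides are (9m + 24 + 12a) n. The right one is arranged so that m + 3 = m a³ turns
          -- the bracket into m (4a⁴ + 8a³ - 4a + 1), which is m times the perfect square (2a² + 2a
          -- - 1)².
          ≡⟨ solve 2 (λ J w → let a = # 1 :- # 3 :* w in
               # 3 :* :n J :* (# 3 :* :n J :- # 4 :* (# 3 :* w)) :=
               (# 4 :* a :* (:m J :+ # 3) :+ # 8 :* (:m J :+ # 3) :- # 4 :* a :* :m J :+ :m J) :* :n J) refl J w ⟩
        (ι 4 * a * (m + ι 3) + ι 8 * (m + ι 3) - ι 4 * a * m + m) * n
          ≡⟨ cong (λ k → (ι 4 * a * k + ι 8 * k - ι 4 * a * m + m) * n) ma³≡m+3 ⟨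
        (ι 4 * a * (m * cube a) + ι 8 * (m * cube a) - ι 4 * a * m + m) * n
          ≡⟨ solve 3 (λ a m n → (# 4 :* a :* (m :* (a :* a :* a)) :+ # 8 :* (m :* (a :* a :* a)) :- # 4 :* a :* m :+ m) :* n :=
               (# 2 :* (a :* a) :+ # 2 :* a :- # 1) :* (# 2 :* (a :* a) :+ # 2 :* a :- # 1) :* (m :* n)) refl a m n ⟩
        q * q * (m * n) ∎
      q≢0 : q ≢ ι 0
      q≢0 = *-≢0ˡ (*-≢0ˡ (subst (_≢ ι 0) key (*-≢0 (*-≢0 3w≢0 3w≢0) αx≢0)))

    -- For x ≠ ±2 this is the sum over a genuine quadratic, which is degenerate exactly when f x =
    -- 0. At x = 2 the polynomial is linear and its sum vanishes; at x = -2 it is the constant 9 m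
    -- n³, with character σ (m n). The formula covers these cases because `α` vanishes at ±2.
    sum-σ-disc : ∀ x → sum (λ z → σ (disc x z)) ≡
      + p ℤ.* (𝟙 (f x ≟ ι 0) ℤ.* σ (α x)) ℤ.- σ (α x) ℤ.+ + p ℤ.* σ (m * n) ℤ.* 𝟙 (x ≟ - ι 2)
    sum-σ-disc x = [ [ at2 , at-2 ]′ , generic ]′ (x≡±2⊎α≢0 x)
      where
      open ≡-Reasoning
      module ℤS = ℤSolver.+-*-Solver
      at2 : x ≡ ι 2 → _
      at2 refl = begin
        sum (λ z → σ (disc (ι 2) z))                       ≡⟨ sum-cong-≗ {p} (λ z → cong σ (disc[2] z)) ⟩
        sum (λ z → σ (β (ι 2) * z + γ (ι 2)))              ≡⟨ sum-σ-affine (γ (ι 2)) β[2]≢0 ⟩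
        + 0                                                ≡⟨ ℤS.solve 3 (λ p F s → ℤS.con (+ 0) ℤS.:= p ℤS.:* (F ℤS.:* ℤS.con (+ 0)) ℤS.:- ℤS.con (+ 0) ℤS.:+ p ℤS.:* s ℤS.:* ℤS.con (+ 0))
                                                                refl (+ p) (𝟙 (f (ι 2) ≟ ι 0)) (σ (m * n)) ⟩
        + p ℤ.* (𝟙 (f (ι 2) ≟ ι 0) ℤ.* + 0) ℤ.- + 0 ℤ.+ + p ℤ.* σ (m * n) ℤ.* + 0
          ≡⟨ cong₂ (λ s d → + p ℤ.* (𝟙 (f (ι 2) ≟ ι 0) ℤ.* s) ℤ.- s ℤ.+ + p ℤ.* σ (m * n) ℤ.* d) (trans (cong σ α[2]≡0) σ-0) (𝟙-no (ι 2 ≟ - ι 2) 2≢-2) ⟨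
        _                                                  ∎
      at-2 : x ≡ - ι 2 → _
      at-2 refl = begin
        sum (λ z → σ (disc (- ι 2) z))                     ≡⟨ sum-cong-≗ {p} (λ z → trans (cong σ (disc[-2] z)) σ-9mn³) ⟩
        sum {p} (λ _ → σ (m * n))                          ≡⟨ sum-const p (σ (m * n)) ⟩
        + p ℤ.* σ (m * n)                                  ≡⟨ ℤS.solve 3 (λ p F s → p ℤS.:* s ℤS.:= p ℤS.:* (F ℤS.:* ℤS.con (+ 0)) ℤS.:- ℤS.con (+ 0) ℤS.:+ p ℤS.:* s ℤS.:* ℤS.con (+ 1))
                                                                refl (+ p) (𝟙 (f (- ι 2) ≟ ι 0)) (σ (m * n)) ⟩
        + p ℤ.* (𝟙 (f (- ι 2) ≟ ι 0) ℤ.* + 0) ℤ.- + 0 ℤ.+ + p ℤ.* σ (m * n) ℤ.* + 1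
          ≡⟨ cong₂ (λ s d → + p ℤ.* (𝟙 (f (- ι 2) ≟ ι 0) ℤ.* s) ℤ.- s ℤ.+ + p ℤ.* σ (m * n) ℤ.* d) (trans (cong σ α[-2]≡0) σ-0) (𝟙-yes (- ι 2 ≟ - ι 2) refl) ⟨
        _                                                  ∎
      generic : x ≢ ι 2 × x ≢ - ι 2 × α x ≢ ι 0 → _
      generic (x≢2 , x≢-2 , αx≢0) = begin
        sum (λ z → σ (disc x z))                           ≡⟨ sum-σ-quadratic (β x) (γ x) αx≢0 ⟩
        σ (α x) ℤ.* (+ p ℤ.* 𝟙 (β x * β x - ι 4 * (α x * γ x) ≟ ι 0) ℤ.- + 1)
          ≡⟨ cong (λ d → σ (α x) ℤ.* (+ p ℤ.* d ℤ.- + 1)) (𝟙-cong (β x * β x - ι 4 * (α x * γ x) ≟ ι 0) (f x ≟ ι 0)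
               (λ e → *-cancelˡ x+2≢0 (*-cancelˡ 16≢0 (trans (sym (disc-disc x)) (trans e (trans (sym (zeroʳ _)) (*-congˡ (sym (zeroʳ _))))))))
               (λ e → trans (disc-disc x) (trans (*-congˡ (trans (*-congˡ e) (zeroʳ _))) (zeroʳ _)))) ⟩
        σ (α x) ℤ.* (+ p ℤ.* 𝟙 (f x ≟ ι 0) ℤ.- + 1)
          ≡⟨ ℤS.solve 4 (λ a p F s → a ℤS.:* (p ℤS.:* F ℤS.:- ℤS.con (+ 1)) ℤS.:= p ℤS.:* (F ℤS.:* a) ℤS.:- a ℤS.:+ p ℤS.:* s ℤS.:* ℤS.con (+ 0))
               refl (σ (α x)) (+ p) (𝟙 (f x ≟ ι 0)) (σ (m * n)) ⟩
        + p ℤ.* (𝟙 (f x ≟ ι 0) ℤ.* σ (α x)) ℤ.- σ (α x) ℤ.+ + p ℤ.* σ (m * n) ℤ.* + 0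
          ≡⟨ cong (λ d → + p ℤ.* (𝟙 (f x ≟ ι 0) ℤ.* σ (α x)) ℤ.- σ (α x) ℤ.+ + p ℤ.* σ (m * n) ℤ.* d) (𝟙-no (x ≟ - ι 2) x≢-2) ⟨
        _                                                  ∎
        where
        x+2≢0 : x + ι 2 ≢ ι 0
        x+2≢0 e = x≢-2 (a-b≡0⇒a≡b (trans (+-congˡ (-‿involutive (ι 2))) e))
        16≢0 : ι 4 * ι 4 ≢ ι 0
        16≢0 = *-≢0 ι4≢0 ι4≢0

    -- The generic count 1 + σ ((x + 2) f x) is too large by one at x = ±2. At 2 it gives 1 + σ
    -- (4C²) = 2 for a linear polynomial with one root; at -2 it gives 1 for a nonzero constant.
    count-roots-disc : ∀ x → sum (λ z → 𝟙 (disc x z ≟ ι 0)) ≡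
      + 1 ℤ.+ σ ((x + ι 2) * f x) ℤ.- 𝟙 (x ≟ ι 2) ℤ.- 𝟙 (x ≟ - ι 2)
    count-roots-disc x = [ [ at2 , at-2 ]′ , generic ]′ (x≡±2⊎α≢0 x)
      where
      open ≡-Reasoning
      at2 : x ≡ ι 2 → _
      at2 refl = begin
        sum (λ z → 𝟙 (disc (ι 2) z ≟ ι 0))                 ≡⟨ sum-cong-≗ {p} (λ z → cong (λ d → 𝟙 (d ≟ ι 0)) (disc[2] z)) ⟩
        sum (λ z → 𝟙 (β (ι 2) * z + γ (ι 2) ≟ ι 0))        ≡⟨ sum-affine (γ (ι 2)) β[2]≢0 (λ u → 𝟙 (u ≟ ι 0)) ⟩
        sum (λ u → 𝟙 (u ≟ ι 0))                            ≡⟨ sum-𝟙 (ι 0) ⟩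
        + 1 ℤ.+ + 1 ℤ.- + 1 ℤ.- + 0
          ≡⟨ cong₂ (λ d e → + 1 ℤ.+ + 1 ℤ.- d ℤ.- e) (𝟙-yes (ι 2 ≟ ι 2) refl) (𝟙-no (ι 2 ≟ - ι 2) 2≢-2) ⟨
        + 1 ℤ.+ + 1 ℤ.- 𝟙 (ι 2 ≟ ι 2) ℤ.- 𝟙 (ι 2 ≟ - ι 2)
          ≡⟨ cong (λ s → + 1 ℤ.+ s ℤ.- 𝟙 (ι 2 ≟ ι 2) ℤ.- 𝟙 (ι 2 ≟ - ι 2)) (trans (cong σ (solve 2 (λ C D →
               (# 2 :+ # 2) :* ((# 2 :- # 2) :* (# 2 :* # 2 :+ C :* # 2 :- D) :+ C :* C) := (# 2 :* C) :* (# 2 :* C)) refl C D)) (σ-square (*-≢0 2≢0 C≢0))) ⟨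
        _                                                  ∎
      at-2 : x ≡ - ι 2 → _
      at-2 refl = begin
        sum (λ z → 𝟙 (disc (- ι 2) z ≟ ι 0))               ≡⟨ sum-cong-≗ {p} (λ z → 𝟙-no (disc (- ι 2) z ≟ ι 0) (λ e → 9mn³≢0 (trans (sym (disc[-2] z)) e))) ⟩
        sum {p} (λ _ → + 0)                                ≡⟨ sum-0 p ⟩
        + 1 ℤ.+ + 0 ℤ.- + 0 ℤ.- + 1
          ≡⟨ cong₂ (λ d e → + 1 ℤ.+ + 0 ℤ.- d ℤ.- e) (𝟙-no (- ι 2 ≟ ι 2) (λ e → 2≢-2 (sym e))) (𝟙-yes (- ι 2 ≟ - ι 2) refl) ⟨
        + 1 ℤ.+ + 0 ℤ.- 𝟙 (- ι 2 ≟ ι 2) ℤ.- 𝟙 (- ι 2 ≟ - ι 2)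
          ≡⟨ cong (λ s → + 1 ℤ.+ s ℤ.- 𝟙 (- ι 2 ≟ ι 2) ℤ.- 𝟙 (- ι 2 ≟ - ι 2)) (trans (cong σ (trans (*-congʳ (-‿inverseˡ (ι 2))) (zeroˡ _))) σ-0) ⟨
        _                                                  ∎
      generic : x ≢ ι 2 × x ≢ - ι 2 × α x ≢ ι 0 → _
      generic (x≢2 , x≢-2 , αx≢0) = begin
        sum (λ z → 𝟙 (disc x z ≟ ι 0))                     ≡⟨ count-quadratic-roots (β x) (γ x) αx≢0 ⟩
        + 1 ℤ.+ σ (β x * β x - ι 4 * (α x * γ x))          ≡⟨ cong (λ s → + 1 ℤ.+ s) (trans (cong σ (disc-disc x)) (σ-square-* _ ι4≢0)) ⟩
        + 1 ℤ.+ σ ((x + ι 2) * f x)                        ≡⟨ trans (ℤₚ.+-identityʳ _) (ℤₚ.+-identityʳ _) ⟨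
        + 1 ℤ.+ σ ((x + ι 2) * f x) ℤ.- + 0 ℤ.- + 0
          ≡⟨ cong₂ (λ d e → + 1 ℤ.+ σ ((x + ι 2) * f x) ℤ.- d ℤ.- e) (𝟙-no (x ≟ ι 2) x≢2) (𝟙-no (x ≟ - ι 2) x≢-2) ⟨
        _                                                  ∎

    -- Solutions, flips and fixed points

    Solution : 𝔽 → 𝔽 → 𝔽 → Set
    Solution x y z = x ^ 2 + y ^ 2 + z ^ 2 ≡ x * y * z - C * (x + y + z) + D

    solution? : ∀ x y z → Dec (Solution x y z)
    solution? x y z = x ^ 2 + y ^ 2 + z ^ 2 ≟ x * y * z - C * (x + y + z) + D

    Fixed : 𝔽 → 𝔽 → 𝔽 → Set
    Fixed x y z = y * z - C - x ≡ x

    fixed? : ∀ x y z → Dec (Fixed x y z)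
    fixed? x y z = y * z - C - x ≟ x

    private
      E : 𝔽 → 𝔽 → 𝔽 → 𝔽
      E x y z = (x * x + y * y + z * z) - (x * y * z - C * (x + y + z) + D)

      solution⇒E : ∀ {x y z} → Solution x y z → E x y z ≡ ι 0
      solution⇒E {x} {y} {z} s = trans (solve 4 (λ x y z r → (x :* x :+ y :* y :+ z :* z) :- r := (x :^ 2 :+ y :^ 2 :+ z :^ 2) :- r)
        refl x y z (x * y * z - C * (x + y + z) + D)) (a≡b⇒a-b≡0 s)

      E⇒solution : ∀ {x y z} → E x y z ≡ ι 0 → Solution x y z
      E⇒solution {x} {y} {z} e = a-b≡0⇒a≡b (trans (solve 4 (λ x y z r → (x :^ 2 :+ y :^ 2 :+ z :^ 2) :- r := (x :* x :+ y :* y :+ z :* z) :- r)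
        refl x y z (x * y * z - C * (x + y + z) + D)) e)

      E-swap₁₂ : ∀ x y z → E x y z ≡ E y x z
      E-swap₁₂ x y z = solve 5 (λ x y z C D → (x :* x :+ y :* y :+ z :* z) :- (x :* y :* z :- C :* (x :+ y :+ z) :+ D) :=
        (y :* y :+ x :* x :+ z :* z) :- (y :* x :* z :- C :* (y :+ x :+ z) :+ D)) refl x y z C D

      E-swap₂₃ : ∀ x y z → E x y z ≡ E x z y
      E-swap₂₃ x y z = solve 5 (λ x y z C D → (x :* x :+ y :* y :+ z :* z) :- (x :* y :* z :- C :* (x :+ y :+ z) :+ D) :=
        (x :* x :+ z :* z :+ y :* y) :- (x :* z :* y :- C :* (x :+ z :+ y) :+ D)) refl x y z C D

      fixed⇒2x : ∀ {x y z} → Fixed x y z → ι 2 * x ≡ y * z - C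
      fixed⇒2x {x} {y} {z} e = trans (solve 1 (λ x → # 2 :* x := x :+ x) refl x)
        (trans (cong (_+ x) (sym e)) (solve 2 (λ u x → u :- x :+ x := u) refl (y * z - C) x))

      2x⇒fixed : ∀ {x y z} → ι 2 * x ≡ y * z - C → Fixed x y z
      2x⇒fixed {x} e = trans (cong (_- x) (sym e)) (solve 1 (λ x → # 2 :* x :- x := x) refl x)

      -- Completing the square in x. The first flip fixes the point exactly when the square
      -- vanishes, so a fixed triple is a solution exactly when `disc y z` is 0.
      4E : ∀ x y z → ι 4 * E x y z ≡ (ι 2 * x - (y * z - C)) * (ι 2 * x - (y * z - C)) - disc y z
      4E x y z = solve 5 (λ x y z C D → # 4 :* ((x :* x :+ y :* y :+ z :* z) :- (x :* y :* z :- C :* (x :+ y :+ z) :+ D)) :=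
        (# 2 :* x :- (y :* z :- C)) :* (# 2 :* x :- (y :* z :- C)) :-
        ((y :* y :- # 4) :* (z :* z) :+ :- (# 2 :* C :* (y :+ # 2)) :* z :+ (C :* C :- # 4 :* (y :* y) :- # 4 :* C :* y :+ # 4 :* D))) refl x y z C D

      4E-fixed : ∀ {x y z} → Fixed x y z → ι 4 * E x y z ≡ - disc y z
      4E-fixed {x} {y} {z} e = trans (4E x y z) (trans (cong (λ u → u * u - disc y z) (a≡b⇒a-b≡0 (fixed⇒2x e)))
        (solve 1 (λ d → # 0 :* # 0 :- d := :- d) refl (disc y z)))

      fixed-solution⇒disc : ∀ {x y z} → Solution x y z → Fixed x y z → disc y z ≡ ι 0
      fixed-solution⇒disc {x} {y} {z} s e = begin
        disc y z             ≡⟨ -‿involutive (disc y z) ⟨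
        - - disc y z         ≡⟨ cong -_ (4E-fixed e) ⟨
        - (ι 4 * E x y z)    ≡⟨ cong (λ u → - (ι 4 * u)) (solution⇒E s) ⟩
        - (ι 4 * ι 0)        ≡⟨ solve 0 (:- (# 4 :* # 0) := # 0) refl ⟩
        ι 0                  ∎
        where open ≡-Reasoning

      fixed-disc⇒solution : ∀ {x y z} → disc y z ≡ ι 0 → Fixed x y z → Solution x y z
      fixed-disc⇒solution {x} {y} {z} d e = E⇒solution (*-cancelˡ ι4≢0
        (trans (4E-fixed e) (trans (cong -_ d) (trans -0#≈0# (sym (zeroʳ (ι 4)))))))

    solution-swap₁₂ : ∀ {x y z} → Solution x y z → Solution y x z
    solution-swap₁₂ {x} {y} {z} s = E⇒solution (trans (sym (E-swap₁₂ x y z)) (solution⇒E s))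

    solution-swap₂₃ : ∀ {x y z} → Solution x y z → Solution x z y
    solution-swap₂₃ {x} {y} {z} s = E⇒solution (trans (sym (E-swap₂₃ x y z)) (solution⇒E s))

    -- For fixed y and z the roots of the equation in x have sum y z - C, and the flip exchanges
    -- them.
    solution-flip₁ : ∀ {x y z} → Solution x y z → Solution (y * z - C - x) y z
    solution-flip₁ {x} {y} {z} s = E⇒solution (trans (solve 5 (λ x y z C D → let x′ = y :* z :- C :- x in
      (x′ :* x′ :+ y :* y :+ z :* z) :- (x′ :* y :* z :- C :* (x′ :+ y :+ z) :+ D) :=
      (x :* x :+ y :* y :+ z :* z) :- (x :* y :* z :- C :* (x :+ y :+ z) :+ D)) refl x y z C D) (solution⇒E s))

    solution-flip₂ : ∀ {x y z} → Solution x y z → Solution x (x * z - C - y) z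
    solution-flip₂ = solution-swap₁₂ ∘ solution-flip₁ ∘ solution-swap₁₂

    solution-flip₃ : ∀ {x y z} → Solution x y z → Solution x y (x * y - C - z)
    solution-flip₃ = solution-swap₂₃ ∘ solution-swap₁₂ ∘ solution-flip₁ ∘ solution-swap₁₂ ∘ solution-swap₂₃

    flip-involutive : ∀ u x → u - (u - x) ≡ x
    flip-involutive u x = solve 2 (λ u x → u :- (u :- x) := x) refl u x

    count-solutions-xz : ∀ x z → sum (λ y → 𝟙 (solution? x y z)) ≡ + 1 ℤ.+ σ (disc x z)
    count-solutions-xz x z = begin
      sum (λ y → 𝟙 (solution? x y z))
        ≡⟨ sum-cong-≗ {p} (λ y → 𝟙-cong (solution? x y z) (ι 1 * (y * y) + b * y + c ≟ ι 0)
             (λ s → trans (quadratic y) (solution⇒E s)) (λ e → E⇒solution (trans (sym (quadratic y)) e))) ⟩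
      sum (λ y → 𝟙 (ι 1 * (y * y) + b * y + c ≟ ι 0))
        ≡⟨ count-quadratic-roots b c 1≢0 ⟩
      + 1 ℤ.+ σ (b * b - ι 4 * (ι 1 * c))
        ≡⟨ cong (λ d → + 1 ℤ.+ σ d) (solve 4 (λ x z C D → let b = C :- x :* z; c = x :* x :+ z :* z :+ C :* (x :+ z) :- D in
             b :* b :- # 4 :* (# 1 :* c) :=
             (x :* x :- # 4) :* (z :* z) :+ :- (# 2 :* C :* (x :+ # 2)) :* z :+ (C :* C :- # 4 :* (x :* x) :- # 4 :* C :* x :+ # 4 :* D)) refl x z C D) ⟩
      + 1 ℤ.+ σ (disc x z) ∎
      where
      open ≡-Reasoning
      b c : 𝔽
      b = C - x * z
      c = x * x + z * z + C * (x + z) - D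
      quadratic : ∀ y → ι 1 * (y * y) + b * y + c ≡ E x y z
      quadratic y = solve 5 (λ x y z C D → # 1 :* (y :* y) :+ (C :- x :* z) :* y :+ (x :* x :+ z :* z :+ C :* (x :+ z) :- D) :=
        (x :* x :+ y :* y :+ z :* z) :- (x :* y :* z :- C :* (x :+ y :+ z) :+ D)) refl x y z C D

    -- The coefficient 4 collects σ (m n) once from each of the three roots of `f` and once from x =
    -- -2. The summand 1 is minus the sum of σ (x² - 4).
    count-solutions : sum³ (λ x y z → 𝟙 (solution? x y z)) ≡ + p ℤ.* + p ℤ.+ + 1 ℤ.+ + 4 ℤ.* σ (m * n) ℤ.* + p
    count-solutions = begin
      sum (λ x → sum (λ y → sum (λ z → 𝟙 (solution? x y z))))
        ≡⟨ sum-cong-≗ {p} (λ x → trans (sum-comm (λ y z → 𝟙 (solution? x y z))) (sum-cong-≗ {p} (count-solutions-xz x))) ⟩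
      sum (λ x → sum (λ z → + 1 ℤ.+ σ (disc x z)))
        ≡⟨ sum-cong-≗ {p} slice ⟩
      sum (λ x → + p ℤ.+ (+ p ℤ.* r x ℤ.- σ (α x) ℤ.+ + p ℤ.* σ (m * n) ℤ.* e x))
        ≡⟨ sum-+ (λ _ → + p) (λ x → + p ℤ.* r x ℤ.- σ (α x) ℤ.+ + p ℤ.* σ (m * n) ℤ.* e x) ⟩
      sum {p} (λ _ → + p) ℤ.+ sum (λ x → + p ℤ.* r x ℤ.- σ (α x) ℤ.+ + p ℤ.* σ (m * n) ℤ.* e x)
        ≡⟨ cong₂ ℤ._+_ (sum-const p (+ p)) (trans (sum-+ (λ x → + p ℤ.* r x ℤ.- σ (α x)) (λ x → + p ℤ.* σ (m * n) ℤ.* e x))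
             (cong₂ ℤ._+_ (sum-− {p} (λ x → + p ℤ.* r x) (λ x → σ (α x))) (trans (sum-* (+ p ℤ.* σ (m * n)) e) (cong (+ p ℤ.* σ (m * n) ℤ.*_) (sum-𝟙 (- ι 2)))))) ⟩
      + p ℤ.* + p ℤ.+ (sum (λ x → + p ℤ.* r x) ℤ.- sum (λ x → σ (α x)) ℤ.+ + p ℤ.* σ (m * n) ℤ.* + 1)
        ≡⟨ cong₂ (λ a b → + p ℤ.* + p ℤ.+ (a ℤ.- b ℤ.+ + p ℤ.* σ (m * n) ℤ.* + 1)) (trans (sum-* (+ p) r) (cong (+ p ℤ.*_) sum-r)) sum-σα ⟩
      + p ℤ.* + p ℤ.+ (+ p ℤ.* (+ 3 ℤ.* σ (m * n)) ℤ.- -[1+ 0 ] ℤ.+ + p ℤ.* σ (m * n) ℤ.* + 1)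
        ≡⟨ ℤS.solve 2 (λ p s → p ℤS.:* p ℤS.:+ (p ℤS.:* (ℤS.con (+ 3) ℤS.:* s) ℤS.:- ℤS.con -[1+ 0 ] ℤS.:+ p ℤS.:* s ℤS.:* ℤS.con (+ 1)) ℤS.:=
             p ℤS.:* p ℤS.:+ ℤS.con (+ 1) ℤS.:+ ℤS.con (+ 4) ℤS.:* s ℤS.:* p) refl (+ p) (σ (m * n)) ⟩
      + p ℤ.* + p ℤ.+ + 1 ℤ.+ + 4 ℤ.* σ (m * n) ℤ.* + p ∎
      where
      open ≡-Reasoning
      module ℤS = ℤSolver.+-*-Solver
      r e : 𝔽 → ℤ
      r x = 𝟙 (f x ≟ ι 0) ℤ.* σ (α x)
      e x = 𝟙 (x ≟ - ι 2)
      slice : ∀ x → sum (λ z → + 1 ℤ.+ σ (disc x z)) ≡ + p ℤ.+ (+ p ℤ.* r x ℤ.- σ (α x) ℤ.+ + p ℤ.* σ (m * n) ℤ.* e x)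
      slice x = trans (sum-+ (λ _ → + 1) (λ z → σ (disc x z))) (cong₂ ℤ._+_ (sum-1 p) (sum-σ-disc x))
      sum-r : sum r ≡ + 3 ℤ.* σ (m * n)
      sum-r = trans (sum-cong-≗ {p} (λ x → 𝟙-*-cong (f x ≟ ι 0) {σ (α x)} {σ (m * n)} σα-root))
        (trans (sym (*-distribʳ-sum (σ (m * n)) (λ x → 𝟙 (f x ≟ ι 0)))) (cong (ℤ._* σ (m * n)) count-roots-f))
      sum-σα : sum (λ x → σ (α x)) ≡ -[1+ 0 ]
      sum-σα = trans (sum-σ-x²+e (- ι 4)) (trans (cong (λ d → + p ℤ.* d ℤ.- + 1) (𝟙-no (- ι 4 ≟ ι 0)
        (λ e → ι4≢0 (trans (sym (-‿involutive (ι 4))) (trans (cong -_ e) -0#≈0#))))) (cong (ℤ._- + 1) (ℤₚ.*-zeroʳ (+ p))))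

    -- The number of solutions fixed by one given flip. The 3 consists of the corrections at x = 2
    -- and x = -2 and of the 1 subtracted in `sum-σ-[x+2]f`.
    N₁ : ℤ
    N₁ = + p ℤ.- + 3 ℤ.+ σ (ι 3 * m) ℤ.* (σ T ℤ.* S (ι 1))

    -- Over a pair (y, z) with `disc y z` equal to 0 lies exactly one fixed solution, with x = (y z
    -- - C) / 2; over other pairs there is none.
    count-fixed : sum³ (λ x y z → 𝟙 (solution? x y z) ℤ.* 𝟙 (fixed? x y z)) ≡ N₁
    count-fixed = begin
      sum (λ x → sum (λ y → sum (λ z → 𝟙 (solution? x y z) ℤ.* 𝟙 (fixed? x y z))))
        ≡⟨ sum-comm (λ x y → sum (λ z → 𝟙 (solution? x y z) ℤ.* 𝟙 (fixed? x y z))) ⟩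
      sum (λ y → sum (λ x → sum (λ z → 𝟙 (solution? x y z) ℤ.* 𝟙 (fixed? x y z))))
        ≡⟨ sum-cong-≗ {p} (λ y → trans (sum-comm (λ x z → 𝟙 (solution? x y z) ℤ.* 𝟙 (fixed? x y z)))
             (trans (sum-cong-≗ {p} (inner y)) (count-roots-disc y))) ⟩
      sum (λ y → + 1 ℤ.+ σ ((y + ι 2) * f y) ℤ.- 𝟙 (y ≟ ι 2) ℤ.- 𝟙 (y ≟ - ι 2))
        ≡⟨ trans (sum-− {p} (λ y → + 1 ℤ.+ σ ((y + ι 2) * f y) ℤ.- 𝟙 (y ≟ ι 2)) (λ y → 𝟙 (y ≟ - ι 2)))
             (cong₂ ℤ._-_ (trans (sum-− {p} (λ y → + 1 ℤ.+ σ ((y + ι 2) * f y)) (λ y → 𝟙 (y ≟ ι 2)))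
               (cong₂ ℤ._-_ (trans (sum-+ (λ _ → + 1) (λ y → σ ((y + ι 2) * f y))) (cong₂ ℤ._+_ (sum-1 p) sum-σ-[x+2]f)) (sum-𝟙 (ι 2)))) (sum-𝟙 (- ι 2))) ⟩
      + p ℤ.+ (σ (ι 3 * m) ℤ.* (σ T ℤ.* S (ι 1)) ℤ.- + 1) ℤ.- + 1 ℤ.- + 1
        ≡⟨ ℤS.solve 2 (λ p s → p ℤS.:+ (s ℤS.:- ℤS.con (+ 1)) ℤS.:- ℤS.con (+ 1) ℤS.:- ℤS.con (+ 1) ℤS.:= p ℤS.:- ℤS.con (+ 3) ℤS.:+ s)
             refl (+ p) (σ (ι 3 * m) ℤ.* (σ T ℤ.* S (ι 1))) ⟩
      N₁ ∎
      where
      open ≡-Reasoning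
      module ℤS = ℤSolver.+-*-Solver
      inner : ∀ y z → sum (λ x → 𝟙 (solution? x y z) ℤ.* 𝟙 (fixed? x y z)) ≡ 𝟙 (disc y z ≟ ι 0)
      inner y z = begin
        sum (λ x → 𝟙 (solution? x y z) ℤ.* 𝟙 (fixed? x y z))
          ≡⟨ sum-cong-≗ {p} (λ x → trans (sym (𝟙-× (solution? x y z) (fixed? x y z)))
               (trans (𝟙-cong (solution? x y z ×-dec fixed? x y z) ((x ≟ h) ×-dec (disc y z ≟ ι 0))
                 (λ (s , e) → *-cancelˡ 2≢0 (trans (fixed⇒2x e) (sym 2h)) , fixed-solution⇒disc s e)
                 (λ { (refl , d) → fixed-disc⇒solution d (2x⇒fixed 2h) , 2x⇒fixed 2h }))
                 (𝟙-× (x ≟ h) (disc y z ≟ ι 0)))) ⟩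
        sum (λ x → 𝟙 (x ≟ h) ℤ.* 𝟙 (disc y z ≟ ι 0))
          ≡⟨ sum-𝟙-≡ h (λ _ → 𝟙 (disc y z ≟ ι 0)) ⟩
        𝟙 (disc y z ≟ ι 0) ∎
        where
        h : 𝔽
        h = inv (ι 2) * (y * z - C)
        2h : ι 2 * h ≡ y * z - C
        2h = inv-cancelʳ (y * z - C) 2≢0

    private
      fixed₁₂⇒z≢-2 : ∀ {x y z} → Solution x y z → Fixed x y z → z ≢ - ι 2
      fixed₁₂⇒z≢-2 {x} {y} s e refl = 9mn³≢0 (trans (sym (disc[-2] y)) (trans (disc-sym (- ι 2) y) (fixed-solution⇒disc s e)))

      -- The difference of the two fixing conditions is (z + 2) (x - y) = 0.
      fixed₁₂⇒x≡y : ∀ {x y z} → Solution x y z → Fixed x y z → Fixed y x z → x ≡ y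
      fixed₁₂⇒x≡y {x} {y} {z} s e₁ e₂ = a-b≡0⇒a≡b (*-cancelˡ (λ z+2≡0 → fixed₁₂⇒z≢-2 s e₁ (a-b≡0⇒a≡b (trans (+-congˡ (-‿involutive (ι 2))) z+2≡0))) (begin
        (z + ι 2) * (x - y)
          ≡⟨ solve 4 (λ x y z C → (z :+ # 2) :* (x :- y) := (# 2 :* x :- (y :* z :- C)) :- (# 2 :* y :- (x :* z :- C))) refl x y z C ⟩
        (ι 2 * x - (y * z - C)) - (ι 2 * y - (x * z - C))
          ≡⟨ cong₂ _-_ (a≡b⇒a-b≡0 (fixed⇒2x e₁)) (a≡b⇒a-b≡0 (fixed⇒2x e₂)) ⟩
        ι 0 - ι 0
          ≡⟨ solve 1 (λ z → # 0 :- # 0 := z :* # 0) refl (z + ι 2) ⟩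
        (z + ι 2) * ι 0 ∎))
        where open ≡-Reasoning

      diagonal-fixed : ∀ {x z} → Fixed x x z → (z - ι 2) * x ≡ C
      diagonal-fixed {x} {z} e = a-b≡0⇒a≡b (trans (solve 3 (λ x z C → (z :- # 2) :* x :- C := (x :* z :- C) :- # 2 :* x) refl x z C)
        (a≡b⇒a-b≡0 (sym (fixed⇒2x e))))

      diagonal-fixed⁻¹ : ∀ {x z} → (z - ι 2) * x ≡ C → Fixed x x z
      diagonal-fixed⁻¹ {x} {z} e = 2x⇒fixed (sym (a-b≡0⇒a≡b (trans (solve 3 (λ x z C → (x :* z :- C) :- # 2 :* x := (z :- # 2) :* x :- C) refl x z C) (a≡b⇒a-b≡0 e))))

      -- After multiplication by z - 2, the variable x occurs only in u = (z - 2) x, through 2 C u -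
      -- u²; at u = C this is C².
      diagonal-E : ∀ {x z} → (z - ι 2) * x ≡ C → (z - ι 2) * E x x z ≡ f z
      diagonal-E {x} {z} e = begin
        (z - ι 2) * E x x z
          ≡⟨ solve 4 (λ x z C D → let u = (z :- # 2) :* x in (z :- # 2) :* ((x :* x :+ x :* x :+ z :* z) :- (x :* x :* z :- C :* (x :+ x :+ z) :+ D)) :=
               (z :- # 2) :* (z :* z :+ C :* z :- D) :+ (# 2 :* C :* u :- u :* u)) refl x z C D ⟩
        (z - ι 2) * (z * z + C * z - D) + (ι 2 * C * ((z - ι 2) * x) - (z - ι 2) * x * ((z - ι 2) * x))
          ≡⟨ cong (λ u → (z - ι 2) * (z * z + C * z - D) + (ι 2 * C * u - u * u)) e ⟩
        (z - ι 2) * (z * z + C * z - D) + (ι 2 * C * C - C * C)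
          ≡⟨ solve 2 (λ g C → g :+ (# 2 :* C :* C :- C :* C) := g :+ C :* C) refl ((z - ι 2) * (z * z + C * z - D)) C ⟩
        f z ∎
        where open ≡-Reasoning

    Fixed₁₂ : 𝔽 → 𝔽 → 𝔽 → Set
    Fixed₁₂ x y z = Fixed x y z × Fixed y x z

    -- These points are (c, c, z) with c = C / (z - 2), one for each root z of `f`; the value z = 2
    -- is excluded by f 2 = C².
    count-fixed₁₂ : sum³ (λ x y z → 𝟙 (solution? x y z) ℤ.* (𝟙 (fixed? x y z) ℤ.* 𝟙 (fixed? y x z))) ≡ + 3
    count-fixed₁₂ = begin
      sum³ (λ x y z → 𝟙 (solution? x y z) ℤ.* (𝟙 (fixed? x y z) ℤ.* 𝟙 (fixed? y x z)))
        ≡⟨ sum³-cong pointwise ⟩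
      sum³ (λ x y z → 𝟙 (x ≟ c z) ℤ.* (𝟙 (y ≟ c z) ℤ.* 𝟙 (f z ≟ ι 0)))
        ≡⟨ sum³-swap₂₃ (λ x z y → 𝟙 (x ≟ c z) ℤ.* (𝟙 (y ≟ c z) ℤ.* 𝟙 (f z ≟ ι 0))) ⟩
      sum³ (λ x z y → 𝟙 (x ≟ c z) ℤ.* (𝟙 (y ≟ c z) ℤ.* 𝟙 (f z ≟ ι 0)))
        ≡⟨ sum³-swap₁₂ (λ z x y → 𝟙 (x ≟ c z) ℤ.* (𝟙 (y ≟ c z) ℤ.* 𝟙 (f z ≟ ι 0))) ⟩
      sum³ (λ z x y → 𝟙 (x ≟ c z) ℤ.* (𝟙 (y ≟ c z) ℤ.* 𝟙 (f z ≟ ι 0)))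
        ≡⟨ sum-cong-≗ {p} (λ z → trans (sum-cong-≗ {p} (λ x → trans (sum-* (𝟙 (x ≟ c z)) (λ y → 𝟙 (y ≟ c z) ℤ.* 𝟙 (f z ≟ ι 0)))
             (cong (𝟙 (x ≟ c z) ℤ.*_) (sum-𝟙-≡ (c z) (λ _ → 𝟙 (f z ≟ ι 0)))))) (sum-𝟙-≡ (c z) (λ _ → 𝟙 (f z ≟ ι 0)))) ⟩
      sum (λ z → 𝟙 (f z ≟ ι 0))
        ≡⟨ count-roots-f ⟩
      + 3 ∎
      where
      open ≡-Reasoning
      c : 𝔽 → 𝔽
      c z = inv (z - ι 2) * C
      [z-2]c≡C : ∀ {z} → z ≢ ι 2 → (z - ι 2) * c z ≡ C
      [z-2]c≡C z≢2 = inv-cancelʳ C (a≢b⇒a-b≢0 z≢2)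
      on-diagonal : ∀ x y z → x ≡ y → Solution x y z → Fixed x y z → x ≡ c z × (y ≡ c z × f z ≡ ι 0)
      on-diagonal x _ z refl s e₁ = x≡c , x≡c , trans (sym (diagonal-E u≡C)) (trans (*-congˡ (solution⇒E s)) (zeroʳ _))
        where
        u≡C : (z - ι 2) * x ≡ C
        u≡C = diagonal-fixed e₁
        z-2≢0 : z - ι 2 ≢ ι 0
        z-2≢0 = *-≢0ˡ (subst (_≢ ι 0) (sym u≡C) C≢0)
        x≡c : x ≡ c z
        x≡c = trans (sym (inv-cancelˡ x z-2≢0)) (*-congˡ u≡C)
      to : ∀ x y z → Solution x y z × Fixed₁₂ x y z → x ≡ c z × (y ≡ c z × f z ≡ ι 0)
      to x y z (s , e₁ , e₂) = on-diagonal x y z (fixed₁₂⇒x≡y s e₁ e₂) s e₁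
      from : ∀ x y z → x ≡ c z × (y ≡ c z × f z ≡ ι 0) → Solution x y z × Fixed₁₂ x y z
      from x y z (refl , refl , fz≡0) =
        E⇒solution (*-cancelˡ (a≢b⇒a-b≢0 z≢2) (trans (diagonal-E u≡C) (trans fz≡0 (sym (zeroʳ _))))) ,
        diagonal-fixed⁻¹ u≡C , diagonal-fixed⁻¹ u≡C
        where
        z≢2 : z ≢ ι 2
        z≢2 refl = f[2]≢0 fz≡0
        u≡C : (z - ι 2) * c z ≡ C
        u≡C = [z-2]c≡C z≢2
      pointwise : ∀ x y z → 𝟙 (solution? x y z) ℤ.* (𝟙 (fixed? x y z) ℤ.* 𝟙 (fixed? y x z)) ≡
                            𝟙 (x ≟ c z) ℤ.* (𝟙 (y ≟ c z) ℤ.* 𝟙 (f z ≟ ι 0))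
      pointwise x y z = begin
        𝟙 (solution? x y z) ℤ.* (𝟙 (fixed? x y z) ℤ.* 𝟙 (fixed? y x z))
          ≡⟨ trans (𝟙-× (solution? x y z) (fixed? x y z ×-dec fixed? y x z)) (cong (𝟙 (solution? x y z) ℤ.*_) (𝟙-× (fixed? x y z) (fixed? y x z))) ⟨
        𝟙 (solution? x y z ×-dec (fixed? x y z ×-dec fixed? y x z))
          ≡⟨ 𝟙-cong (solution? x y z ×-dec (fixed? x y z ×-dec fixed? y x z)) ((x ≟ c z) ×-dec ((y ≟ c z) ×-dec (f z ≟ ι 0))) (to x y z) (from x y z) ⟩
        𝟙 ((x ≟ c z) ×-dec ((y ≟ c z) ×-dec (f z ≟ ι 0)))
          ≡⟨ trans (𝟙-× (x ≟ c z) ((y ≟ c z) ×-dec (f z ≟ ι 0))) (cong (𝟙 (x ≟ c z) ℤ.*_) (𝟙-× (y ≟ c z) (f z ≟ ι 0))) ⟩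
        𝟙 (x ≟ c z) ℤ.* (𝟙 (y ≟ c z) ℤ.* 𝟙 (f z ≟ ι 0)) ∎

    -- Eliminating x leaves 3 (J - 2) (J + 2)³ = 0.
    diagonal-not-singular : ∀ {x} → Solution x x x → ¬ Fixed x x x
    diagonal-not-singular {x} s e₁ = *-≢0 3≢0 (*-≢0 m≢0 (cube-≢0 n≢0)) (begin
      ι 3 * (m * cube n)
        ≡⟨ solve 1 (λ J → let ε = # 3 :* J :* J :- # 4 :* J :- # 8; k = # 2 :* (J :- # 1) in
             # 3 :* (:m J :* (:n J :* :n J :* :n J)) := :- (ε :* ε :- # 2 :* k :* ε :+ k :* k :* (# 4 :- # 3 :* (J :* J)))) refl J ⟩
      - (ε * ε - ι 2 * k * ε + k * k * (ι 4 - ι 3 * (J * J)))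
        ≡⟨ cong (λ u → - (u * u - ι 2 * k * u + k * k * (ι 4 - ι 3 * (J * J)))) kx≡ε ⟨
      - (k * x * (k * x) - ι 2 * k * (k * x) + k * k * (ι 4 - ι 3 * (J * J)))
        ≡⟨ solve 3 (λ k x J → :- (k :* x :* (k :* x) :- # 2 :* k :* (k :* x) :+ k :* k :* (# 4 :- # 3 :* (J :* J))) :=
             k :* k :* (:- (x :* x :- # 2 :* x :- (# 3 :* J :^ 2 :- # 4)))) refl k x J ⟩
      k * k * - P₁
        ≡⟨ cong (λ u → k * k * - u) P₁≡0 ⟩
      k * k * - ι 0
        ≡⟨ solve 1 (λ k → k :* k :* :- # 0 := # 0) refl k ⟩
      ι 0 ∎)
      where
      open ≡-Reasoning
      -- The fixing condition is P₁ = 0. Division of E x x x by P₁ has quotient 1 - x and the linear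
      -- remainder 3 (J + 1) (k x - ε), which defines `k` and `ε`.
      k ε P₁ : 𝔽
      k = ι 2 * (J - ι 1)
      ε = ι 3 * J * J - ι 4 * J - ι 8
      P₁ = x * x - ι 2 * x - C
      P₁≡0 : P₁ ≡ ι 0
      P₁≡0 = trans (solve 2 (λ x C → x :* x :- # 2 :* x :- C := (x :- # 2) :* x :- C) refl x C) (a≡b⇒a-b≡0 (diagonal-fixed e₁))
      kx≡ε : k * x ≡ ε
      kx≡ε = a-b≡0⇒a≡b (*-cancelˡ (*-≢0 3≢0 J+1≢0) (begin
        ι 3 * (J + ι 1) * (k * x - ε)
          ≡⟨ solve 2 (λ x J → # 3 :* (J :+ # 1) :* (# 2 :* (J :- # 1) :* x :- (# 3 :* J :* J :- # 4 :* J :- # 8)) :=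
               ((x :* x :+ x :* x :+ x :* x) :- (x :* x :* x :- :C J :* (x :+ x :+ x) :+ :D J)) :- (# 1 :- x) :* (x :* x :- # 2 :* x :- :C J)) refl x J ⟩
        E x x x - (ι 1 - x) * P₁
          ≡⟨ cong₂ (λ a b → a - (ι 1 - x) * b) (solution⇒E s) P₁≡0 ⟩
        ι 0 - (ι 1 - x) * ι 0
          ≡⟨ solve 2 (λ x c → # 0 :- (# 1 :- x) :* # 0 := c :* # 0) refl x (ι 3 * (J + ι 1)) ⟩
        ι 3 * (J + ι 1) * ι 0 ∎))

    -- Any two of the conditions identify two coordinates, so such a point would lie on the
    -- diagonal.
    no-singular-point : ∀ {x y z} → Solution x y z → Fixed x y z → Fixed y x z → ¬ Fixed z x y
    no-singular-point {x} {y} {z} s e₁ e₂ e₃ = on-diagonal (fixed₁₂⇒x≡y s e₁ e₂)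
      (fixed₁₂⇒x≡y (solution-swap₂₃ s) (trans (cong (λ u → u - C - x) (*-comm z y)) e₁) e₃) s e₁
      where
      on-diagonal : ∀ {x y z} → x ≡ y → x ≡ z → Solution x y z → ¬ Fixed x y z
      on-diagonal refl refl = diagonal-not-singular

    -- The two characters in terms of T

    -- From m T³ = m + 3 and n = m + 4 one gets m² (1 - 4T³) = -3 m n, and -3 is the square of 2ω +
    -- 1.
    σ-mn : σ (ι 1 - ι 4 * T ^ 3) ≡ σ (m * n)
    σ-mn = begin
      σ (ι 1 - ι 4 * T ^ 3)                        ≡⟨ σ-square-* _ m≢0 ⟨
      σ (m * m * (ι 1 - ι 4 * T ^ 3))              ≡⟨ cong σ (solve 2 (λ m T → m :* m :* (# 1 :- # 4 :* T :^ 3) := m :* (m :- # 4 :* (m :* (T :* T :* T)))) refl m T) ⟩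
      σ (m * (m - ι 4 * (m * cube T)))             ≡⟨ cong (λ k → σ (m * (m - ι 4 * k))) mT³≡m+3 ⟩
      σ (m * (m - ι 4 * (m + ι 3)))                ≡⟨ cong σ (solve 2 (λ J w → :m J :* (:m J :- # 4 :* (:m J :+ # 3)) :=
                                                        ((# 2 :* w :+ # 1) :* (# 2 :* w :+ # 1) :- # 4 :* (w :* w :+ w :+ # 1)) :* (:m J :* :n J)) refl J ω) ⟩
      σ ((r * r - ι 4 * (ω * ω + ω + ι 1)) * (m * n)) ≡⟨ cong (λ k → σ ((r * r - ι 4 * k) * (m * n))) ω²+ω+1≡0 ⟩
      σ ((r * r - ι 4 * ι 0) * (m * n))            ≡⟨ cong σ (solve 2 (λ r k → (r :* r :- # 4 :* # 0) :* k := r :* r :* k) refl r (m * n)) ⟩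
      σ (r * r * (m * n))                          ≡⟨ σ-square-* (m * n) r≢0 ⟩
      σ (m * n)                                    ∎
      where
      open ≡-Reasoning
      r : 𝔽
      r = ι 2 * ω + ι 1
      r≢0 : r ≢ ι 0
      r≢0 eq = 3≢0 (begin
        ι 3                                        ≡⟨ solve 1 (λ w → # 3 := # 4 :* (w :* w :+ w :+ # 1) :- (# 2 :* w :+ # 1) :* (# 2 :* w :+ # 1)) refl ω ⟩
        ι 4 * (ω * ω + ω + ι 1) - r * r            ≡⟨ cong₂ (λ a b → ι 4 * a - b * b) ω²+ω+1≡0 eq ⟩
        ι 4 * ι 0 - ι 0 * ι 0                      ≡⟨ solve 0 (# 4 :* # 0 :- # 0 :* # 0 := # 0) refl ⟩
        ι 0                                        ∎)

    -- The relation 3 = m (T³ - 1) turns 3 m T into m² (T⁴ - T).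
    σ-3mT : σ (ι 3 * m) ℤ.* σ T ≡ σ (T ^ 4 - T)
    σ-3mT = begin
      σ (ι 3 * m) ℤ.* σ T                          ≡⟨ σ-* (ι 3 * m) T ⟨
      σ (ι 3 * m * T)                              ≡⟨ cong (λ k → σ (k * m * T)) m[T³-1]≡3 ⟨
      σ (m * (cube T - ι 1) * m * T)               ≡⟨ cong σ (solve 2 (λ m T → m :* (T :* T :* T :- # 1) :* m :* T := m :* m :* (T :^ 4 :- T)) refl m T) ⟩
      σ (m * m * (T ^ 4 - T))                      ≡⟨ σ-square-* _ m≢0 ⟩
      σ (T ^ 4 - T)                                ∎
      where open ≡-Reasoning

    -- Counts weighted by the number of fixing flips

    private
      χ e₁ e₂ e₃ : 𝔽 → 𝔽 → 𝔽 → ℤ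
      χ x y z = 𝟙 (solution? x y z)
      e₁ x y z = 𝟙 (fixed? x y z)
      e₂ x y z = 𝟙 (fixed? y x z)
      e₃ x y z = 𝟙 (fixed? z x y)

      χ-swap₁₂ : ∀ x y z → χ x y z ≡ χ y x z
      χ-swap₁₂ x y z = 𝟙-cong (solution? x y z) (solution? y x z) solution-swap₁₂ solution-swap₁₂

      χ-swap₂₃ : ∀ x y z → χ x y z ≡ χ x z y
      χ-swap₂₃ x y z = 𝟙-cong (solution? x y z) (solution? x z y) solution-swap₂₃ solution-swap₂₃

      e₁-swap₂₃ : ∀ x y z → e₁ x y z ≡ e₁ x z y
      e₁-swap₂₃ x y z = cong (λ u → 𝟙 (u - C - x ≟ x)) (*-comm y z)

      χ-rotate : ∀ x y z → χ x y z ≡ χ z x y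
      χ-rotate x y z = trans (χ-swap₂₃ x y z) (χ-swap₁₂ x z y)

      sum-χe₂ : sum³ (λ x y z → χ x y z ℤ.* e₂ x y z) ≡ N₁
      sum-χe₂ = trans (sum³-cong (λ x y z → cong (ℤ._* e₂ x y z) (χ-swap₁₂ x y z)))
        (trans (sum³-swap₁₂ (λ x y z → χ x y z ℤ.* e₁ x y z)) count-fixed)

      sum-χe₃ : sum³ (λ x y z → χ x y z ℤ.* e₃ x y z) ≡ N₁
      sum-χe₃ = trans (sum³-cong (λ x y z → cong (ℤ._* e₃ x y z) (χ-rotate x y z)))
        (trans (sum³-rotate (λ x y z → χ x y z ℤ.* e₁ x y z)) count-fixed)

      sum-χe₁e₃ : sum³ (λ x y z → χ x y z ℤ.* (e₁ x y z ℤ.* e₃ x y z)) ≡ + 3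
      sum-χe₁e₃ = trans (sum³-cong (λ x y z → cong₂ (λ a b → a ℤ.* (b ℤ.* e₃ x y z)) (χ-swap₂₃ x y z) (e₁-swap₂₃ x y z)))
        (trans (sum³-swap₂₃ (λ x y z → χ x y z ℤ.* (e₁ x y z ℤ.* e₂ x y z))) count-fixed₁₂)

      sum-χe₂e₃ : sum³ (λ x y z → χ x y z ℤ.* (e₂ x y z ℤ.* e₃ x y z)) ≡ + 3
      sum-χe₂e₃ = trans (sum³-cong (λ x y z → cong₂ ℤ._*_ (χ-swap₁₂ x y z) (cong (e₂ x y z ℤ.*_) (e₁-swap₂₃ z x y))))
        (trans (sum³-swap₁₂ (λ x y z → χ x y z ℤ.* (e₁ x y z ℤ.* e₃ x y z))) sum-χe₁e₃)

    weight³ : ℤ → 𝔽 → 𝔽 → 𝔽 → ℤ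
    weight³ k x y z = weight k (fixed? x y z) (fixed? y x z) (fixed? z x y)

    -- Each of the three flips fixes `N₁` solutions, and each of the three pairs of flips has 3
    -- common fixed solutions.
    count-weighted-fixed : ∀ k → sum³ (λ x y z → 𝟙 (solution? x y z) ℤ.* weight³ k x y z) ≡ + 3 ℤ.* N₁ ℤ.+ k ℤ.* + 9
    count-weighted-fixed k = begin
      sum³ (λ x y z → χ x y z ℤ.* (e₁ x y z ℤ.+ e₂ x y z ℤ.+ e₃ x y z ℤ.+ k ℤ.* (e₁ x y z ℤ.* e₂ x y z ℤ.+ e₁ x y z ℤ.* e₃ x y z ℤ.+ e₂ x y z ℤ.* e₃ x y z)))
        ≡⟨ sum³-cong (λ x y z → ℤS.solve 5 (λ s a b c k → s ℤS.:* (a ℤS.:+ b ℤS.:+ c ℤS.:+ k ℤS.:* (a ℤS.:* b ℤS.:+ a ℤS.:* c ℤS.:+ b ℤS.:* c)) ℤS.:=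
             s ℤS.:* a ℤS.:+ (s ℤS.:* b ℤS.:+ s ℤS.:* c) ℤS.:+ k ℤS.:* (s ℤS.:* (a ℤS.:* b) ℤS.:+ (s ℤS.:* (a ℤS.:* c) ℤS.:+ s ℤS.:* (b ℤS.:* c))))
             refl (χ x y z) (e₁ x y z) (e₂ x y z) (e₃ x y z) k) ⟩
      sum³ (λ x y z → s₁ x y z ℤ.+ (s₂ x y z ℤ.+ s₃ x y z) ℤ.+ k ℤ.* (s₁₂ x y z ℤ.+ (s₁₃ x y z ℤ.+ s₂₃ x y z)))
        ≡⟨ sum³-+ (λ x y z → s₁ x y z ℤ.+ (s₂ x y z ℤ.+ s₃ x y z)) (λ x y z → k ℤ.* (s₁₂ x y z ℤ.+ (s₁₃ x y z ℤ.+ s₂₃ x y z))) ⟩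
      sum³ (λ x y z → s₁ x y z ℤ.+ (s₂ x y z ℤ.+ s₃ x y z)) ℤ.+ sum³ (λ x y z → k ℤ.* (s₁₂ x y z ℤ.+ (s₁₃ x y z ℤ.+ s₂₃ x y z)))
        ≡⟨ cong₂ ℤ._+_
             (trans (sum³-+ s₁ (λ x y z → s₂ x y z ℤ.+ s₃ x y z)) (cong₂ ℤ._+_ count-fixed (trans (sum³-+ s₂ s₃) (cong₂ ℤ._+_ sum-χe₂ sum-χe₃))))
             (trans (sum³-* k (λ x y z → s₁₂ x y z ℤ.+ (s₁₃ x y z ℤ.+ s₂₃ x y z))) (cong (k ℤ.*_)
               (trans (sum³-+ s₁₂ (λ x y z → s₁₃ x y z ℤ.+ s₂₃ x y z)) (cong₂ ℤ._+_ count-fixed₁₂ (trans (sum³-+ s₁₃ s₂₃) (cong₂ ℤ._+_ sum-χe₁e₃ sum-χe₂e₃)))))) ⟩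
      N₁ ℤ.+ (N₁ ℤ.+ N₁) ℤ.+ k ℤ.* + 9
        ≡⟨ ℤS.solve 2 (λ n k → n ℤS.:+ (n ℤS.:+ n) ℤS.:+ k ℤS.:* ℤS.con (+ 9) ℤS.:= ℤS.con (+ 3) ℤS.:* n ℤS.:+ k ℤS.:* ℤS.con (+ 9)) refl N₁ k ⟩
      + 3 ℤ.* N₁ ℤ.+ k ℤ.* + 9 ∎
      where
      open ≡-Reasoning
      module ℤS = ℤSolver.+-*-Solver
      s₁ s₂ s₃ s₁₂ s₁₃ s₂₃ : 𝔽 → 𝔽 → 𝔽 → ℤ
      s₁ x y z = χ x y z ℤ.* e₁ x y z
      s₂ x y z = χ x y z ℤ.* e₂ x y z
      s₃ x y z = χ x y z ℤ.* e₃ x y z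
      s₁₂ x y z = χ x y z ℤ.* (e₁ x y z ℤ.* e₂ x y z)
      s₁₃ x y z = χ x y z ℤ.* (e₁ x y z ℤ.* e₃ x y z)
      s₂₃ x y z = χ x y z ℤ.* (e₂ x y z ℤ.* e₃ x y z)

    -- The relation between k and l moves 9k inside the bracket: k = -1 goes with l = 6 and k = -2
    -- with l = 9.
    count-weighted-fixed-A₃ : ∀ {A} → S (ι 1) ≡ + 2 ℤ.* A → ∀ k l → + 3 ℤ.* (ℤ.- l ℤ.+ + 3) ≡ k ℤ.* + 9 →
      sum³ (λ x y z → 𝟙 (solution? x y z) ℤ.* weight³ k x y z) ≡ + 3 ℤ.* (+ p ℤ.- l ℤ.+ + 2 ℤ.* σ (T ^ 4 - T) ℤ.* A)
    count-weighted-fixed-A₃ {A} S≡2A k l eq = begin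
      sum³ (λ x y z → 𝟙 (solution? x y z) ℤ.* weight³ k x y z)
        ≡⟨ count-weighted-fixed k ⟩
      + 3 ℤ.* N₁ ℤ.+ k ℤ.* + 9
        ≡⟨ cong₂ (λ s c → + 3 ℤ.* (+ p ℤ.- + 3 ℤ.+ σ (ι 3 * m) ℤ.* (σ T ℤ.* s)) ℤ.+ c) S≡2A (sym eq) ⟩
      + 3 ℤ.* (+ p ℤ.- + 3 ℤ.+ σ (ι 3 * m) ℤ.* (σ T ℤ.* (+ 2 ℤ.* A))) ℤ.+ + 3 ℤ.* (ℤ.- l ℤ.+ + 3)
        ≡⟨ ℤS.solve 5 (λ p u v A l → ℤS.con (+ 3) ℤS.:* (p ℤS.:- ℤS.con (+ 3) ℤS.:+ u ℤS.:* (v ℤS.:* (ℤS.con (+ 2) ℤS.:* A))) ℤS.:+ ℤS.con (+ 3) ℤS.:* (ℤS.:- l ℤS.:+ ℤS.con (+ 3)) ℤS.:=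
             ℤS.con (+ 3) ℤS.:* (p ℤS.:- l ℤS.:+ ℤS.con (+ 2) ℤS.:* (u ℤS.:* v) ℤS.:* A)) refl (+ p) (σ (ι 3 * m)) (σ T) A l ⟩
      + 3 ℤ.* (+ p ℤ.- l ℤ.+ + 2 ℤ.* (σ (ι 3 * m) ℤ.* σ T) ℤ.* A)
        ≡⟨ cong (λ s → + 3 ℤ.* (+ p ℤ.- l ℤ.+ + 2 ℤ.* s ℤ.* A)) σ-3mT ⟩
      + 3 ℤ.* (+ p ℤ.- l ℤ.+ + 2 ℤ.* σ (T ^ 4 - T) ℤ.* A) ∎
      where
      open ≡-Reasoning
      module ℤS = ℤSolver.+-*-Solver

    -- The difference of the weights is the number of pairs of fixing flips, so `N₁` cancels.
    count-doubly-fixed : sum³ (λ x y z → 𝟙 (solution? x y z) ℤ.* (weight³ (ℤ.- + 1) x y z ℤ.- weight³ (ℤ.- + 2) x y z)) ≡ + 9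
    count-doubly-fixed = begin
      sum³ (λ x y z → 𝟙 (solution? x y z) ℤ.* (weight³ (ℤ.- + 1) x y z ℤ.- weight³ (ℤ.- + 2) x y z))
        ≡⟨ sum³-cong (λ x y z → ℤS.solve 3 (λ s a b → s ℤS.:* (a ℤS.:- b) ℤS.:= s ℤS.:* a ℤS.:+ ℤS.con (ℤ.- + 1) ℤS.:* (s ℤS.:* b))
             refl (𝟙 (solution? x y z)) (weight³ (ℤ.- + 1) x y z) (weight³ (ℤ.- + 2) x y z)) ⟩
      sum³ (λ x y z → w₁ x y z ℤ.+ ℤ.- + 1 ℤ.* w₂ x y z)
        ≡⟨ trans (sum³-+ w₁ (λ x y z → ℤ.- + 1 ℤ.* w₂ x y z)) (cong₂ ℤ._+_ (count-weighted-fixed (ℤ.- + 1))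
             (trans (sum³-* (ℤ.- + 1) w₂) (cong (ℤ.- + 1 ℤ.*_) (count-weighted-fixed (ℤ.- + 2))))) ⟩
      (+ 3 ℤ.* N₁ ℤ.+ ℤ.- + 1 ℤ.* + 9) ℤ.+ ℤ.- + 1 ℤ.* (+ 3 ℤ.* N₁ ℤ.+ ℤ.- + 2 ℤ.* + 9)
        ≡⟨ ℤS.solve 1 (λ n → (n ℤS.:+ ℤS.con (ℤ.- + 1) ℤS.:* ℤS.con (+ 9)) ℤS.:+ ℤS.con (ℤ.- + 1) ℤS.:*
             (n ℤS.:+ ℤS.con (ℤ.- + 2) ℤS.:* ℤS.con (+ 9)) ℤS.:= ℤS.con (+ 9)) refl (+ 3 ℤ.* N₁) ⟩
      + 9 ∎
      where
      open ≡-Reasoning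
      module ℤS = ℤSolver.+-*-Solver
      w₁ w₂ : 𝔽 → 𝔽 → 𝔽 → ℤ
      w₁ x y z = 𝟙 (solution? x y z) ℤ.* weight³ (ℤ.- + 1) x y z
      w₂ x y z = 𝟙 (solution? x y z) ℤ.* weight³ (ℤ.- + 2) x y z

-- The prime field

module ResidueRing (p : ℕ) .{{_ : NonZero p}} where
  open PrimeField p

  toℕ-ι : ∀ k → toℕ (ι k) ≡ k % p
  toℕ-ι k = toℕ-fromℕ< (m%n<n k p)

  ι-cong-% : ∀ {k l} → k % p ≡ l % p → ι k ≡ ι l
  ι-cong-% {k} {l} eq = toℕ-injective (trans (toℕ-ι k) (trans eq (sym (toℕ-ι l))))

  ι-toℕ : ∀ a → ι (toℕ a) ≡ a
  ι-toℕ a = toℕ-injective (trans (toℕ-ι (toℕ a)) (m<n⇒m%n≡m (toℕ<n a)))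

  ι-+ : ∀ k l → ι (k ℕ.+ l) ≡ ι k + ι l
  ι-+ k l = ι-cong-% (trans (%-distribˡ-+ k l p) (sym (cong₂ (λ a b → (a ℕ.+ b) % p) (toℕ-ι k) (toℕ-ι l))))

  ι-* : ∀ k l → ι (k ℕ.* l) ≡ ι k * ι l
  ι-* k l = ι-cong-% (trans (%-distribˡ-* k l p) (sym (cong₂ (λ a b → (a ℕ.* b) % p) (toℕ-ι k) (toℕ-ι l))))

  0%p≡0 : 0 % p ≡ 0
  0%p≡0 = m<n⇒m%n≡m (ℕ.>-nonZero⁻¹ p)

  ι-p≡0 : ι p ≡ ι 0
  ι-p≡0 = ι-cong-% (trans (n%n≡0 p) (sym 0%p≡0))

  ι≡0⇒p∣ : ∀ {k} → ι k ≡ ι 0 → p ℕ.∣ k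
  ι≡0⇒p∣ {k} eq = ℕ.m%n≡0⇒n∣m k p (trans (sym (toℕ-ι k)) (trans (cong toℕ eq) (trans (toℕ-ι 0) 0%p≡0)))

  private
    -- Absorbing an operand into `ι` in this way reduces the ring axioms to those of ℕ.
    ι-+ʳ : ∀ a k → a + ι k ≡ ι (toℕ a ℕ.+ k)
    ι-+ʳ a k = sym (trans (ι-+ (toℕ a) k) (cong (_+ ι k) (ι-toℕ a)))

    ι-+ˡ : ∀ k a → ι k + a ≡ ι (k ℕ.+ toℕ a)
    ι-+ˡ k a = sym (trans (ι-+ k (toℕ a)) (cong (λ b → ι k + b) (ι-toℕ a)))

    ι-*ʳ : ∀ a k → a * ι k ≡ ι (toℕ a ℕ.* k)
    ι-*ʳ a k = sym (trans (ι-* (toℕ a) k) (cong (_* ι k) (ι-toℕ a)))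

    ι-*ˡ : ∀ k a → ι k * a ≡ ι (k ℕ.* toℕ a)
    ι-*ˡ k a = sym (trans (ι-* k (toℕ a)) (cong (λ b → ι k * b) (ι-toℕ a)))

  +-assoc : ∀ a b c → (a + b) + c ≡ a + (b + c)
  +-assoc a b c = trans (ι-+ˡ _ c) (trans (cong ι (ℕₚ.+-assoc (toℕ a) (toℕ b) (toℕ c))) (sym (ι-+ʳ a _)))

  +-comm : ∀ a b → a + b ≡ b + a
  +-comm a b = cong ι (ℕₚ.+-comm (toℕ a) (toℕ b))

  +-identityˡ : ∀ a → ι 0 + a ≡ a
  +-identityˡ a = trans (ι-+ˡ 0 a) (ι-toℕ a)

  -‿inverseʳ : ∀ a → a + - a ≡ ι 0
  -‿inverseʳ a = trans (ι-+ʳ a (p ∸ toℕ a)) (trans (cong ι (ℕₚ.m+[n∸m]≡n (ℕₚ.<⇒≤ (toℕ<n a)))) ι-p≡0)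

  *-assoc : ∀ a b c → (a * b) * c ≡ a * (b * c)
  *-assoc a b c = trans (ι-*ˡ _ c) (trans (cong ι (ℕₚ.*-assoc (toℕ a) (toℕ b) (toℕ c))) (sym (ι-*ʳ a _)))

  *-comm : ∀ a b → a * b ≡ b * a
  *-comm a b = cong ι (ℕₚ.*-comm (toℕ a) (toℕ b))

  *-identityˡ : ∀ a → ι 1 * a ≡ a
  *-identityˡ a = trans (ι-*ˡ 1 a) (trans (cong ι (ℕₚ.*-identityˡ (toℕ a))) (ι-toℕ a))

  *-distribʳ-+ : ∀ a b c → (b + c) * a ≡ b * a + c * a
  *-distribʳ-+ a b c = trans (ι-*ˡ _ a) (trans (cong ι (ℕₚ.*-distribʳ-+ (toℕ a) (toℕ b) (toℕ c))) (ι-+ _ _))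

  isCommutativeRing : IsCommutativeRing _≡_ _+_ _*_ (λ b → - b) (ι 0) (ι 1)
  isCommutativeRing = record
    { isRing = record
      { +-isAbelianGroup = record
        { isGroup = record
          { isMonoid = record
            { isSemigroup = record
              { isMagma = record { isEquivalence = isEquivalence ; ∙-cong = cong₂ _+_ }
              ; assoc = +-assoc }
            ; identity = comm∧idˡ⇒id +-comm +-identityˡ }
          ; inverse = comm∧invʳ⇒inv +-comm -‿inverseʳ
          ; ⁻¹-cong = cong (λ b → - b) }
        ; comm = +-comm }
      ; *-cong = cong₂ _*_
      ; *-assoc = *-assoc
      ; *-identity = comm∧idˡ⇒id *-comm *-identityˡ
      ; distrib = (λ a b c → trans (*-comm a (b + c)) (trans (*-distribʳ-+ a b c) (cong₂ _+_ (*-comm b a) (*-comm c a)))) , *-distribʳ-+ }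
    ; *-comm = *-comm }

  ring : Ring 0ℓ 0ℓ
  ring = record { isRing = IsCommutativeRing.isRing isCommutativeRing }

-- Inverses and the quadratic character modulo p

module _ (p : ℕ) .{{_ : NonZero p}} (p-prime : Prime p) where
  open PrimeField p
  private
    module R = ResidueRing p

    p∤1 : ¬ p ℕ.∣ 1
    p∤1 d = ℕₚ.<⇒≱ (ℕ.nonTrivial⇒n>1 p {{prime⇒nonTrivial p-prime}}) (ℕ.∣⇒≤ d)

    1≢0 : ι 1 ≢ ι 0
    1≢0 = p∤1 ∘ R.ι≡0⇒p∣

    inverse : ∀ {a} → a ≢ ι 0 → ∃[ x ] a * x ≡ ι 1
    inverse {a} a≢0 = from-Bézout (coprime-Bézout (prime⇒coprime p-prime {{ℕ.≢-nonZero toℕ≢0}} (toℕ<n a)))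
      where
      toℕ≢0 : toℕ a ≢ 0
      toℕ≢0 eq = a≢0 (trans (sym (R.ι-toℕ a)) (cong ι eq))
      ι[ka]≡a*ι : ∀ k → ι (k ℕ.* toℕ a) ≡ a * ι k
      ι[ka]≡a*ι k = trans (R.ι-* k (toℕ a)) (trans (cong (λ b → ι k * b) (R.ι-toℕ a)) (R.*-comm (ι k) a))
      ι[kp]≡0 : ∀ k → ι (k ℕ.* p) ≡ ι 0
      ι[kp]≡0 k = trans (R.ι-* k p) (trans (cong (λ b → ι k * b) R.ι-p≡0) (trans (sym (R.ι-* k 0)) (cong ι (ℕₚ.*-zeroʳ k))))
      from-Bézout : Bézout.Identity 1 p (toℕ a) → ∃[ x ] a * x ≡ ι 1
      from-Bézout (Bézout.-+ x y eq) = ι y , (begin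
        a * ι y                   ≡⟨ ι[ka]≡a*ι y ⟨
        ι (y ℕ.* toℕ a)           ≡⟨ cong ι eq ⟨
        ι (1 ℕ.+ x ℕ.* p)         ≡⟨ R.ι-+ 1 (x ℕ.* p) ⟩
        ι 1 + ι (x ℕ.* p)         ≡⟨ cong (λ b → ι 1 + b) (ι[kp]≡0 x) ⟩
        ι 1 + ι 0                 ≡⟨ trans (R.+-comm (ι 1) (ι 0)) (R.+-identityˡ (ι 1)) ⟩
        ι 1                       ∎)
        where open ≡-Reasoning
      from-Bézout (Bézout.+- x y eq) = - ι y , (begin
        a * - ι y                             ≡⟨ -‿distribʳ-* a (ι y) ⟨
        - (a * ι y)                           ≡⟨ R.+-identityˡ _ ⟨
        ι 0 - a * ι y                         ≡⟨ cong (_- a * ι y) (ι[kp]≡0 x) ⟨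
        ι (x ℕ.* p) - a * ι y                 ≡⟨ cong (λ k → ι k - a * ι y) eq ⟨
        ι (1 ℕ.+ y ℕ.* toℕ a) - a * ι y       ≡⟨ cong (_- a * ι y) (trans (R.ι-+ 1 (y ℕ.* toℕ a)) (cong (λ b → ι 1 + b) (ι[ka]≡a*ι y))) ⟩
        (ι 1 + a * ι y) - a * ι y             ≡⟨ R.+-assoc (ι 1) (a * ι y) _ ⟩
        ι 1 + (a * ι y - a * ι y)             ≡⟨ cong (λ b → ι 1 + b) (R.-‿inverseʳ (a * ι y)) ⟩
        ι 1 + ι 0                             ≡⟨ trans (R.+-comm (ι 1) (ι 0)) (R.+-identityˡ (ι 1)) ⟩
        ι 1                                   ∎)
        where
        open ≡-Reasoning
        open RingProperties R.ring using (-‿distribʳ-*)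

    *-invʳ : ∀ {a} → a ≢ ι 0 → a * inv a ≡ ι 1
    *-invʳ {a} a≢0 with any? (λ x → a * x ≟ ι 1)
    ... | yes (_ , eq) = eq
    ... | no ∄         = contradiction (inverse a≢0) ∄

    inv-0 : inv (ι 0) ≡ ι 0
    inv-0 with any? (λ x → ι 0 * x ≟ ι 1)
    ... | yes (x , eq) = contradiction (trans (sym eq) (IsCommutativeRing.zeroˡ R.isCommutativeRing x)) 1≢0
    ... | no _         = refl

  primeField : FiniteField p
  primeField = record
    { _+_ = _+_ ; _*_ = _*_ ; -_ = λ b → - b ; inv = inv ; ι = ι
    ; isCommutativeRing = R.isCommutativeRing ; ι-+ = R.ι-+ ; ι-* = R.ι-*
    ; 1≢0 = 1≢0 ; *-invʳ = *-invʳ ; inv-0 = inv-0 }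

  isQuadraticCharacter : IsQuadraticCharacter primeField σ
  isQuadraticCharacter = record { σ-0 = σ-0 ; σ-square = σ-square ; σ-nonsquare = σ-nonsquare }
    where
    open FieldProperties primeField using (*-≢0; zeroˡ)
    σ-0 : σ (ι 0) ≡ + 0
    σ-0 with ι 0 ≟ ι 0
    ... | yes _ = refl
    ... | no ¬e = contradiction refl ¬e
    σ-square : ∀ {x} → x ≢ ι 0 → σ (x * x) ≡ + 1
    σ-square {x} x≢0 with x * x ≟ ι 0 | any? (λ y → y * y ≟ x * x)
    ... | yes e | _     = contradiction e (*-≢0 x≢0 x≢0)
    ... | no _  | yes _ = refl
    ... | no _  | no ∄  = contradiction (x , refl) ∄
    σ-nonsquare : ∀ {a} → (∀ x → x * x ≢ a) → σ a ≡ -[1+ 0 ]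
    σ-nonsquare {a} ∄ with a ≟ ι 0 | any? (λ y → y * y ≟ a)
    ... | yes refl | _             = contradiction (zeroˡ (ι 0)) (∄ (ι 0))
    ... | no _     | yes (x , eq)  = contradiction eq (∄ x)
    ... | no _     | no _          = refl

  small≢0 : ∀ {k} .{{_ : NonZero k}} → k ℕ.< p → ι k ≢ ι 0
  small≢0 k<p eq = ℕₚ.<⇒≱ k<p (ℕ.∣⇒≤ (R.ι≡0⇒p∣ eq))

  open FieldProperties primeField using (φ; φ-+; φ-*; *-≡0; *-≢0; *-cancelˡ; -‿involutive; -0#≈0#; solve; #; _:=_; _:+_; _:*_; _:-_; :-_; zeroʳ)

  φ≡0⇒p∣ : ∀ {i} → φ i ≡ ι 0 → + p ∣ i
  φ≡0⇒p∣ {+ n}      eq = ∣ᵤ⇒∣ (R.ι≡0⇒p∣ eq)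
  φ≡0⇒p∣ { -[1+ n ]} eq = ∣ᵤ⇒∣ (R.ι≡0⇒p∣ (trans (sym (-‿involutive (ι (suc n)))) (trans (cong (λ b → - b) eq) -0#≈0#)))

  -- p = A² + 3B² makes A/B a square root of -3.
  cube-root-of-unity : ∀ {A} → IsA₃ p A → ι 2 ≢ ι 0 → ∃[ ω ] ω * ω + ω + ι 1 ≡ ι 0
  cube-root-of-unity {A} ((B , p≡) , _) 2≢0 = ω , *-cancelˡ (*-≢0 2≢0 2≢0) (begin
    ι 2 * ι 2 * (ω * ω + ω + ι 1)
      ≡⟨ solve 2 (λ h s → let ω = h :* (s :- # 1); e = # 2 :* h in
           # 2 :* # 2 :* (ω :* ω :+ ω :+ # 1) := e :* e :* ((s :- # 1) :* (s :- # 1)) :+ e :* # 2 :* (s :- # 1) :+ # 4) refl (inv (ι 2)) s ⟩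
    g (ι 2 * inv (ι 2))
      ≡⟨ cong g (*-invʳ 2≢0) ⟩
    g (ι 1)
      ≡⟨ solve 1 (λ s → # 1 :* # 1 :* ((s :- # 1) :* (s :- # 1)) :+ # 1 :* # 2 :* (s :- # 1) :+ # 4 := s :* s :+ # 3) refl s ⟩
    s * s + ι 3
      ≡⟨ s²+3≡0 ⟩
    ι 0
      ≡⟨ zeroʳ (ι 2 * ι 2) ⟨
    ι 2 * ι 2 * ι 0 ∎)
    where
    open ≡-Reasoning
    norm≡0 : φ A * φ A + ι 3 * (φ B * φ B) ≡ ι 0
    norm≡0 = begin
      φ A * φ A + ι 3 * (φ B * φ B)             ≡⟨ cong₂ _+_ (φ-* A A) (trans (φ-* (+ 3) (B ℤ.* B)) (cong (λ b → ι 3 * b) (φ-* B B))) ⟨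
      φ (A ℤ.* A) + φ (+ 3 ℤ.* (B ℤ.* B))       ≡⟨ φ-+ (A ℤ.* A) (+ 3 ℤ.* (B ℤ.* B)) ⟨
      φ (A ℤ.* A ℤ.+ + 3 ℤ.* (B ℤ.* B))         ≡⟨ cong φ p≡ ⟨
      ι p                                       ≡⟨ R.ι-p≡0 ⟩
      ι 0                                       ∎
    -- Otherwise p² divides A² + 3B² = p.
    p∣A∧p∣B⇒⊥ : + p ∣ A → + p ∣ B → p ℕ.∣ 1
    p∣A∧p∣B⇒⊥ (divides a A≡) (divides b B≡) = ∣⇒∣ᵤ (divides {+ p} {+ 1} ((a ℤ.* a ℤ.+ + 3 ℤ.* (b ℤ.* b)) ℤ.* + 1)
      (ℤₚ.*-cancelʳ-≡ (+ 1) _ (+ p) (begin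
        + 1 ℤ.* + p                                                          ≡⟨ ℤₚ.*-identityˡ (+ p) ⟩
        + p                                                                  ≡⟨ p≡ ⟩
        A ℤ.* A ℤ.+ + 3 ℤ.* (B ℤ.* B)                                        ≡⟨ cong₂ (λ A B → A ℤ.* A ℤ.+ + 3 ℤ.* (B ℤ.* B)) A≡ B≡ ⟩
        a ℤ.* + p ℤ.* (a ℤ.* + p) ℤ.+ + 3 ℤ.* (b ℤ.* + p ℤ.* (b ℤ.* + p))    ≡⟨ ℤS.solve 3 (λ a b p → a ℤS.:* p ℤS.:* (a ℤS.:* p) ℤS.:+ ℤS.con (+ 3) ℤS.:* (b ℤS.:* p ℤS.:* (b ℤS.:* p)) ℤS.:=
                                                                                  (a ℤS.:* a ℤS.:+ ℤS.con (+ 3) ℤS.:* (b ℤS.:* b)) ℤS.:* ℤS.con (+ 1) ℤS.:* p ℤS.:* p) refl a b (+ p) ⟩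
        (a ℤ.* a ℤ.+ + 3 ℤ.* (b ℤ.* b)) ℤ.* + 1 ℤ.* + p ℤ.* + p              ∎)))
      where module ℤS = ℤSolver.+-*-Solver
    φB≢0 : φ B ≢ ι 0
    φB≢0 φB≡0 = p∤1 (p∣A∧p∣B⇒⊥ (φ≡0⇒p∣ {A} ([ id , id ]′ (*-≡0 φA²≡0))) (φ≡0⇒p∣ {B} φB≡0))
      where
      φA²≡0 : φ A * φ A ≡ ι 0
      φA²≡0 = trans (solve 1 (λ a → a :* a := a :* a :+ # 3 :* (# 0 :* # 0)) refl (φ A))
        (trans (cong (λ b → φ A * φ A + ι 3 * (b * b)) (sym φB≡0)) norm≡0)
    s ω : 𝔽
    s = φ A * inv (φ B)
    ω = inv (ι 2) * (s - ι 1)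
    g : 𝔽 → 𝔽
    g e = e * e * ((s - ι 1) * (s - ι 1)) + e * ι 2 * (s - ι 1) + ι 4
    s²+3≡0 : s * s + ι 3 ≡ ι 0
    s²+3≡0 = *-cancelˡ (*-≢0 φB≢0 φB≢0) (begin
      φ B * φ B * (s * s + ι 3)
        ≡⟨ solve 3 (λ a b i → b :* b :* (a :* i :* (a :* i) :+ # 3) := a :* a :* ((b :* i) :* (b :* i)) :+ # 3 :* (b :* b)) refl (φ A) (φ B) (inv (φ B)) ⟩
      φ A * φ A * ((φ B * inv (φ B)) * (φ B * inv (φ B))) + ι 3 * (φ B * φ B)
        ≡⟨ cong (λ e → φ A * φ A * (e * e) + ι 3 * (φ B * φ B)) (*-invʳ φB≢0) ⟩
      φ A * φ A * (ι 1 * ι 1) + ι 3 * (φ B * φ B)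
        ≡⟨ solve 2 (λ a b → a :* (# 1 :* # 1) :+ b := a :+ b) refl (φ A * φ A) (ι 3 * (φ B * φ B)) ⟩
      φ A * φ A + ι 3 * (φ B * φ B)
        ≡⟨ trans norm≡0 (sym (zeroʳ (φ B * φ B))) ⟩
      φ B * φ B * ι 0 ∎)

-- Degrees in the Vieta graph

module _ {A : Set} where

  Unique∧⊆⇒length≤ : ∀ {xs ys : List A} → Unique xs → xs ⊆ ys → length xs ℕ.≤ length ys
  Unique∧⊆⇒length≤ {[]} _ _ = ℕ.z≤n
  Unique∧⊆⇒length≤ {x ∷ xs} (x∉xs ∷ unique) x∷xs⊆ys with ∈-∃++ (x∷xs⊆ys (here refl))
  ... | us , vs , refl = ℕₚ.≤-trans (ℕ.s≤s (Unique∧⊆⇒length≤ unique xs⊆)) (ℕₚ.≤-reflexive (begin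
    suc (length (us ++ vs))              ≡⟨ cong suc (length-++ us) ⟩
    suc (length us ℕ.+ length vs)        ≡⟨ ℕₚ.+-suc (length us) (length vs) ⟨
    length us ℕ.+ length (x ∷ vs)        ≡⟨ length-++ us ⟨
    length (us ++ x ∷ vs)                ∎))
    where
    open ≡-Reasoning
    drop-x : ∀ us {vs w} → w ∈ us ++ x ∷ vs → x ≢ w → w ∈ us ++ vs
    drop-x []       (here w≡x)  x≢w = contradiction (sym w≡x) x≢w
    drop-x []       (there w∈)  _   = w∈
    drop-x (u ∷ us) (here w≡u)  _   = here w≡u
    drop-x (u ∷ us) (there w∈)  x≢w = there (drop-x us w∈ x≢w)
    xs⊆ : xs ⊆ us ++ vs
    xs⊆ w∈ = drop-x us (x∷xs⊆ys (there w∈)) (All.lookup x∉xs w∈)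

  listSum : (A → ℤ) → List A → ℤ
  listSum f []       = + 0
  listSum f (x ∷ xs) = f x ℤ.+ listSum f xs

  listSum-++ : ∀ f xs ys → listSum f (xs ++ ys) ≡ listSum f xs ℤ.+ listSum f ys
  listSum-++ f []       ys = sym (ℤₚ.+-identityˡ _)
  listSum-++ f (x ∷ xs) ys = trans (cong (λ s → f x ℤ.+ s) (listSum-++ f xs ys)) (sym (ℤₚ.+-assoc (f x) _ _))

  module _ {P : A → Set} (P? : U.Decidable P) where

    length-filter : ∀ xs → + length (filter P? xs) ≡ listSum (𝟙 ∘ P?) xs
    length-filter [] = refl
    length-filter (x ∷ xs) with P? x
    ... | yes _ = trans (ℤₚ.pos-+ 1 _) (cong (λ s → + 1 ℤ.+ s) (length-filter xs))
    ... | no _  = trans (length-filter xs) (sym (ℤₚ.+-identityˡ _))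

    listSum-filter : ∀ f xs → listSum f (filter P? xs) ≡ listSum (λ x → 𝟙 (P? x) ℤ.* f x) xs
    listSum-filter f [] = refl
    listSum-filter f (x ∷ xs) with P? x
    ... | yes _ = cong₂ ℤ._+_ (sym (ℤₚ.*-identityˡ (f x))) (listSum-filter f xs)
    ... | no _  = trans (listSum-filter f xs) (sym (ℤₚ.+-identityˡ _))

listSum-map : ∀ {A B : Set} (f : B → ℤ) (g : A → B) xs → listSum f (map g xs) ≡ listSum (f ∘ g) xs
listSum-map f g []       = refl
listSum-map f g (x ∷ xs) = cong (λ s → f (g x) ℤ.+ s) (listSum-map f g xs)

listSum-cartesianProduct : ∀ {A B : Set} (f : A × B → ℤ) xs ys →
  listSum f (cartesianProduct xs ys) ≡ listSum (λ x → listSum (λ y → f (x , y)) ys) xs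
listSum-cartesianProduct f []       ys = refl
listSum-cartesianProduct f (x ∷ xs) ys = trans (listSum-++ f (map (x ,_) ys) (cartesianProduct xs ys))
  (cong₂ ℤ._+_ (listSum-map f (x ,_) ys) (listSum-cartesianProduct f xs ys))

listSum-tabulate : ∀ {A : Set} {n} (f : A → ℤ) (g : Fin n → A) → listSum f (tabulate g) ≡ sum (f ∘ g)
listSum-tabulate {n = zero}  f g = refl
listSum-tabulate {n = suc n} f g = cong (λ s → f (g zero) ℤ.+ s) (listSum-tabulate f (g ∘ suc))

listSum-allFin³ : ∀ n (f : Fin n × Fin n × Fin n → ℤ) →
  listSum f (cartesianProduct (allFin n) (cartesianProduct (allFin n) (allFin n))) ≡
  sum (λ x → sum (λ y → sum (λ z → f (x , y , z))))
listSum-allFin³ n f = begin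
  listSum f (cartesianProduct (allFin n) (cartesianProduct (allFin n) (allFin n)))
    ≡⟨ listSum-cartesianProduct f (allFin n) (cartesianProduct (allFin n) (allFin n)) ⟩
  listSum (λ x → listSum (λ yz → f (x , yz)) (cartesianProduct (allFin n) (allFin n))) (allFin n)
    ≡⟨ listSum-tabulate {n = n} (λ x → listSum (λ yz → f (x , yz)) (cartesianProduct (allFin n) (allFin n))) id ⟩
  sum (λ x → listSum (λ yz → f (x , yz)) (cartesianProduct (allFin n) (allFin n)))
    ≡⟨ sum-cong-≗ {n} (λ x → trans (listSum-cartesianProduct (λ yz → f (x , yz)) (allFin n) (allFin n))
         (listSum-tabulate {n = n} (λ y → listSum (λ z → f (x , y , z)) (allFin n)) id)) ⟩
  sum (λ x → sum (λ y → listSum (λ z → f (x , y , z)) (allFin n)))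
    ≡⟨ sum-cong-≗ {n} (λ x → sum-cong-≗ {n} (λ y → listSum-tabulate {n = n} (λ z → f (x , y , z)) id)) ⟩
  sum (λ x → sum (λ y → sum (λ z → f (x , y , z)))) ∎
  where open ≡-Reasoning

module _ {A : Set} {P : Set} where

  unless : Dec P → A → List A
  unless (yes _) _ = []
  unless (no _)  a = a ∷ []

  ∈-unless⁺ : ∀ (d : Dec P) {a} → ¬ P → a ∈ unless d a
  ∈-unless⁺ (yes p) ¬p = contradiction p ¬p
  ∈-unless⁺ (no _)  _  = here refl

  ∈-unless⁻ : ∀ (d : Dec P) {a w} → w ∈ unless d a → w ≡ a × ¬ P
  ∈-unless⁻ (no ¬p) (here w≡a) = w≡a , ¬p

-- The number of flips that move a point, built in the same shape as the list of its neighbours.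
#moved : ∀ {P₁ P₂ P₃ : Set} → Dec P₁ → Dec P₂ → Dec P₃ → ℕ
#moved d₁ d₂ d₃ = length (unless d₁ 0 ++ unless d₂ 0 ++ unless d₃ 0)

module _ {P₁ P₂ P₃ : Set} where

  -- If j of the flips are trivial, `#moved` is 3 - j. For j ≤ 2 the numbers j - (j choose 2), j - 2
  -- (j choose 2) and (j choose 2) are the indicators of j ≥ 1, j = 1 and j = 2.
  𝟙-#moved : (d₁ : Dec P₁) (d₂ : Dec P₂) (d₃ : Dec P₃) → ¬ (P₁ × P₂ × P₃) →
    𝟙 (#moved d₁ d₂ d₃ ℕₚ.<? 3) ≡ weight (ℤ.- + 1) d₁ d₂ d₃ ×
    𝟙 (#moved d₁ d₂ d₃ ℕₚ.≟ 2) ≡ weight (ℤ.- + 2) d₁ d₂ d₃ ×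
    𝟙 (#moved d₁ d₂ d₃ ℕₚ.≟ 1) ≡ weight (ℤ.- + 1) d₁ d₂ d₃ ℤ.- weight (ℤ.- + 2) d₁ d₂ d₃ ×
    𝟙 (#moved d₁ d₂ d₃ ℕₚ.≟ 0) ≡ + 0
  𝟙-#moved (yes p₁) (yes p₂) (yes p₃) ¬all = contradiction (p₁ , p₂ , p₃) ¬all
  𝟙-#moved (yes _)  (yes _)  (no _)   _    = refl , refl , refl , refl
  𝟙-#moved (yes _)  (no _)   (yes _)  _    = refl , refl , refl , refl
  𝟙-#moved (yes _)  (no _)   (no _)   _    = refl , refl , refl , refl
  𝟙-#moved (no _)   (yes _)  (yes _)  _    = refl , refl , refl , refl
  𝟙-#moved (no _)   (yes _)  (no _)   _    = refl , refl , refl , refl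
  𝟙-#moved (no _)   (no _)   (yes _)  _    = refl , refl , refl , refl
  𝟙-#moved (no _)   (no _)   (no _)   _    = refl , refl , refl , refl

-- Neighbours and degrees

module _ (p : ℕ) .{{_ : NonZero p}} where
  open PrimeField p

  module VietaDegree (C D : Fin p) where
    open VietaGraph C D

    module Counting
        (flip-involutive : ∀ u x → u - (u - x) ≡ x)
        (flip-solution : ∀ {v w} → w ∈ flips v → IsSolution v → IsSolution w)
        (no-singular-point : ∀ {x y z} → IsSolution (x , y , z) →
          y * z - C - x ≡ x → x * z - C - y ≡ y → ¬ x * y - C - z ≡ z) where

      -- Makes the two alternatives in `Adjacent` equivalent.
      flips-sym : ∀ {v w} → w ∈ flips v → v ∈ flips w
      flips-sym {x , y , z} (here refl)                 = here (cong (λ x → x , y , z) (sym (flip-involutive (y * z - C) x)))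
      flips-sym {x , y , z} (there (here refl))         = there (here (cong (λ y → x , y , z) (sym (flip-involutive (x * z - C) y))))
      flips-sym {x , y , z} (there (there (here refl))) = there (there (here (cong (λ z → x , y , z) (sym (flip-involutive (x * y - C) z)))))

      module _ {x y z : Fin p} (v-solution : IsSolution (x , y , z)) where

        private
          v a b c : Point
          v = x , y , z
          a = y * z - C - x , y , z
          b = x , x * z - C - y , z
          c = x , y , x * y - C - z

          d₁ : Dec (y * z - C - x ≡ x)
          d₁ = y * z - C - x ≟ x
          d₂ : Dec (x * z - C - y ≡ y)
          d₂ = x * z - C - y ≟ y
          d₃ : Dec (x * y - C - z ≡ z)
          d₃ = x * y - C - z ≟ z

          neighbours : List Point
          neighbours = unless d₁ a ++ unless d₂ b ++ unless d₃ c

          -- Distinct flips change distinct coordinates, so they can agree only where both are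
          -- trivial.
          a≡b⇒fixed : a ≡ b → y * z - C - x ≡ x
          a≡b⇒fixed = cong proj₁

          a≡c⇒fixed : a ≡ c → y * z - C - x ≡ x
          a≡c⇒fixed = cong proj₁

          b≡c⇒fixed : b ≡ c → x * z - C - y ≡ y
          b≡c⇒fixed = cong (proj₁ ∘ proj₂)

          neighbours-unique : Unique neighbours
          neighbours-unique with d₁ | d₂ | d₃
          ... | yes _ | yes _ | yes _ = []
          ... | yes _ | yes _ | no _  = [] ∷ []
          ... | yes _ | no _  | yes _ = [] ∷ []
          ... | yes _ | no n₂ | no _  = ((n₂ ∘ b≡c⇒fixed) ∷ []) ∷ [] ∷ []
          ... | no _  | yes _ | yes _ = [] ∷ []
          ... | no n₁ | yes _ | no _  = ((n₁ ∘ a≡c⇒fixed) ∷ []) ∷ [] ∷ []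
          ... | no n₁ | no _  | yes _ = ((n₁ ∘ a≡b⇒fixed) ∷ []) ∷ [] ∷ []
          ... | no n₁ | no n₂ | no _  = ((n₁ ∘ a≡b⇒fixed) ∷ (n₁ ∘ a≡c⇒fixed) ∷ []) ∷ ((n₂ ∘ b≡c⇒fixed) ∷ []) ∷ [] ∷ []

          length-neighbours : length neighbours ≡ #moved d₁ d₂ d₃
          length-neighbours with d₁ | d₂ | d₃
          ... | yes _ | yes _ | yes _ = refl
          ... | yes _ | yes _ | no _  = refl
          ... | yes _ | no _  | yes _ = refl
          ... | yes _ | no _  | no _  = refl
          ... | no _  | yes _ | yes _ = refl
          ... | no _  | yes _ | no _  = refl
          ... | no _  | no _  | yes _ = refl
          ... | no _  | no _  | no _  = refl

          ∈-neighbours⁺ : ∀ {w} → w ∈ flips v → v ≢ w → w ∈ neighbours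
          ∈-neighbours⁺ (here refl)                 v≢w = ∈-++⁺ˡ (∈-unless⁺ d₁ (λ e → v≢w (sym (cong (λ x → x , y , z) e))))
          ∈-neighbours⁺ (there (here refl))         v≢w = ∈-++⁺ʳ (unless d₁ a) (∈-++⁺ˡ (∈-unless⁺ d₂ (λ e → v≢w (sym (cong (λ y → x , y , z) e)))))
          ∈-neighbours⁺ (there (there (here refl))) v≢w = ∈-++⁺ʳ (unless d₁ a) (∈-++⁺ʳ (unless d₂ b) (∈-unless⁺ d₃ (λ e → v≢w (sym (cong (λ z → x , y , z) e)))))

          ∈-neighbours⁻ : ∀ {w} → w ∈ neighbours → w ∈ flips v × v ≢ w
          ∈-neighbours⁻ w∈ = [ moved₁ , [ moved₂ , moved₃ ]′ ∘ ∈-++⁻ (unless d₂ b) ]′ (∈-++⁻ (unless d₁ a) w∈)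
            where
            moved₁ : ∀ {w} → w ∈ unless d₁ a → w ∈ flips v × v ≢ w
            moved₁ w∈ = let w≡a , n₁ = ∈-unless⁻ d₁ w∈ in
              here w≡a , λ v≡w → n₁ (sym (cong proj₁ (trans v≡w w≡a)))
            moved₂ : ∀ {w} → w ∈ unless d₂ b → w ∈ flips v × v ≢ w
            moved₂ w∈ = let w≡b , n₂ = ∈-unless⁻ d₂ w∈ in
              there (here w≡b) , λ v≡w → n₂ (sym (cong (proj₁ ∘ proj₂) (trans v≡w w≡b)))
            moved₃ : ∀ {w} → w ∈ unless d₃ c → w ∈ flips v × v ≢ w
            moved₃ w∈ = let w≡c , n₃ = ∈-unless⁻ d₃ w∈ in
              there (there (here w≡c)) , λ v≡w → n₃ (sym (cong (proj₂ ∘ proj₂) (trans v≡w w≡c)))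

          adjacent-vertices-unique : Unique (filter (adjacent? v) vertices)
          adjacent-vertices-unique = Unique.filter⁺ (adjacent? v) (Unique.filter⁺ isSolution?
            (Unique.cartesianProduct⁺ (Unique.allFin⁺ p) (Unique.cartesianProduct⁺ (Unique.allFin⁺ p) (Unique.allFin⁺ p))))

          adjacent⊆neighbours : filter (adjacent? v) vertices ⊆ neighbours
          adjacent⊆neighbours w∈ with ∈-filter⁻ (adjacent? v) {xs = vertices} w∈
          ... | _ , v≢w , inj₁ w∈flips = ∈-neighbours⁺ w∈flips v≢w
          ... | _ , v≢w , inj₂ v∈flips = ∈-neighbours⁺ (flips-sym v∈flips) v≢w

          neighbours⊆adjacent : neighbours ⊆ filter (adjacent? v) vertices
          neighbours⊆adjacent w∈ = let w∈flips , v≢w = ∈-neighbours⁻ w∈ in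
            ∈-filter⁺ (adjacent? v) (∈-filter⁺ isSolution?
              (∈-cartesianProduct⁺ (∈-allFin _) (∈-cartesianProduct⁺ (∈-allFin _) (∈-allFin _)))
              (flip-solution w∈flips v-solution)) (v≢w , inj₁ w∈flips)

        -- Two duplicate-free lists with the same members have the same length.
        degree≡#moved : degree (x , y , z) ≡ #moved (y * z - C - x ≟ x) (x * z - C - y ≟ y) (x * y - C - z ≟ z)
        degree≡#moved = trans (ℕₚ.≤-antisym
          (Unique∧⊆⇒length≤ adjacent-vertices-unique adjacent⊆neighbours)
          (Unique∧⊆⇒length≤ neighbours-unique neighbours⊆adjacent)) length-neighbours

      private
        points : List Point
        points = cartesianProduct (allFin p) (cartesianProduct (allFin p) (allFin p))

        χ : Fin p → Fin p → Fin p → ℤ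
        χ x y z = 𝟙 (isSolution? (x , y , z))

        moved : Fin p → Fin p → Fin p → ℕ
        moved x y z = #moved (y * z - C - x ≟ x) (x * z - C - y ≟ y) (x * y - C - z ≟ z)

      vertex-weight : ℤ → Fin p → Fin p → Fin p → ℤ
      vertex-weight k x y z = weight k (y * z - C - x ≟ x) (x * z - C - y ≟ y) (x * y - C - z ≟ z)

      #vertices≡ : + #vertices ≡ sum³ (λ x y z → 𝟙 (isSolution? (x , y , z)))
      #vertices≡ = trans (length-filter isSolution? points) (listSum-allFin³ p (𝟙 ∘ isSolution?))

      private
        count : ∀ {Q : ℕ → Set} (Q? : U.Decidable Q) (g : Fin p → Fin p → Fin p → ℤ) →
          (∀ {x y z} → IsSolution (x , y , z) → 𝟙 (Q? (moved x y z)) ≡ g x y z) →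
          + length (filter (λ v → Q? (degree v)) vertices) ≡ sum³ (λ x y z → χ x y z ℤ.* g x y z)
        count Q? g eq = trans (length-filter (λ v → Q? (degree v)) vertices)
          (trans (listSum-filter isSolution? (λ v → 𝟙 (Q? (degree v))) points)
          (trans (listSum-allFin³ p (λ v → 𝟙 (isSolution? v) ℤ.* 𝟙 (Q? (degree v))))
          (sum³-cong (λ x y z → 𝟙-*-cong (isSolution? (x , y , z)) (λ s → trans (cong (λ d → 𝟙 (Q? d)) (degree≡#moved s)) (eq s))))))

        table : ∀ {x y z} (s : IsSolution (x , y , z)) → _
        table {x} {y} {z} s = 𝟙-#moved (y * z - C - x ≟ x) (x * z - C - y ≟ y) (x * y - C - z ≟ z)
          (λ (e₁ , e₂ , e₃) → no-singular-point s e₁ e₂ e₃)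

      #deficient≡ : + #deficient ≡ sum³ (λ x y z → 𝟙 (isSolution? (x , y , z)) ℤ.* vertex-weight (ℤ.- + 1) x y z)
      #deficient≡ = count (ℕₚ._<? 3) (vertex-weight (ℤ.- + 1)) (λ s → proj₁ (table s))

      #degree2≡ : + #degree 2 ≡ sum³ (λ x y z → 𝟙 (isSolution? (x , y , z)) ℤ.* vertex-weight (ℤ.- + 2) x y z)
      #degree2≡ = count (ℕₚ._≟ 2) (vertex-weight (ℤ.- + 2)) (λ s → proj₁ (proj₂ (table s)))

      #degree1≡ : + #degree 1 ≡ sum³ (λ x y z → 𝟙 (isSolution? (x , y , z)) ℤ.* (vertex-weight (ℤ.- + 1) x y z ℤ.- vertex-weight (ℤ.- + 2) x y z))
      #degree1≡ = count (ℕₚ._≟ 1) (λ x y z → vertex-weight (ℤ.- + 1) x y z ℤ.- vertex-weight (ℤ.- + 2) x y z) (λ s → proj₁ (proj₂ (proj₂ (table s))))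

      #degree0≡ : + #degree 0 ≡ + 0
      #degree0≡ = trans (count (ℕₚ._≟ 0) (λ _ _ _ → + 0) (λ s → proj₂ (proj₂ (proj₂ (table s)))))
        (trans (sum³-cong (λ x y z → ℤₚ.*-comm (χ x y z) (+ 0))) (sum³-* (+ 0) χ))

theorem14p3 : (p : ℕ) .{{_ : NonZero p}} → Prime p → p ≥ 5 → p % 3 ≡ 1 →
    (A : ℤ) → IsA₃ p A →
    let open PrimeField p in
    (J T : 𝔽) →
    J ≢ ι 2 → J ≢ - ι 2 → J ≢ - ι 1 → J ^ 2 ≢ ι 4 / ι 3 →
    T ≢ ι 0 → (J + ι 1) / (J - ι 2) ≡ T ^ 3 →
    let C = ι 3 * J ^ 2 - ι 4
        D = ι 9 * J ^ 3 - ι 36 * J - ι 28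
        open VietaGraph C D
    in
      (+ #vertices  ≡ + p ℤ.* + p ℤ.+ + 1 ℤ.+ + 4 ℤ.* σ (ι 1 - ι 4 * T ^ 3) ℤ.* + p)
    × (+ #deficient ≡ + 3 ℤ.* (+ p ℤ.- + 6 ℤ.+ + 2 ℤ.* σ (T ^ 4 - T) ℤ.* A))
    × (+ #degree 2  ≡ + 3 ℤ.* (+ p ℤ.- + 9 ℤ.+ + 2 ℤ.* σ (T ^ 4 - T) ℤ.* A))
    × (#degree 1 ≡ 9)
    × (#degree 0 ≡ 0)
theorem14p3 p p-prime p≥5 _ A A-isA₃ J T J≢2 J≢-2 J≢-1 J²≢4/3 _ T³-eq =
    trans #vertices≡ (trans (sum³-cong χ≡) (trans count-solutions (cong (λ s → + p ℤ.* + p ℤ.+ + 1 ℤ.+ + 4 ℤ.* s ℤ.* + p) (sym σ-mn))))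
  , trans #deficient≡ (trans (sum³-cong (λ x y z → cong₂ ℤ._*_ (χ≡ x y z) (weight≡ (ℤ.- + 1) x y z)))
      (count-weighted-fixed-A₃ S≡2A (ℤ.- + 1) (+ 6) refl))
  , trans #degree2≡ (trans (sum³-cong (λ x y z → cong₂ ℤ._*_ (χ≡ x y z) (weight≡ (ℤ.- + 2) x y z)))
      (count-weighted-fixed-A₃ S≡2A (ℤ.- + 2) (+ 9) refl))
  , ℤₚ.+-injective (trans #degree1≡ (trans (sum³-cong (λ x y z → cong₂ ℤ._*_ (χ≡ x y z)
      (cong₂ ℤ._-_ (weight≡ (ℤ.- + 1) x y z) (weight≡ (ℤ.- + 2) x y z)))) count-doubly-fixed))
  , ℤₚ.+-injective #degree0≡
  where
  open PrimeField p
  K : FiniteField p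
  K = primeField p p-prime
  open FieldProperties K using (*-≢0; inv-cancelˡ; a-b≡0⇒a≡b; a≢b⇒a-b≢0; *-invˡ; *-identityʳ; *-assoc; *-comm)
  2≢0 : ι 2 ≢ ι 0
  2≢0 = small≢0 p p-prime (ℕₚ.≤-trans (ℕ.s≤s (ℕ.s≤s (ℕ.s≤s ℕ.z≤n))) p≥5)
  3≢0 : ι 3 ≢ ι 0
  3≢0 = small≢0 p p-prime (ℕₚ.≤-trans (ℕ.s≤s (ℕ.s≤s (ℕ.s≤s (ℕ.s≤s ℕ.z≤n)))) p≥5)
  C≢0 : ι 3 * J ^ 2 - ι 4 ≢ ι 0
  C≢0 eq = J²≢4/3 (begin
    J ^ 2                      ≡⟨ inv-cancelˡ (J ^ 2) 3≢0 ⟨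
    inv (ι 3) * (ι 3 * J ^ 2)  ≡⟨ cong (λ c → inv (ι 3) * c) (a-b≡0⇒a≡b eq) ⟩
    inv (ι 3) * ι 4            ≡⟨ *-comm (inv (ι 3)) (ι 4) ⟩
    ι 4 / ι 3                  ∎)
    where open ≡-Reasoning
  J+1≡T³[J-2] : J + ι 1 ≡ T ^ 3 * (J - ι 2)
  J+1≡T³[J-2] = begin
    J + ι 1                                      ≡⟨ *-identityʳ (J + ι 1) ⟨
    (J + ι 1) * ι 1                              ≡⟨ cong (λ u → (J + ι 1) * u) (*-invˡ (a≢b⇒a-b≢0 J≢2)) ⟨
    (J + ι 1) * (inv (J - ι 2) * (J - ι 2))      ≡⟨ *-assoc (J + ι 1) (inv (J - ι 2)) (J - ι 2) ⟨
    (J + ι 1) / (J - ι 2) * (J - ι 2)            ≡⟨ cong (λ u → u * (J - ι 2)) T³-eq ⟩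
    T ^ 3 * (J - ι 2)                            ∎
    where open ≡-Reasoning
  ω : 𝔽
  ω = proj₁ (cube-root-of-unity p p-prime {A} A-isA₃ 2≢0)
  ω²+ω+1≡0 : ω * ω + ω + ι 1 ≡ ι 0
  ω²+ω+1≡0 = proj₂ (cube-root-of-unity p p-prime {A} A-isA₃ 2≢0)
  open CubicSums K 2≢0 3≢0 (isQuadraticCharacter p p-prime) ω ω²+ω+1≡0 using (S; S≡2A₃)
  open Surface K 2≢0 3≢0 (isQuadraticCharacter p p-prime) ω ω²+ω+1≡0 J T J≢2 J≢-2 J≢-1 C≢0 J+1≡T³[J-2]
  open VietaGraph C D
  flip-solutions : ∀ {v w} → w ∈ flips v → IsSolution v → IsSolution w
  flip-solutions {x , y , z} (here refl)                 = solution-flip₁ {x} {y} {z}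
  flip-solutions {x , y , z} (there (here refl))         = solution-flip₂ {x} {y} {z}
  flip-solutions {x , y , z} (there (there (here refl))) = solution-flip₃ {x} {y} {z}
  no-singular : ∀ {x y z} → IsSolution (x , y , z) → y * z - C - x ≡ x → x * z - C - y ≡ y → ¬ x * y - C - z ≡ z
  no-singular {x} {y} {z} = no-singular-point {x} {y} {z}
  open VietaDegree.Counting p C D flip-involutive flip-solutions no-singular

  χ≡ : ∀ x y z → 𝟙 (isSolution? (x , y , z)) ≡ 𝟙 (solution? x y z)
  χ≡ x y z = 𝟙-cong (isSolution? (x , y , z)) (solution? x y z) id id
  fixed≡ : ∀ x y z → 𝟙 (y * z - C - x ≟ x) ≡ 𝟙 (fixed? x y z)
  fixed≡ x y z = 𝟙-cong (y * z - C - x ≟ x) (fixed? x y z) id id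
  weight≡ : ∀ k x y z → vertex-weight k x y z ≡ weight³ k x y z
  weight≡ k x y z = weight-cong k {y * z - C - x ≟ x} {x * z - C - y ≟ y} {x * y - C - z ≟ z} {fixed? x y z} {fixed? y x z} {fixed? z x y}
    (fixed≡ x y z) (fixed≡ y x z) (fixed≡ z x y)
  S≡2A : S (ι 1) ≡ + 2 ℤ.* A
  S≡2A = S≡2A₃ {A} p-prime A-isA₃
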